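{- Let $k\ge 1$ and $n$ be integers with $n>k+1$. Then $$\left|A_k(n)-C_k\,f_k(n)\,\frac{n^{k}}{k!}\right|\le \frac{2+e}{\sqrt{2\pi k}}\,(e^2\log n)^{k}\,n^{k-1}.$$
   Context: $\mathbb{N}$ denotes the positive integers, $p$ always denotes a prime, and $\log$ is the natural logarithm. For positive integers $k,n$: $A_k(n)$ is the number of tuples $(x,y_1,\dots,y_k)\in\mathbb{N}^{k+1}$ with $n=x+y_1+\cdots+y_k$ and $\gcd(x,y_1\cdots y_k)=1$. $\psi_k(x)=\dfrac{x^k-(x-1)^k+(-1)^k}{x}$. $C_k=\prod_{p}\left(1-\dfrac{\psi_k(p)}{p^k}\right)$, the product being over all primes $p$. $f_k(n)=\prod_{p\mid n}\left(1+\dfrac{(-1)^k}{p^k-\psi_k(p)}\right)$, the product being over the primes $p$ dividing $n$. -}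

module Defs where

open import Data.Empty using (⊥-elim)
open import Data.Integer as ℤ using (+_)
import Data.Integer.Properties as ℤ
open import Data.List as List using (List; []; _∷_)
open import Data.Nat as ℕ using (ℕ; zero; suc; _!; z≤n; s≤s)
import Data.Nat.Divisibility as ℕ
import Data.Nat.DivMod as ℕ
import Data.Nat.GCD as ℕ
import Data.Nat.Properties as ℕ
open import Data.Nat.Primality using (Prime; prime?; prime⇒nonZero; prime⇒nonTrivial)
import Data.Nat.Solver as ℕ
open import Data.Product using (∃-syntax; _×_; _,_; proj₁; proj₂)
open import Data.Rational as ℚ using (ℚ; 0ℚ; 1ℚ; ½)
import Data.Rational.Properties as ℚ
import Data.Rational.Solver as ℚ
open import Data.Rational.Unnormalised as ℚᵘ using (mkℚᵘ; *≤*; *<*)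
import Data.Rational.Unnormalised.Properties as ℚᵘ
open import Data.Sum using (_⊎_; inj₁; inj₂; [_,_]′)
open import Data.Vec as Vec using (Vec; []; _∷_)
open import Relation.Binary.PropositionalEquality
  using (_≡_; refl; sym; trans; cong; cong₂; subst; subst₂)
open import Relation.Nullary using (Dec; yes; no; contradiction)
open import Relation.Nullary.Decidable using (_×-dec_)
open import Relation.Unary using (Decidable)

private
  module RS = ℚ.+-*-Solver
  module NS = ℕ.+-*-Solver

  κ : ∀ {n} → ℕ → NS.Polynomial n
  κ = NS.con

infix 8 _//_

_//_ : (a b : ℕ) → .{{ℕ.NonZero b}} → ℚ
a // b = + a ℚ./ b

/-toℚᵘ : ∀ i d → ℚ.toℚᵘ (i ℚ./ suc d) ℚᵘ.≃ mkℚᵘ i d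
/-toℚᵘ i d = ℚ.toℚᵘ-fromℚᵘ (mkℚᵘ i d)

/-mono-≤ : ∀ i j b d .{{_ : ℕ.NonZero b}} .{{_ : ℕ.NonZero d}} →
           i ℤ.* + d ℤ.≤ j ℤ.* + b → i ℚ./ b ℚ.≤ j ℚ./ d
/-mono-≤ i j (suc b) (suc d) h = ℚ.toℚᵘ-cancel-≤
  (ℚᵘ.≤-respˡ-≃ (ℚᵘ.≃-sym (/-toℚᵘ i b)) (ℚᵘ.≤-respʳ-≃ (ℚᵘ.≃-sym (/-toℚᵘ j d)) (*≤* h)))

/-mono-< : ∀ i j b d .{{_ : ℕ.NonZero b}} .{{_ : ℕ.NonZero d}} →
           i ℤ.* + d ℤ.< j ℤ.* + b → i ℚ./ b ℚ.< j ℚ./ d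
/-mono-< i j (suc b) (suc d) h = ℚ.toℚᵘ-cancel-<
  (ℚᵘ.<-respˡ-≃ (ℚᵘ.≃-sym (/-toℚᵘ i b)) (ℚᵘ.<-respʳ-≃ (ℚᵘ.≃-sym (/-toℚᵘ j d)) (*<* h)))

//-mono-≤ : ∀ a c b d .{{_ : ℕ.NonZero b}} .{{_ : ℕ.NonZero d}} →
            a ℕ.* d ℕ.≤ c ℕ.* b → a // b ℚ.≤ c // d
//-mono-≤ a c b d h = /-mono-≤ (+ a) (+ c) b d
  (subst₂ ℤ._≤_ (ℤ.pos-* a d) (ℤ.pos-* c b) (ℤ.+≤+ h))

//-mono-< : ∀ a c b d .{{_ : ℕ.NonZero b}} .{{_ : ℕ.NonZero d}} →
            a ℕ.* d ℕ.< c ℕ.* b → a // b ℚ.< c // d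
//-mono-< a c b d h = /-mono-< (+ a) (+ c) b d
  (subst₂ ℤ._<_ (ℤ.pos-* a d) (ℤ.pos-* c b) (ℤ.+<+ h))

//-cong : ∀ a c b d .{{_ : ℕ.NonZero b}} .{{_ : ℕ.NonZero d}} →
          a ℕ.* d ≡ c ℕ.* b → a // b ≡ c // d
//-cong a c b d h = ℚ.≤-antisym (//-mono-≤ a c b d (ℕ.≤-reflexive h))
                                (//-mono-≤ c a d b (ℕ.≤-reflexive (sym h)))

//-* : ∀ a c b d .{{_ : ℕ.NonZero b}} .{{_ : ℕ.NonZero d}} .{{_ : ℕ.NonZero (b ℕ.* d)}} →
       (a // b) ℚ.* (c // d) ≡ (a ℕ.* c) // (b ℕ.* d)
//-* a c (suc b) (suc d) = ℚ.toℚᵘ-injective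
  (ℚᵘ.≃-trans (ℚ.toℚᵘ-homo-* (a // suc b) (c // suc d))
  (ℚᵘ.≃-trans (ℚᵘ.*-cong (/-toℚᵘ (+ a) b) (/-toℚᵘ (+ c) d))
  (ℚᵘ.≃-trans (ℚᵘ.*≡* (cong₂ ℤ._*_ (sym (ℤ.pos-* a c)) refl))
  (ℚᵘ.≃-sym (/-toℚᵘ (+ (a ℕ.* c)) _)))))

//-+ : ∀ a c b d .{{_ : ℕ.NonZero b}} .{{_ : ℕ.NonZero d}} .{{_ : ℕ.NonZero (b ℕ.* d)}} →
       (a // b) ℚ.+ (c // d) ≡ (a ℕ.* d ℕ.+ c ℕ.* b) // (b ℕ.* d)
//-+ a c (suc b) (suc d) = ℚ.toℚᵘ-injective
  (ℚᵘ.≃-trans (ℚ.toℚᵘ-homo-+ (a // suc b) (c // suc d))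
  (ℚᵘ.≃-trans (ℚᵘ.+-cong (/-toℚᵘ (+ a) b) (/-toℚᵘ (+ c) d))
  (ℚᵘ.≃-trans (ℚᵘ.*≡* (cong₂ ℤ._*_ {u = + (suc b ℕ.* suc d)}
      (sym (trans (ℤ.pos-+ (a ℕ.* suc d) (c ℕ.* suc b))
                  (cong₂ ℤ._+_ (ℤ.pos-* a (suc d)) (ℤ.pos-* c (suc b))))) refl))
  (ℚᵘ.≃-sym (/-toℚᵘ (+ (a ℕ.* suc d ℕ.+ c ℕ.* suc b)) _)))))

0≤// : ∀ a b .{{_ : ℕ.NonZero b}} → 0ℚ ℚ.≤ a // b
0≤// a b = //-mono-≤ 0 a 1 b z≤n

0<// : ∀ a b .{{_ : ℕ.NonZero a}} .{{_ : ℕ.NonZero b}} → 0ℚ ℚ.< a // b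
0<// (suc a) b = //-mono-< 0 (suc a) 1 b (s≤s z≤n)

archimedean : ∀ ε → 0ℚ ℚ.< ε → ∃[ N ] (∀ m → N ℕ.≤ m → 1 // suc m ℚ.≤ ε)
archimedean ε@(ℚ.mkℚ ℤ.+[1+ a ] d _) 0<ε = d , λ m d≤m →
  subst (1 // suc m ℚ.≤_) (ℚ.↥p/↧p≡p ε) (//-mono-≤ 1 (suc a) (suc m) (suc d)
    (ℕ.≤-trans (ℕ.≤-reflexive (ℕ.*-identityˡ (suc d)))
    (ℕ.≤-trans (s≤s d≤m) (ℕ.m≤n*m (suc m) (suc a)))))
archimedean (ℚ.mkℚ (+ zero) d _) (ℚ.*<* (ℤ.+<+ ()))
archimedean (ℚ.mkℚ (ℤ.-[1+ _ ]) d _) (ℚ.*<* ())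

*-mono : ∀ {a b c d} → 0ℚ ℚ.≤ a → a ℚ.≤ b → 0ℚ ℚ.≤ c → c ℚ.≤ d → a ℚ.* c ℚ.≤ b ℚ.* d
*-mono {a} {b} {c} {d} 0≤a a≤b 0≤c c≤d = ℚ.≤-trans
  (ℚ.*-monoʳ-≤-nonNeg c {{ℚ.nonNegative 0≤c}} a≤b)
  (ℚ.*-monoˡ-≤-nonNeg b {{ℚ.nonNegative (ℚ.≤-trans 0≤a a≤b)}} c≤d)

0≤* : ∀ {a b} → 0ℚ ℚ.≤ a → 0ℚ ℚ.≤ b → 0ℚ ℚ.≤ a ℚ.* b
0≤* {a} {b} 0≤a 0≤b = subst (ℚ._≤ a ℚ.* b) (ℚ.*-zeroˡ 0ℚ) (*-mono ℚ.≤-refl 0≤a ℚ.≤-refl 0≤b)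

0<* : ∀ {a b} → 0ℚ ℚ.< a → 0ℚ ℚ.< b → 0ℚ ℚ.< a ℚ.* b
0<* {a} {b} 0<a 0<b = subst (ℚ._< a ℚ.* b) (ℚ.*-zeroˡ b)
  (ℚ.*-monoˡ-<-pos b {{ℚ.positive 0<b}} 0<a)

+-neg : ∀ p → p ℚ.- p ≡ 0ℚ
+-neg = ℚ.+-inverseʳ

0≤⇒≤ : ∀ {p q} → 0ℚ ℚ.≤ q ℚ.- p → p ℚ.≤ q
0≤⇒≤ {p} {q} h = subst₂ ℚ._≤_ (ℚ.+-identityˡ p)
  (RS.solve 2 (λ p q → (q RS.:- p) RS.:+ p RS.:= q) refl p q) (ℚ.+-monoˡ-≤ p h)

≤⇒0≤ : ∀ {p q} → p ℚ.≤ q → 0ℚ ℚ.≤ q ℚ.- p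
≤⇒0≤ {p} {q} h = subst (ℚ._≤ q ℚ.- p) (+-neg p) (ℚ.+-monoˡ-≤ (ℚ.- p) h)

<⇒0< : ∀ {p q} → p ℚ.< q → 0ℚ ℚ.< q ℚ.- p
<⇒0< {p} {q} h = subst (ℚ._< q ℚ.- p) (+-neg p) (ℚ.+-monoˡ-< (ℚ.- p) h)

neg-sub : ∀ p q → ℚ.- (p ℚ.- q) ≡ q ℚ.- p
neg-sub = RS.solve 2 (λ p q → RS.:- (p RS.:- q) RS.:= q RS.:- p) refl

∣-∣-swap : ∀ p q → ℚ.∣ p ℚ.- q ∣ ≡ ℚ.∣ q ℚ.- p ∣
∣-∣-swap p q = trans (sym (ℚ.∣-p∣≡∣p∣ (p ℚ.- q))) (cong ℚ.∣_∣ (neg-sub p q))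

≤∣∣ : ∀ p → p ℚ.≤ ℚ.∣ p ∣
≤∣∣ p@(ℚ.mkℚ (+ n) d _)       = ℚ.≤-refl
≤∣∣ p@(ℚ.mkℚ (ℤ.-[1+ n ]) d _) = ℚ.≤-trans {j = 0ℚ} (ℚ.nonPositive⁻¹ p) (ℚ.nonNegative⁻¹ ℚ.∣ p ∣)

∣∣≤ : ∀ {p q} → p ℚ.≤ q → ℚ.- p ℚ.≤ q → ℚ.∣ p ∣ ℚ.≤ q
∣∣≤ {p} {q} h₁ h₂ with ℚ.∣p∣≡p∨∣p∣≡-p p
... | inj₁ e = subst (ℚ._≤ q) (sym e) h₁
... | inj₂ e = subst (ℚ._≤ q) (sym e) h₂

∣-∣≤ : ∀ {p q ε} → p ℚ.≤ q ℚ.+ ε → q ℚ.≤ p ℚ.+ ε → ℚ.∣ p ℚ.- q ∣ ℚ.≤ ε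
∣-∣≤ {p} {q} {ε} h₁ h₂ = ∣∣≤ (lem h₁) (subst (ℚ._≤ ε) (sym (neg-sub p q)) (lem h₂))
  where
  lem : ∀ {x y} → x ℚ.≤ y ℚ.+ ε → x ℚ.- y ℚ.≤ ε
  lem {x} {y} h = subst (x ℚ.- y ℚ.≤_)
    (RS.solve 2 (λ y ε → (y RS.:+ ε) RS.:- y RS.:= ε) refl y ε) (ℚ.+-monoˡ-≤ (ℚ.- y) h)

≤+∣-∣ : ∀ p q → p ℚ.≤ q ℚ.+ ℚ.∣ p ℚ.- q ∣
≤+∣-∣ p q = subst (ℚ._≤ q ℚ.+ ℚ.∣ p ℚ.- q ∣)
  (RS.solve 2 (λ p q → q RS.:+ (p RS.:- q) RS.:= p) refl p q) (ℚ.+-monoʳ-≤ q (≤∣∣ (p ℚ.- q)))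

∣-∣⇒≤ : ∀ {p q ε} → ℚ.∣ p ℚ.- q ∣ ℚ.≤ ε → p ℚ.≤ q ℚ.+ ε
∣-∣⇒≤ {p} {q} h = ℚ.≤-trans (≤+∣-∣ p q) (ℚ.+-monoʳ-≤ q h)

∣∣-lipschitz : ∀ p q → ℚ.∣ ℚ.∣ p ∣ ℚ.- ℚ.∣ q ∣ ∣ ℚ.≤ ℚ.∣ p ℚ.- q ∣
∣∣-lipschitz p q = ∣-∣≤ (lem p q) (subst (λ z → ℚ.∣ q ∣ ℚ.≤ ℚ.∣ p ∣ ℚ.+ z) (∣-∣-swap q p) (lem q p))
  where
  lem : ∀ p q → ℚ.∣ p ∣ ℚ.≤ ℚ.∣ q ∣ ℚ.+ ℚ.∣ p ℚ.- q ∣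
  lem p q = subst (λ z → ℚ.∣ z ∣ ℚ.≤ ℚ.∣ q ∣ ℚ.+ ℚ.∣ p ℚ.- q ∣)
    (RS.solve 2 (λ p q → q RS.:+ (p RS.:- q) RS.:= p) refl p q) (ℚ.∣p+q∣≤∣p∣+∣q∣ q (p ℚ.- q))

½ε+½ε : ∀ ε → ½ ℚ.* ε ℚ.+ ½ ℚ.* ε ≡ ε
½ε+½ε ε = trans (sym (ℚ.*-distribʳ-+ ε ½ ½)) (ℚ.*-identityˡ ε)

0<½* : ∀ {ε} → 0ℚ ℚ.< ε → 0ℚ ℚ.< ½ ℚ.* ε
0<½* = 0<* (ℚ.positive⁻¹ ½)

Cauchy : (ℕ → ℚ) → Set
Cauchy s = ∀ ε → 0ℚ ℚ.< ε →
  ∃[ N ] (∀ m n → N ℕ.≤ m → N ℕ.≤ n → ℚ.∣ s m ℚ.- s n ∣ ℚ.≤ ε)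

record ℝ : Set where
  no-eta-equality
  field
    approx : ℕ → ℚ
    cauchy : Cauchy approx

open ℝ public

infix 4 _≤_

-- comparison of the limits
_≤_ : ℝ → ℝ → Set
x ≤ y = ∀ ε → 0ℚ ℚ.< ε → ∃[ N ] (∀ m → N ℕ.≤ m → approx x m ℚ.≤ approx y m ℚ.+ ε)

record Positive (x : ℝ) : Set where
  no-eta-equality
  field
    bound   : ℚ
    0<bound : 0ℚ ℚ.< bound
    index   : ℕ
    bound≤  : ∀ m → index ℕ.≤ m → bound ℚ.≤ approx x m

open Positive public

bounded : ∀ x → ∃[ B ] (0ℚ ℚ.< B × ∃[ N ] (∀ m → N ℕ.≤ m → ℚ.∣ approx x m ∣ ℚ.≤ B))
bounded x = let s = approx x ; N , h = cauchy x 1ℚ (ℚ.positive⁻¹ 1ℚ) in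
                ℚ.∣ s N ∣ ℚ.+ 1ℚ
            , ℚ.+-mono-≤-< (ℚ.nonNegative⁻¹ ℚ.∣ s N ∣ {{ℚ.∣-∣-nonNeg (s N)}}) (ℚ.positive⁻¹ 1ℚ)
            , N , λ m N≤m → ∣-∣⇒≤ (ℚ.≤-trans (∣∣-lipschitz (s m) (s N)) (h m N N≤m ℕ.≤-refl))

fromℚ : ℚ → ℝ
approx (fromℚ q) _ = q
cauchy (fromℚ q) ε 0<ε = 0 , λ _ _ _ _ →
  subst (ℚ._≤ ε) (sym (cong ℚ.∣_∣ (+-neg q))) (ℚ.<⇒≤ 0<ε)

fromℕ : ℕ → ℝ
approx (fromℕ n) = approx (fromℚ (n // 1))
cauchy (fromℕ n) = cauchy (fromℚ (n // 1))

infixl 6 _+_ _-_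
infixl 7 _*_ _/_
infixr 8 _^_
infix  8 -_

_+_ : ℝ → ℝ → ℝ
approx (x + y) m = approx x m ℚ.+ approx y m
cauchy (x + y) ε 0<ε =
  let s = approx x
      t = approx y
      N₁ , h₁ = cauchy x (½ ℚ.* ε) (0<½* 0<ε)
      N₂ , h₂ = cauchy y (½ ℚ.* ε) (0<½* 0<ε)
  in N₁ ℕ.⊔ N₂ , λ m n N≤m N≤n → subst₂ ℚ._≤_
       (cong ℚ.∣_∣ (eq (s m) (s n) (t m) (t n))) (½ε+½ε ε)
       (ℚ.≤-trans (ℚ.∣p+q∣≤∣p∣+∣q∣ (s m ℚ.- s n) (t m ℚ.- t n))
         (ℚ.+-mono-≤ (h₁ m n (ℕ.m⊔n≤o⇒m≤o N₁ N₂ N≤m) (ℕ.m⊔n≤o⇒m≤o N₁ N₂ N≤n))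
                     (h₂ m n (ℕ.m⊔n≤o⇒n≤o N₁ N₂ N≤m) (ℕ.m⊔n≤o⇒n≤o N₁ N₂ N≤n))))
  where
  eq : ∀ a b c d → (a ℚ.- b) ℚ.+ (c ℚ.- d) ≡ (a ℚ.+ c) ℚ.- (b ℚ.+ d)
  eq = RS.solve 4 (λ a b c d → (a RS.:- b) RS.:+ (c RS.:- d) RS.:= (a RS.:+ c) RS.:- (b RS.:+ d)) refl

-_ : ℝ → ℝ
approx (- x) m = ℚ.- approx x m
cauchy (- x) ε 0<ε =
  let s = approx x
      N , h = cauchy x ε 0<ε
  in N , λ m n N≤m N≤n → subst (ℚ._≤ ε)
       (trans (sym (ℚ.∣-p∣≡∣p∣ (s m ℚ.- s n))) (cong ℚ.∣_∣ (ℚ.neg-distrib-+ (s m) (ℚ.- s n))))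
       (h m n N≤m N≤n)

_-_ : ℝ → ℝ → ℝ
x - y = x + - y

∣_∣ : ℝ → ℝ
approx ∣ x ∣ m = ℚ.∣ approx x m ∣
cauchy ∣ x ∣ ε 0<ε =
  let s = approx x
      N , h = cauchy x ε 0<ε
  in N , λ m n N≤m N≤n → ℚ.≤-trans (∣∣-lipschitz (s m) (s n)) (h m n N≤m N≤n)

-- Extended by 0 at 0; for a positive real only finitely many approximations
-- are affected.
recip : ℚ → ℚ
recip q with q ℚ.≟ 0ℚ
... | yes _   = 0ℚ
... | no  q≢0 = ℚ.1/_ q {{ℚ.≢-nonZero q≢0}}

recip-inverse : ∀ {q} → 0ℚ ℚ.< q → recip q ℚ.* q ≡ 1ℚ
recip-inverse {q} 0<q with q ℚ.≟ 0ℚ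
... | yes q≡0 = contradiction (sym q≡0) (ℚ.<⇒≢ 0<q)
... | no  q≢0 = ℚ.*-inverseˡ q {{ℚ.≢-nonZero q≢0}}

0<recip : ∀ {q} → 0ℚ ℚ.< q → 0ℚ ℚ.< recip q
0<recip {q} 0<q = ℚ.*-cancelʳ-<-nonNeg q {{ℚ.nonNegative (ℚ.<⇒≤ 0<q)}}
  (subst₂ ℚ._<_ (sym (ℚ.*-zeroˡ q)) (sym (recip-inverse 0<q)) (ℚ.positive⁻¹ 1ℚ))

_*_ : ℝ → ℝ → ℝ
approx (x * y) m = approx x m ℚ.* approx y m
cauchy (x * y) ε 0<ε =
  let s = approx x
      t = approx y
      B , 0<B , M₁ , b = bounded x
      D , 0<D , M₂ , d = bounded y
      0<ε′ = 0<½* 0<ε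
      N₁ , h₁ = cauchy x (recip D ℚ.* (½ ℚ.* ε)) (0<* (0<recip 0<D) 0<ε′)
      N₂ , h₂ = cauchy y (recip B ℚ.* (½ ℚ.* ε)) (0<* (0<recip 0<B) 0<ε′)
      K₁ = M₁ ℕ.⊔ N₁
      K₂ = M₂ ℕ.⊔ N₂
  in K₁ ℕ.⊔ K₂ , λ m n K≤m K≤n →
    let m₁ = ℕ.m⊔n≤o⇒m≤o K₁ K₂ K≤m
        m₂ = ℕ.m⊔n≤o⇒n≤o K₁ K₂ K≤m
        n₁ = ℕ.m⊔n≤o⇒m≤o K₁ K₂ K≤n
        n₂ = ℕ.m⊔n≤o⇒n≤o K₁ K₂ K≤n
    in subst₂ ℚ._≤_ (cong ℚ.∣_∣ (eq (s m) (s n) (t m) (t n))) (½ε+½ε ε)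
      (ℚ.≤-trans (ℚ.∣p+q∣≤∣p∣+∣q∣ (s m ℚ.* (t m ℚ.- t n)) (t n ℚ.* (s m ℚ.- s n)))
        (ℚ.+-mono-≤
          (bnd 0<B (b m (ℕ.m⊔n≤o⇒m≤o M₁ N₁ m₁))
                   (h₂ m n (ℕ.m⊔n≤o⇒n≤o M₂ N₂ m₂) (ℕ.m⊔n≤o⇒n≤o M₂ N₂ n₂)))
          (bnd 0<D (d n (ℕ.m⊔n≤o⇒m≤o M₂ N₂ n₂))
                   (h₁ m n (ℕ.m⊔n≤o⇒n≤o M₁ N₁ m₁) (ℕ.m⊔n≤o⇒n≤o M₁ N₁ n₁)))))
  where
  eq : ∀ a b c d → a ℚ.* (c ℚ.- d) ℚ.+ d ℚ.* (a ℚ.- b) ≡ a ℚ.* c ℚ.- b ℚ.* d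
  eq = RS.solve 4 (λ a b c d →
    a RS.:* (c RS.:- d) RS.:+ d RS.:* (a RS.:- b) RS.:= a RS.:* c RS.:- b RS.:* d) refl
  bnd : ∀ {B p q η} → 0ℚ ℚ.< B → ℚ.∣ p ∣ ℚ.≤ B → ℚ.∣ q ∣ ℚ.≤ recip B ℚ.* η → ℚ.∣ p ℚ.* q ∣ ℚ.≤ η
  bnd {B} {p} {q} {η} 0<B hp hq = subst₂ ℚ._≤_ (sym (ℚ.∣p*q∣≡∣p∣*∣q∣ p q))
    (trans (sym (ℚ.*-assoc B (recip B) η))
      (trans (cong (ℚ._* η) (trans (ℚ.*-comm B (recip B)) (recip-inverse 0<B))) (ℚ.*-identityˡ η)))
    (*-mono (ℚ.nonNegative⁻¹ _ {{ℚ.∣-∣-nonNeg p}}) hp (ℚ.nonNegative⁻¹ _ {{ℚ.∣-∣-nonNeg q}}) hq)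

_^_ : ℝ → ℕ → ℝ
x ^ zero  = fromℕ 1
x ^ suc n = x * x ^ n

reciprocal : (x : ℝ) → Positive x → ℝ
approx (reciprocal x x>0) m = recip (approx x m)
cauchy (reciprocal x x>0) ε 0<ε =
  let M = index x>0
      p = bound≤ x>0
      N , h = cauchy x (ε ℚ.* (δ ℚ.* δ)) (0<* 0<ε (0<* 0<δ 0<δ))
  in M ℕ.⊔ N , λ m n K≤m K≤n →
    bnd (p m (ℕ.m⊔n≤o⇒m≤o M N K≤m)) (p n (ℕ.m⊔n≤o⇒m≤o M N K≤n))
        (h m n (ℕ.m⊔n≤o⇒n≤o M N K≤m) (ℕ.m⊔n≤o⇒n≤o M N K≤n))
  where
  δ = bound x>0
  0<δ = 0<bound x>0
  eq : ∀ a b r q → r ℚ.* a ≡ 1ℚ → q ℚ.* b ≡ 1ℚ → (r ℚ.* q) ℚ.* (b ℚ.- a) ≡ r ℚ.- q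
  eq a b r q ra qb = trans
    (RS.solve 4 (λ a b r q → (r RS.:* q) RS.:* (b RS.:- a) RS.:= r RS.:* (q RS.:* b) RS.:- q RS.:* (r RS.:* a)) refl a b r q)
    (cong₂ ℚ._-_ (trans (cong (r ℚ.*_) qb) (ℚ.*-identityʳ r)) (trans (cong (q ℚ.*_) ra) (ℚ.*-identityʳ q)))
  bnd : ∀ {a b ε} → δ ℚ.≤ a → δ ℚ.≤ b → ℚ.∣ a ℚ.- b ∣ ℚ.≤ ε ℚ.* (δ ℚ.* δ) →
        ℚ.∣ recip a ℚ.- recip b ∣ ℚ.≤ ε
  bnd {a} {b} {ε} δ≤a δ≤b h = ℚ.*-cancelʳ-≤-pos (δ ℚ.* δ) {{ℚ.positive (0<* 0<δ 0<δ)}} (ℚ.≤-trans step h)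
    where
    0<a = ℚ.<-≤-trans 0<δ δ≤a
    0<b = ℚ.<-≤-trans 0<δ δ≤b
    r = recip a
    q = recip b
    0≤r = ℚ.<⇒≤ (0<recip 0<a)
    0≤q = ℚ.<⇒≤ (0<recip 0<b)
    D = ℚ.∣ b ℚ.- a ∣
    rδ≤1 : ∀ {x} → δ ℚ.≤ x → recip x ℚ.* δ ℚ.≤ 1ℚ
    rδ≤1 {x} δ≤x = subst (recip x ℚ.* δ ℚ.≤_) (recip-inverse 0<x)
      (ℚ.*-monoˡ-≤-nonNeg (recip x) {{ℚ.nonNegative (ℚ.<⇒≤ (0<recip 0<x))}} δ≤x)
      where 0<x = ℚ.<-≤-trans 0<δ δ≤x
    abs-rq : ℚ.∣ r ℚ.* q ∣ ≡ r ℚ.* q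
    abs-rq = ℚ.0≤p⇒∣p∣≡p (0≤* 0≤r 0≤q)
    step : ℚ.∣ r ℚ.- q ∣ ℚ.* (δ ℚ.* δ) ℚ.≤ ℚ.∣ a ℚ.- b ∣
    step = subst₂ ℚ._≤_
      (sym (trans (cong (λ z → ℚ.∣ z ∣ ℚ.* (δ ℚ.* δ)) (sym (eq a b r q (recip-inverse 0<a) (recip-inverse 0<b))))
        (trans (cong (ℚ._* (δ ℚ.* δ)) (trans (ℚ.∣p*q∣≡∣p∣*∣q∣ (r ℚ.* q) (b ℚ.- a)) (cong (ℚ._* D) abs-rq)))
          (RS.solve 4 (λ r q D δ → ((r RS.:* q) RS.:* D) RS.:* (δ RS.:* δ) RS.:= ((r RS.:* δ) RS.:* (q RS.:* δ)) RS.:* D) refl r q D δ))))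
      (trans (ℚ.*-identityˡ D) (∣-∣-swap b a))
      (ℚ.*-monoʳ-≤-nonNeg D {{ℚ.∣-∣-nonNeg (b ℚ.- a)}}
        (*-mono (0≤* 0≤r (ℚ.<⇒≤ 0<δ)) (rδ≤1 δ≤a) (0≤* 0≤q (ℚ.<⇒≤ 0<δ)) (rδ≤1 δ≤b)))

_/_ : (x y : ℝ) → {{Positive y}} → ℝ
_/_ x y {{0<y}} = x * reciprocal y 0<y

-- ⌊ √ n ⌋
isqrt : ℕ → ℕ
isqrt zero = 0
isqrt (suc n) with suc (isqrt n) ℕ.* suc (isqrt n) ℕ.≤? suc n
... | yes _ = suc (isqrt n)
... | no  _ = isqrt n

isqrt-lower : ∀ n → isqrt n ℕ.* isqrt n ℕ.≤ n
isqrt-lower zero = z≤n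
isqrt-lower (suc n) with suc (isqrt n) ℕ.* suc (isqrt n) ℕ.≤? suc n
... | yes h = h
... | no  _ = ℕ.m≤n⇒m≤1+n (isqrt-lower n)

isqrt-upper : ∀ n → n ℕ.< suc (isqrt n) ℕ.* suc (isqrt n)
isqrt-upper zero = s≤s z≤n
isqrt-upper (suc n) with suc (isqrt n) ℕ.* suc (isqrt n) ℕ.≤? suc n
... | no  h = ℕ.≰⇒> h
... | yes _ = ℕ.≤-<-trans (isqrt-upper n)
                (ℕ.*-mono-< (ℕ.n<1+n (suc (isqrt n))) (ℕ.n<1+n (suc (isqrt n))))

-- ⌊ √ ⌊ q M² ⌋ ⌋ / M, which for q ≥ 0 approximates √ q from below to within 1 / M
√approx : (M : ℕ) → .{{ℕ.NonZero M}} → ℚ → ℚ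
√approx M q = isqrt ((ℤ.∣ ℚ.↥ q ∣ ℕ.* (M ℕ.* M)) ℕ./ ℚ.↧ₙ q) // M

√approx-lower : ∀ m q → 0ℚ ℚ.≤ q → √approx (suc m) q ℚ.* √approx (suc m) q ℚ.≤ q
√approx-lower m q@(ℚ.mkℚ ℤ.-[1+ _ ] d _) (ℚ.*≤* ())
√approx-lower m q@(ℚ.mkℚ (+ a) d _) _ = subst₂ ℚ._≤_ (sym (//-* s s M M)) (ℚ.↥p/↧p≡p q)
  (//-mono-≤ (s ℕ.* s) a (M ℕ.* M) (suc d)
    (ℕ.≤-trans (ℕ.*-monoˡ-≤ (suc d) (isqrt-lower ((a ℕ.* (M ℕ.* M)) ℕ./ suc d)))
               (ℕ.m/n*n≤m (a ℕ.* (M ℕ.* M)) (suc d))))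
  where
  M = suc m
  s = isqrt ((a ℕ.* (M ℕ.* M)) ℕ./ suc d)

√approx-upper : ∀ m q → 0ℚ ℚ.≤ q →
  q ℚ.≤ (√approx (suc m) q ℚ.+ 1 // suc m) ℚ.* (√approx (suc m) q ℚ.+ 1 // suc m)
√approx-upper m q@(ℚ.mkℚ ℤ.-[1+ _ ] d _) (ℚ.*≤* ())
√approx-upper m q@(ℚ.mkℚ (+ a) d _) _ = subst₂ ℚ._≤_ (ℚ.↥p/↧p≡p q)
  (sym (trans (cong₂ ℚ._*_ eq eq) (//-* (suc s) (suc s) M M)))
  (//-mono-≤ a (suc s ℕ.* suc s) (suc d) (M ℕ.* M)
    (ℕ.≤-trans (ℕ.≤-trans (ℕ.≤-reflexive (ℕ.m≡m%n+[m/n]*n (a ℕ.* (M ℕ.* M)) (suc d)))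
                           (ℕ.+-monoˡ-≤ (N ℕ.* suc d) (ℕ.<⇒≤ (ℕ.m%n<n (a ℕ.* (M ℕ.* M)) (suc d)))))
      (ℕ.*-monoˡ-≤ (suc d) (isqrt-upper N))))
  where
  M = suc m
  N = (a ℕ.* (M ℕ.* M)) ℕ./ suc d
  s = isqrt N
  eq : s // M ℚ.+ 1 // M ≡ suc s // M
  eq = trans (//-+ s 1 M M) (//-cong (s ℕ.* M ℕ.+ 1 ℕ.* M) (suc s) (M ℕ.* M) M
    (NS.solve 2 (λ s M → (s NS.:* M NS.:+ κ 1 NS.:* M) NS.:* M NS.:= (κ 1 NS.:+ s) NS.:* (M NS.:* M)) refl s M))

sq-cancel-≤ : ∀ {a b} → 0ℚ ℚ.≤ a → 0ℚ ℚ.≤ b → a ℚ.* a ℚ.≤ b ℚ.* b → a ℚ.≤ b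
sq-cancel-≤ {a} {b} 0≤a 0≤b h with a ℚ.≤? b
... | yes a≤b = a≤b
... | no  a≰b = ⊥-elim (ℚ.<-irrefl refl (ℚ.≤-<-trans h
  (ℚ.≤-<-trans (ℚ.*-monoˡ-≤-nonNeg b {{ℚ.nonNegative 0≤b}} (ℚ.<⇒≤ b<a))
               (ℚ.*-monoˡ-<-pos a {{ℚ.positive (ℚ.≤-<-trans 0≤b b<a)}} b<a))))
  where b<a = ℚ.≰⇒> a≰b

0≤+ : ∀ {a b} → 0ℚ ℚ.≤ a → 0ℚ ℚ.≤ b → 0ℚ ℚ.≤ a ℚ.+ b
0≤+ = ℚ.+-mono-≤

root-≤ : ∀ {a b η q q′} → 0ℚ ℚ.≤ a → 0ℚ ℚ.≤ b → 0ℚ ℚ.≤ η → a ℚ.* a ℚ.≤ q → q′ ℚ.≤ b ℚ.* b →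
         q ℚ.≤ q′ ℚ.+ η ℚ.* η → a ℚ.≤ b ℚ.+ η
root-≤ {a} {b} {η} 0≤a 0≤b 0≤η ha hb h = sq-cancel-≤ 0≤a (0≤+ 0≤b 0≤η)
  (ℚ.≤-trans ha (ℚ.≤-trans h (ℚ.≤-trans (ℚ.+-monoˡ-≤ (η ℚ.* η) hb)
    (0≤⇒≤ (subst (0ℚ ℚ.≤_)
      (RS.solve 2 (λ b η → b RS.:* η RS.:+ b RS.:* η RS.:= (b RS.:+ η) RS.:* (b RS.:+ η) RS.:- (b RS.:* b RS.:+ η RS.:* η)) refl b η)
      (0≤+ (0≤* 0≤b 0≤η) (0≤* 0≤b 0≤η)))))))

0≤√approx : ∀ m q → 0ℚ ℚ.≤ √approx (suc m) q
0≤√approx m q = 0≤// (isqrt ((ℤ.∣ ℚ.↥ q ∣ ℕ.* (suc m ℕ.* suc m)) ℕ./ ℚ.↧ₙ q)) (suc m)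

√approx-≤ : ∀ m n p q η → 0ℚ ℚ.≤ p → 0ℚ ℚ.≤ q → 0ℚ ℚ.≤ η → 1 // suc n ℚ.≤ η →
            ℚ.∣ p ℚ.- q ∣ ℚ.≤ η ℚ.* η → √approx (suc m) p ℚ.≤ √approx (suc n) q ℚ.+ (η ℚ.+ η)
√approx-≤ m n p q η 0≤p 0≤q 0≤η u≤η h = ℚ.≤-trans
  (root-≤ (0≤√approx m p) (0≤+ (0≤√approx n q) (0≤// 1 (suc n))) 0≤η
    (√approx-lower m p 0≤p) (√approx-upper n q 0≤q) (∣-∣⇒≤ h))
  (subst ((√approx (suc n) q ℚ.+ 1 // suc n) ℚ.+ η ℚ.≤_) (ℚ.+-assoc (√approx (suc n) q) η η)
    (ℚ.+-monoˡ-≤ η (ℚ.+-monoʳ-≤ (√approx (suc n) q) u≤η)))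

√ : (x : ℝ) → {{Positive x}} → ℝ
approx (√ x) m = √approx (suc m) (approx x m)
cauchy (√ x {{x>0}}) ε 0<ε =
  let s     = approx x
      M     = index x>0
      p     = bound≤ x>0
      η     = ½ ℚ.* ε
      0<η   = 0<½* 0<ε
      N₁ , h = cauchy x (η ℚ.* η) (0<* 0<η 0<η)
      N₂ , u = archimedean η 0<η
      K     = N₁ ℕ.⊔ N₂
      nonneg = λ m K≤m → ℚ.≤-trans (ℚ.<⇒≤ (0<bound x>0)) (p m (ℕ.m⊔n≤o⇒m≤o M K K≤m))
      close  = λ m n (K≤m : M ℕ.⊔ K ℕ.≤ m) (K≤n : M ℕ.⊔ K ℕ.≤ n) →
        subst (λ z → √approx (suc m) (s m) ℚ.≤ √approx (suc n) (s n) ℚ.+ z) (½ε+½ε ε)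
          (√approx-≤ m n (s m) (s n) η (nonneg m K≤m) (nonneg n K≤n) (ℚ.<⇒≤ 0<η)
            (u n (ℕ.m⊔n≤o⇒n≤o N₁ N₂ (ℕ.m⊔n≤o⇒n≤o M K K≤n)))
            (h m n (ℕ.m⊔n≤o⇒m≤o N₁ N₂ (ℕ.m⊔n≤o⇒n≤o M K K≤m))
                   (ℕ.m⊔n≤o⇒m≤o N₁ N₂ (ℕ.m⊔n≤o⇒n≤o M K K≤n))))
  in M ℕ.⊔ K , λ m n K≤m K≤n → ∣-∣≤ (close m n K≤m K≤n) (close n m K≤n K≤m)

⊓1-positive : ∀ {δ} → 0ℚ ℚ.< δ → 0ℚ ℚ.< δ ℚ.⊓ 1ℚ
⊓1-positive {δ} 0<δ = [ (λ e → subst (0ℚ ℚ.<_) (sym e) 0<δ)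
                      , (λ e → subst (0ℚ ℚ.<_) (sym e) (ℚ.positive⁻¹ 1ℚ)) ]′ (ℚ.⊓-sel δ 1ℚ)

√-bound : ∀ x (x>0 : Positive x) → let c = bound x>0 ℚ.⊓ 1ℚ in
  ∃[ N ] (∀ m → N ℕ.≤ m → ½ ℚ.* c ℚ.≤ approx (√ x {{x>0}}) m)
√-bound x x>0 =
  let N , u = archimedean (½ ℚ.* c) (0<½* 0<c)
  in M ℕ.⊔ N , λ m K≤m →
    let δ≤s = bound≤ x>0 m (ℕ.m⊔n≤o⇒m≤o M N K≤m)
        0≤s = ℚ.≤-trans (ℚ.<⇒≤ (0<bound x>0)) δ≤s
        r   = √approx (suc m) (s m)
        c≤  : c ℚ.≤ r ℚ.+ ½ ℚ.* c
        c≤  = ℚ.≤-trans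
          (sq-cancel-≤ (ℚ.<⇒≤ 0<c) (0≤+ (0≤√approx m (s m)) (0≤// 1 (suc m)))
            (ℚ.≤-trans c² (ℚ.≤-trans δ≤s (√approx-upper m (s m) 0≤s))))
          (ℚ.+-monoʳ-≤ r (u m (ℕ.m⊔n≤o⇒n≤o M N K≤m)))
    in 0≤⇒≤ (subst (0ℚ ℚ.≤_) (eq r) (≤⇒0≤ c≤))
  where
  s = approx x
  M = index x>0
  δ = bound x>0
  c = δ ℚ.⊓ 1ℚ
  0<c : 0ℚ ℚ.< c
  0<c = ⊓1-positive (0<bound x>0)
  c² : c ℚ.* c ℚ.≤ δ
  c² = subst (c ℚ.* c ℚ.≤_) (ℚ.*-identityʳ δ)
         (*-mono (ℚ.<⇒≤ 0<c) (ℚ.p⊓q≤p δ 1ℚ) (ℚ.<⇒≤ 0<c) (ℚ.p⊓q≤q δ 1ℚ))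
  eq : ∀ r → (r ℚ.+ ½ ℚ.* c) ℚ.- c ≡ r ℚ.- ½ ℚ.* c
  eq r = trans (cong (λ z → (r ℚ.+ ½ ℚ.* c) ℚ.- z) (sym (½ε+½ε c)))
    (RS.solve 2 (λ h r → (r RS.:+ h) RS.:- (h RS.:+ h) RS.:= r RS.:- h) refl (½ ℚ.* c) r)

instance
  √-positive : ∀ {x} {{_ : Positive x}} → Positive (√ x)
  bound   (√-positive {{x>0}}) = ½ ℚ.* (bound x>0 ℚ.⊓ 1ℚ)
  0<bound (√-positive {{x>0}}) = 0<½* (⊓1-positive (0<bound x>0))
  index   (√-positive {x} {{x>0}}) = proj₁ (√-bound x x>0)
  bound≤  (√-positive {x} {{x>0}}) = proj₂ (√-bound x x>0)

  *-positive : ∀ {x y} {{_ : Positive x}} {{_ : Positive y}} → Positive (x * y)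
  bound   (*-positive {{x>0}} {{y>0}}) = bound x>0 ℚ.* bound y>0
  0<bound (*-positive {{x>0}} {{y>0}}) = 0<* (0<bound x>0) (0<bound y>0)
  index   (*-positive {{x>0}} {{y>0}}) = index x>0 ℕ.⊔ index y>0
  bound≤  (*-positive {{x>0}} {{y>0}}) m K≤m =
    *-mono (ℚ.<⇒≤ (0<bound x>0)) (bound≤ x>0 m (ℕ.m⊔n≤o⇒m≤o (index x>0) (index y>0) K≤m))
           (ℚ.<⇒≤ (0<bound y>0)) (bound≤ y>0 m (ℕ.m⊔n≤o⇒n≤o (index x>0) (index y>0) K≤m))

  fromℕ-positive : ∀ {n} .{{_ : ℕ.NonZero n}} → Positive (fromℕ n)
  bound   (fromℕ-positive {n}) = n // 1
  0<bound (fromℕ-positive {n}) = 0<// n 1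
  index   fromℕ-positive = 0
  bound≤  fromℕ-positive _ _ = ℚ.≤-refl

Σ< : ℕ → (ℕ → ℚ) → ℚ
Σ< zero    f = 0ℚ
Σ< (suc n) f = Σ< n f ℚ.+ f n

∏< : ℕ → (ℕ → ℚ) → ℚ
∏< zero    f = 1ℚ
∏< (suc n) f = ∏< n f ℚ.* f n

infix 5 Σ< ∏<

syntax Σ< n (λ j → t) = Σ[ j < n ] t
syntax ∏< n (λ j → t) = ∏[ j < n ] t

inv : ℕ → ℚ
inv m = 1 // suc m

h-step : ∀ C m → C // (suc m ℕ.* suc (suc m)) ≡ (C // 1) ℚ.* (inv m ℚ.- inv (suc m))
h-step C m = sym (trans (cong ((C // 1) ℚ.*_) diff)
    (trans (//-* C 1 1 (suc m ℕ.* suc (suc m)))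
      (//-cong (C ℕ.* 1) C (1 ℕ.* (suc m ℕ.* suc (suc m))) (suc m ℕ.* suc (suc m))
        (NS.solve 2 (λ c x → c NS.:* κ 1 NS.:* x NS.:= c NS.:* (κ 1 NS.:* x)) refl C (suc m ℕ.* suc (suc m))))))
  where
  split : inv m ≡ inv (suc m) ℚ.+ 1 // (suc m ℕ.* suc (suc m))
  split = sym (trans (//-+ 1 1 (suc (suc m)) (suc m ℕ.* suc (suc m)))
    (//-cong (1 ℕ.* (suc m ℕ.* suc (suc m)) ℕ.+ 1 ℕ.* suc (suc m)) 1
             (suc (suc m) ℕ.* (suc m ℕ.* suc (suc m))) (suc m)
      (NS.solve 1 (λ m → let a = κ 1 NS.:+ m ; b = κ 2 NS.:+ m ; one = κ 1 in
        (one NS.:* (a NS.:* b) NS.:+ one NS.:* b) NS.:* a NS.:= one NS.:* (b NS.:* (a NS.:* b))) refl m)))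
  diff : inv m ℚ.- inv (suc m) ≡ 1 // (suc m ℕ.* suc (suc m))
  diff = trans (cong (λ z → z ℚ.- inv (suc m)) split)
    (RS.solve 2 (λ x y → (x RS.:+ y) RS.:- x RS.:= y) refl (inv (suc m)) (1 // (suc m ℕ.* suc (suc m))))

C*h≤ : ∀ C ε → 0ℚ ℚ.< ε → ∃[ N ] (∀ m → N ℕ.≤ m → (C // 1) ℚ.* inv m ℚ.≤ ε)
C*h≤ C ε 0<ε with archimedean ((1 // suc C) ℚ.* ε) (0<* (0<// 1 (suc C)) 0<ε)
... | N , u = N , λ m N≤m → subst ((C // 1) ℚ.* inv m ℚ.≤_)
  (trans (sym (ℚ.*-assoc (suc C // 1) (1 // suc C) ε))
    (trans (cong (ℚ._* ε) one) (ℚ.*-identityˡ ε)))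
  (*-mono (0≤// C 1) (//-mono-≤ C (suc C) 1 1 (ℕ.*-monoˡ-≤ 1 (ℕ.n≤1+n C))) (0≤// 1 (suc m)) (u m N≤m))
  where
  one : (suc C // 1) ℚ.* (1 // suc C) ≡ 1ℚ
  one = trans (//-* (suc C) 1 1 (suc C)) (//-cong (suc C ℕ.* 1) 1 (1 ℕ.* suc C) 1
    (NS.solve 1 (λ c → let a = κ 1 NS.:+ c ; one = κ 1 in a NS.:* one NS.:* one NS.:= one NS.:* (one NS.:* a)) refl C))

-- increments of size at most C / ((m + 1) (m + 2)) are summable
summable-cauchy : ∀ s C →
  (∀ m → ℚ.∣ s (suc m) ℚ.- s m ∣ ℚ.≤ C // (suc m ℕ.* suc (suc m))) → Cauchy s
summable-cauchy s C inc ε 0<ε = let N , u = C*h≤ C ε 0<ε in N , λ m n N≤m N≤n →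
  [ (λ m≤n → subst (ℚ._≤ ε) (∣-∣-swap (s n) (s m)) (ℚ.≤-trans (far′ m n m≤n) (u m N≤m)))
  , (λ n≤m → ℚ.≤-trans (far′ n m n≤m) (u n N≤n)) ]′ (ℕ.≤-total m n)
  where
  c = C // 1
  far : ∀ j m → ℚ.∣ s (j ℕ.+ m) ℚ.- s m ∣ ℚ.≤ c ℚ.* (inv m ℚ.- inv (j ℕ.+ m))
  far zero m = ℚ.≤-reflexive (trans (cong ℚ.∣_∣ (+-neg (s m)))
    (sym (trans (cong (c ℚ.*_) (+-neg (inv m))) (ℚ.*-zeroʳ c))))
  far (suc j) m = subst₂ ℚ._≤_
    (cong ℚ.∣_∣ (RS.solve 3 (λ x y z → (x RS.:- y) RS.:+ (y RS.:- z) RS.:= x RS.:- z) refl (s (suc i)) (s i) (s m)))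
    (RS.solve 4 (λ c x y z → c RS.:* (y RS.:- x) RS.:+ c RS.:* (z RS.:- y) RS.:= c RS.:* (z RS.:- x)) refl c (inv (suc i)) (inv i) (inv m))
    (ℚ.≤-trans (ℚ.∣p+q∣≤∣p∣+∣q∣ (s (suc i) ℚ.- s i) (s i ℚ.- s m))
      (ℚ.+-mono-≤ (subst (ℚ.∣ s (suc i) ℚ.- s i ∣ ℚ.≤_) (h-step C i) (inc i)) (far j m)))
    where i = j ℕ.+ m
  far′ : ∀ m n → m ℕ.≤ n → ℚ.∣ s n ℚ.- s m ∣ ℚ.≤ c ℚ.* inv m
  far′ m n m≤n = ℚ.≤-trans
    (subst (λ i → ℚ.∣ s i ℚ.- s m ∣ ℚ.≤ c ℚ.* (inv m ℚ.- inv i)) (ℕ.m∸n+n≡m m≤n) (far (n ℕ.∸ m) m))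
    (ℚ.*-monoˡ-≤-nonNeg c {{ℚ.nonNegative (0≤// C 1)}}
      (0≤⇒≤ (subst (0ℚ ℚ.≤_) (RS.solve 2 (λ x y → y RS.:= x RS.:- (x RS.:- y)) refl (inv m) (inv n)) (0≤// 1 (suc n)))))

increment : ∀ {x y d b} → y ≡ x ℚ.+ d → 0ℚ ℚ.≤ d → d ℚ.≤ b → ℚ.∣ y ℚ.- x ∣ ℚ.≤ b
increment {x} {y} {d} {b} e 0≤d d≤b = subst (ℚ._≤ b)
  (trans (sym (ℚ.0≤p⇒∣p∣≡p 0≤d)) (cong ℚ.∣_∣ (sym (trans (cong (λ z → z ℚ.- x) e)
    (RS.solve 2 (λ x d → (x RS.:+ d) RS.:- x RS.:= d) refl x d))))) d≤b

e-step : ∀ m → suc m ℕ.* suc (suc m) ℕ.≤ 6 ℕ.* m !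
e-step 0 = s≤s (s≤s z≤n)
e-step 1 = ℕ.≤-refl
e-step (suc m@(suc i)) = ℕ.≤-trans
  (ℕ.≤-trans (ℕ.m≤m+n (suc (suc m) ℕ.* suc (suc (suc m))) ((3 ℕ.* i ℕ.+ i ℕ.* i) ℕ.* (3 ℕ.+ i)))
    (ℕ.≤-reflexive (NS.solve 1 (λ i → 
      (κ 3 NS.:+ i) NS.:* (κ 4 NS.:+ i) NS.:+ (κ 3 NS.:* i NS.:+ i NS.:* i) NS.:* (κ 3 NS.:+ i)
      NS.:= (κ 2 NS.:+ i) NS.:* ((κ 2 NS.:+ i) NS.:* (κ 3 NS.:+ i))) refl i)))
  (ℕ.≤-trans (ℕ.*-monoʳ-≤ (suc m) (e-step m))
    (ℕ.≤-reflexive (NS.solve 2 (λ a f → a NS.:* (κ 6 NS.:* f) NS.:= κ 6 NS.:* (a NS.:* f)) refl (suc m) (m !))))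

e-approx : ℕ → ℚ
e-approx m = Σ[ j < m ] _//_ 1 (j !) {{j ℕ.!≢0}}

e : ℝ
approx e = e-approx
cauchy e = summable-cauchy e-approx 6 λ m →
  increment {e-approx m} refl (0≤// 1 (m !) {{m ℕ.!≢0}})
    (//-mono-≤ 1 6 (m !) (suc m ℕ.* suc (suc m)) {{m ℕ.!≢0}}
      (ℕ.≤-trans (ℕ.≤-reflexive (ℕ.*-identityˡ _)) (e-step m)))

-- The Wallis product π / 2 = 2/1 · 2/3 · 4/3 · 4/5 · 6/5 · 6/7 ⋯
wallis : ℕ → ℚ
wallis m = ∏[ j < m ] (2 ℕ.+ 2 ℕ.* j) // (1 ℕ.+ 2 ℕ.* j) ℚ.* (2 ℕ.+ 2 ℕ.* j) // (3 ℕ.+ 2 ℕ.* j)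

wallis-denom : ℕ → ℕ
wallis-denom m = (1 ℕ.+ 2 ℕ.* m) ℕ.* (3 ℕ.+ 2 ℕ.* m)

wallis-factor : ∀ m → (2 ℕ.+ 2 ℕ.* m) // (1 ℕ.+ 2 ℕ.* m) ℚ.* (2 ℕ.+ 2 ℕ.* m) // (3 ℕ.+ 2 ℕ.* m)
                    ≡ 1ℚ ℚ.+ 1 // wallis-denom m
wallis-factor m = trans (//-* x x a b) (sym (trans (//-+ 1 1 1 (a ℕ.* b))
  (//-cong (1 ℕ.* (a ℕ.* b) ℕ.+ 1 ℕ.* 1) (x ℕ.* x) (1 ℕ.* (a ℕ.* b)) (a ℕ.* b)
    (NS.solve 1 (λ m → let t = κ 2 NS.:* m ; d = (κ 1 NS.:+ t) NS.:* (κ 3 NS.:+ t) in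
      (κ 1 NS.:* d NS.:+ κ 1 NS.:* κ 1) NS.:* d
      NS.:= (κ 2 NS.:+ t) NS.:* (κ 2 NS.:+ t) NS.:* (κ 1 NS.:* d)) refl m))))
  where
  x = 2 ℕ.+ 2 ℕ.* m
  a = 1 ℕ.+ 2 ℕ.* m
  b = 3 ℕ.+ 2 ℕ.* m

wallis-step : ∀ m → wallis (suc m) ≡ wallis m ℚ.+ wallis m ℚ.* (1 // wallis-denom m)
wallis-step m = trans (cong (wallis m ℚ.*_) (wallis-factor m))
  (trans (ℚ.*-distribˡ-+ (wallis m) 1ℚ (1 // wallis-denom m))
    (cong (ℚ._+ wallis m ℚ.* (1 // wallis-denom m)) (ℚ.*-identityʳ (wallis m))))

1≤wallis : ∀ m → 1ℚ ℚ.≤ wallis m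
1≤wallis zero    = ℚ.≤-refl
1≤wallis (suc m) = subst (1ℚ ℚ.≤_) (sym (wallis-step m))
  (ℚ.+-mono-≤ (1≤wallis m)
    (0≤* (ℚ.≤-trans (ℚ.nonNegative⁻¹ 1ℚ) (1≤wallis m)) (0≤// 1 (wallis-denom m))))

0≤wallis : ∀ m → 0ℚ ℚ.≤ wallis m
0≤wallis m = ℚ.≤-trans (ℚ.nonNegative⁻¹ 1ℚ) (1≤wallis m)

wallis≤ : ∀ m → wallis m ℚ.≤ (1 ℕ.+ 2 ℕ.* m) // suc m
wallis≤ zero    = ℚ.≤-refl
wallis≤ (suc m) = ℚ.≤-trans
  (*-mono (0≤wallis m) (wallis≤ m) (subst (0ℚ ℚ.≤_) (sym (//-* x x a b)) (0≤// (x ℕ.* x) (a ℕ.* b)))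
          (ℚ.≤-reflexive (//-* x x a b)))
  (ℚ.≤-trans (ℚ.≤-reflexive (//-* a (x ℕ.* x) (suc m) (a ℕ.* b)))
    (//-mono-≤ (a ℕ.* (x ℕ.* x)) (1 ℕ.+ 2 ℕ.* suc m) (suc m ℕ.* (a ℕ.* b)) (suc (suc m))
      (ℕ.≤-trans (ℕ.m≤m+n (a ℕ.* (x ℕ.* x) ℕ.* suc (suc m)) (a ℕ.* suc m))
        (ℕ.≤-reflexive (NS.solve 1 (λ m → let t = κ 2 NS.:* m ; a = κ 1 NS.:+ t ; x = κ 2 NS.:+ t in
          a NS.:* (x NS.:* x) NS.:* (κ 2 NS.:+ m) NS.:+ a NS.:* (κ 1 NS.:+ m)
          NS.:= (κ 1 NS.:+ κ 2 NS.:* (κ 1 NS.:+ m)) NS.:* ((κ 1 NS.:+ m) NS.:* (a NS.:* (κ 3 NS.:+ t)))) refl m)))))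
  where
  x = 2 ℕ.+ 2 ℕ.* m
  a = 1 ℕ.+ 2 ℕ.* m
  b = 3 ℕ.+ 2 ℕ.* m

wallis≤2 : ∀ m → wallis m ℚ.≤ 2 // 1
wallis≤2 m = ℚ.≤-trans (wallis≤ m) (//-mono-≤ (1 ℕ.+ 2 ℕ.* m) 2 (suc m) 1
  (ℕ.≤-trans (ℕ.n≤1+n _) (ℕ.≤-reflexive (NS.solve 1 (λ m → 
    κ 1 NS.:+ (κ 1 NS.:+ κ 2 NS.:* m) NS.:* κ 1 NS.:= κ 2 NS.:* (κ 1 NS.:+ m)) refl m))))

π : ℝ
approx π m = 2 // 1 ℚ.* wallis m
cauchy π = summable-cauchy (λ m → 2 // 1 ℚ.* wallis m) 4 λ m →
  increment {2 // 1 ℚ.* wallis m} (trans (cong (2 // 1 ℚ.*_) (wallis-step m)) (ℚ.*-distribˡ-+ (2 // 1) (wallis m) _))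
    (0≤* (0≤// 2 1) (0≤* (0≤wallis m) (0≤// 1 (wallis-denom m))))
    (ℚ.≤-trans
      (ℚ.*-monoˡ-≤-nonNeg (2 // 1) (*-mono (0≤wallis m) (wallis≤2 m) (0≤// 1 (wallis-denom m)) ℚ.≤-refl))
      (ℚ.≤-trans
        (ℚ.≤-reflexive (trans (cong (2 // 1 ℚ.*_) (//-* 2 1 1 (wallis-denom m))) (//-* 2 2 1 (1 ℕ.* wallis-denom m))))
        (//-mono-≤ 4 4 (1 ℕ.* (1 ℕ.* wallis-denom m)) (suc m ℕ.* suc (suc m)) (ℕ.*-monoʳ-≤ 4 (denom m)))))
  where
  denom : ∀ m → suc m ℕ.* suc (suc m) ℕ.≤ 1 ℕ.* (1 ℕ.* wallis-denom m)
  denom m = ℕ.≤-trans (ℕ.m≤m+n _ (3 ℕ.* (m ℕ.* m) ℕ.+ 5 ℕ.* m ℕ.+ 1))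
    (ℕ.≤-reflexive (NS.solve 1 (λ m → let t = κ 2 NS.:* m in
      (κ 1 NS.:+ m) NS.:* (κ 2 NS.:+ m) NS.:+ (κ 3 NS.:* (m NS.:* m) NS.:+ κ 5 NS.:* m NS.:+ κ 1)
      NS.:= κ 1 NS.:* (κ 1 NS.:* ((κ 1 NS.:+ t) NS.:* (κ 3 NS.:+ t)))) refl m))

instance
  π-positive : Positive π
  bound   π-positive = 2 // 1
  0<bound π-positive = 0<// 2 1
  index   π-positive = 0
  bound≤  π-positive m _ =
    subst (ℚ._≤ 2 // 1 ℚ.* wallis m) (ℚ.*-identityʳ (2 // 1)) (ℚ.*-monoˡ-≤-nonNeg (2 // 1) (1≤wallis m))

harmonic : ℕ → ℕ → ℚ
harmonic a j = Σ[ i < j ] 1 // suc (a ℕ.+ i)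

harmonic-shift : ∀ a j → harmonic a (suc j) ≡ inv a ℚ.+ harmonic (suc a) j
harmonic-shift a zero    = trans (ℚ.+-comm 0ℚ (1 // suc (a ℕ.+ 0))) (cong (λ z → inv z ℚ.+ 0ℚ) (ℕ.+-identityʳ a))
harmonic-shift a (suc j) = trans
  (cong₂ ℚ._+_ (harmonic-shift a j) (cong inv (ℕ.+-suc a j)))
  (ℚ.+-assoc (inv a) (harmonic (suc a) j) (inv (suc a ℕ.+ j)))

harmonic-split : ∀ a i j → harmonic a (i ℕ.+ j) ≡ harmonic a i ℚ.+ harmonic (a ℕ.+ i) j
harmonic-split a i zero    = trans (cong (harmonic a) (ℕ.+-identityʳ i)) (sym (ℚ.+-identityʳ (harmonic a i)))
harmonic-split a i (suc j) = trans (cong (harmonic a) (ℕ.+-suc i j))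
  (trans (cong₂ ℚ._+_ (harmonic-split a i j) (cong inv (sym (ℕ.+-assoc a i j))))
    (ℚ.+-assoc (harmonic a i) (harmonic (a ℕ.+ i) j) (inv (a ℕ.+ i ℕ.+ j))))

//-suc : ∀ j b .{{_ : ℕ.NonZero b}} → j // b ℚ.+ 1 // b ≡ suc j // b
//-suc j b@(suc _) = trans (//-+ j 1 b b) (//-cong (j ℕ.* b ℕ.+ 1 ℕ.* b) (suc j) (b ℕ.* b) b
  (NS.solve 2 (λ j b → (j NS.:* b NS.:+ κ 1 NS.:* b) NS.:* b NS.:= (κ 1 NS.:+ j) NS.:* (b NS.:* b)) refl j b))

harmonic-lower : ∀ a j b .{{_ : ℕ.NonZero b}} → a ℕ.+ j ℕ.≤ b → j // b ℚ.≤ harmonic a j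
harmonic-lower a zero    b _ = //-mono-≤ 0 0 b 1 z≤n
harmonic-lower a (suc j) b h = subst (ℚ._≤ harmonic a (suc j)) (//-suc j b)
  (ℚ.+-mono-≤ (harmonic-lower a j b (ℕ.≤-trans (ℕ.n≤1+n (a ℕ.+ j)) h′))
              (//-mono-≤ 1 1 b (suc (a ℕ.+ j)) (ℕ.*-monoʳ-≤ 1 h′)))
  where h′ = subst (ℕ._≤ b) (ℕ.+-suc a j) h

harmonic-upper : ∀ a j b .{{_ : ℕ.NonZero b}} → b ℕ.≤ a → harmonic a j ℚ.≤ j // b
harmonic-upper a zero    b _ = //-mono-≤ 0 0 1 b z≤n
harmonic-upper a (suc j) b h = subst (harmonic a (suc j) ℚ.≤_) (//-suc j b)
  (ℚ.+-mono-≤ (harmonic-upper a j b h)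
    (//-mono-≤ 1 1 (suc (a ℕ.+ j)) b (ℕ.*-monoʳ-≤ 1 (ℕ.≤-trans h (ℕ.≤-trans (ℕ.m≤m+n a j) (ℕ.n≤1+n (a ℕ.+ j)))))))

-- The right Riemann sum of ∫₁ⁿ dt / t with mesh 1 / M, M = m + 1: the
-- interval ending at t = 1 + (i + 1) / M contributes
-- (1 / M) (1 / t) = 1 / (M + i + 1).
log-approx : ℕ → ℕ → ℚ
log-approx n m = Σ[ i < (n ℕ.∸ 1) ℕ.* suc m ] 1 // suc (suc m ℕ.+ i)

log-tail : ℕ → ℕ → ℚ
log-tail d m = harmonic (suc m ℕ.+ d ℕ.* suc m) (suc d)

log-step : ∀ n m → log-approx n (suc m) ≡
  log-approx n m ℚ.+ (log-tail (n ℕ.∸ 1) m ℚ.- inv (suc m))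
log-step n m = trans (sym (RS.solve 2 (λ x y → (x RS.:+ y) RS.:- x RS.:= y) refl (inv M) (log-approx n (suc m))))
  (trans (cong (λ z → z ℚ.- inv M)
    (trans (sym (harmonic-shift M (d ℕ.* suc M)))
      (trans (cong (harmonic M) (NS.solve 2 (λ d M → κ 1 NS.:+ d NS.:* (κ 1 NS.:+ M) NS.:= d NS.:* M NS.:+ (κ 1 NS.:+ d)) refl d M))
        (harmonic-split M (d ℕ.* M) (suc d)))))
    (ℚ.+-assoc (log-approx n m) (log-tail d m) (ℚ.- inv M)))
  where
  M = suc m
  d = n ℕ.∸ 1

-- only meaningful for n ≥ 1
log : ℕ → ℝ
approx (log n) = log-approx n
cauchy (log n) = summable-cauchy (log-approx n) 1 λ m →
  let d = n ℕ.∸ 1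
      M = suc m
      lower : inv M ℚ.≤ log-tail d m
      lower = subst (ℚ._≤ log-tail d m)
        (//-cong (suc d) 1 (suc d ℕ.* suc M) (suc M)
          (sym (ℕ.*-identityˡ (suc d ℕ.* suc M))))
        (harmonic-lower (M ℕ.+ d ℕ.* M) (suc d) (suc d ℕ.* suc M)
          (ℕ.≤-reflexive (NS.solve 2 (λ d M → (M NS.:+ d NS.:* M) NS.:+ (κ 1 NS.:+ d) NS.:= (κ 1 NS.:+ d) NS.:* (κ 1 NS.:+ M)) refl d M)))
      upper : log-tail d m ℚ.≤ inv m
      upper = subst (log-tail d m ℚ.≤_)
        (//-cong (suc d) 1 (suc d ℕ.* M) M (sym (ℕ.*-identityˡ (suc d ℕ.* M))))
        (harmonic-upper (M ℕ.+ d ℕ.* M) (suc d) (suc d ℕ.* M) ℕ.≤-refl)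
  in increment {log-approx n m} (log-step n m) (≤⇒0≤ lower)
       (subst (log-tail d m ℚ.- inv M ℚ.≤_) (sym (trans (h-step 1 m) (ℚ.*-identityˡ (inv m ℚ.- inv M))))
         (ℚ.+-monoˡ-≤ (ℚ.- inv M) upper))

ψ : ℕ → (x : ℕ) → .{{ℕ.NonZero x}} → ℚ
ψ k x = ((+ x) ℤ.^ k ℤ.- (+ x ℤ.- + 1) ℤ.^ k ℤ.+ (ℤ.- + 1) ℤ.^ k) ℚ./ x

pos-^ : ∀ a k → (+ a) ℤ.^ k ≡ + (a ℕ.^ k)
pos-^ a zero    = refl
pos-^ a (suc k) = trans (cong ((+ a) ℤ.*_) (pos-^ a k)) (sym (ℤ.pos-* a (a ℕ.^ k)))

sign : ∀ k → ((ℤ.- + 1) ℤ.^ k ≡ + 1) ⊎ ((ℤ.- + 1) ℤ.^ k ≡ ℤ.- + 1)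
sign zero = inj₁ refl
sign (suc k) with sign k
... | inj₁ h = inj₂ (cong ((ℤ.- + 1) ℤ.*_) h)
... | inj₂ h = inj₁ (cong ((ℤ.- + 1) ℤ.*_) h)

bernoulli : ∀ q k → suc q ℕ.* suc q ℕ.^ k ℕ.≤ k ℕ.* suc q ℕ.^ k ℕ.+ suc q ℕ.* q ℕ.^ k
bernoulli q zero = ℕ.≤-refl
bernoulli q (suc k) = ℕ.≤-trans (ℕ.*-monoʳ-≤ (suc q) (bernoulli q k))
  (ℕ.≤-trans (ℕ.≤-reflexive (NS.solve 4 (λ q k P Q → let p = κ 1 NS.:+ q in
      p NS.:* (k NS.:* P NS.:+ p NS.:* Q) NS.:= (k NS.:* (p NS.:* P) NS.:+ p NS.:* (q NS.:* Q)) NS.:+ p NS.:* Q)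
      refl q k (suc q ℕ.^ k) (q ℕ.^ k)))
    (ℕ.≤-trans (ℕ.+-monoʳ-≤ (k ℕ.* (suc q ℕ.* suc q ℕ.^ k) ℕ.+ suc q ℕ.* (q ℕ.* q ℕ.^ k))
        (ℕ.*-monoʳ-≤ (suc q) (ℕ.^-monoˡ-≤ k (ℕ.n≤1+n q))))
      (ℕ.≤-reflexive (NS.solve 4 (λ q k P Q → let p = κ 1 NS.:+ q in
        (k NS.:* (p NS.:* P) NS.:+ p NS.:* (q NS.:* Q)) NS.:+ p NS.:* P
        NS.:= (p NS.:* P NS.:+ k NS.:* (p NS.:* P)) NS.:+ p NS.:* (q NS.:* Q)) refl q k (suc q ℕ.^ k) (q ℕ.^ k)))))

-- for p ≥ 2 and k ≥ 1 the numerator of ψ k p is a natural number N ≤ p ^ k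
-- with p N ≤ (k + 1) p ^ k
ψ-numerator : ∀ k p .{{_ : ℕ.NonZero k}} .{{_ : ℕ.NonTrivial p}} →
  ∃[ N ] ((+ p) ℤ.^ k ℤ.- (+ p ℤ.- + 1) ℤ.^ k ℤ.+ (ℤ.- + 1) ℤ.^ k ≡ + N
          × N ℕ.≤ p ℕ.^ k × p ℕ.* N ℕ.≤ suc k ℕ.* p ℕ.^ k)
ψ-numerator k@(suc j) p@(suc q@(suc _)) = result (sign k)
  where
  A = p ℕ.^ k
  B = q ℕ.^ k
  d = A ℕ.∸ suc B
  B<A : B ℕ.< A
  B<A = ℕ.^-monoˡ-< k (ℕ.n<1+n q)
  A≡ : A ≡ suc d ℕ.+ B
  A≡ = trans (sym (ℕ.m∸n+n≡m B<A)) (ℕ.+-suc d B)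
  1≤B : 1 ℕ.≤ B
  1≤B = ℕ.m^n>0 q k
  diff : (+ p) ℤ.^ k ℤ.- (+ p ℤ.- + 1) ℤ.^ k ≡ + suc d
  diff = trans (cong₂ ℤ._-_ (pos-^ p k) (pos-^ q k))
    (trans (ℤ.m-n≡m⊖n A B) (trans (ℤ.⊖-≥ (ℕ.<⇒≤ B<A))
      (cong +_ (trans (cong (ℕ._∸ B) A≡) (ℕ.m+n∸n≡m (suc d) B)))))
  p≤A : p ℕ.≤ A
  p≤A = ℕ.≤-trans (ℕ.≤-reflexive (sym (ℕ.*-identityʳ p))) (ℕ.*-monoʳ-≤ p (ℕ.m^n>0 p j))
  main : p ℕ.* suc d ℕ.≤ k ℕ.* A
  main = ℕ.+-cancelʳ-≤ (p ℕ.* B) (p ℕ.* suc d) (k ℕ.* A)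
    (subst (ℕ._≤ k ℕ.* A ℕ.+ p ℕ.* B) (trans (cong (p ℕ.*_) A≡) (ℕ.*-distribˡ-+ p (suc d) B)) (bernoulli q k))
  pN≤ : p ℕ.* suc (suc d) ℕ.≤ suc k ℕ.* A
  pN≤ = subst (ℕ._≤ suc k ℕ.* A) (sym (ℕ.*-suc p (suc d))) (ℕ.+-mono-≤ p≤A main)
  small : suc (suc d) ℕ.≤ A
  small = subst (suc (suc d) ℕ.≤_) (trans (ℕ.+-comm B (suc d)) (sym A≡)) (ℕ.+-monoˡ-≤ (suc d) 1≤B)
  d≤ : d ℕ.≤ suc (suc d)
  d≤ = ℕ.≤-trans (ℕ.n≤1+n d) (ℕ.n≤1+n (suc d))
  result : ((ℤ.- + 1) ℤ.^ k ≡ + 1) ⊎ ((ℤ.- + 1) ℤ.^ k ≡ ℤ.- + 1) → _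
  result (inj₁ e) = suc (suc d)
    , trans (cong₂ ℤ._+_ diff e) (cong +_ (ℕ.+-comm (suc d) 1)) , small , pN≤
  result (inj₂ e) = d
    , cong₂ ℤ._+_ diff e , ℕ.≤-trans d≤ small , ℕ.≤-trans (ℕ.*-monoʳ-≤ p d≤) pN≤

when : ∀ {P : Set} → Dec P → (P → ℚ) → ℚ
when (yes p) t = t p
when (no  _) t = 1ℚ

C-factor : (k : ℕ) .{{_ : ℕ.NonZero k}} (p : ℕ) → Prime p → ℚ
C-factor k p pr = 1ℚ ℚ.- ψ k p ℚ.* 1 // (p ℕ.^ k)
  where instance
    _ = prime⇒nonZero pr
    _ = ℕ.m^n≢0 p k

C-approx : (k : ℕ) .{{_ : ℕ.NonZero k}} → ℕ → ℚ
C-approx k m = ∏[ p < m ] when (prime? p) (C-factor k p)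

Gap : ℕ → ℕ → ℚ → Set
Gap k p q = ∃[ t ] (q ≡ 1ℚ ℚ.- t × 0ℚ ℚ.≤ t × t ℚ.≤ 1ℚ
                    × t ℚ.≤ (3 ℕ.* suc k) // (suc p ℕ.* suc (suc p)))

C-factor-gap : ∀ k .{{_ : ℕ.NonZero k}} p pr → Gap k p (C-factor k p pr)
C-factor-gap k p@(suc (suc i)) pr = let N , eq , N≤ , pN≤ = ψ-numerator k p in
  (N ℕ.* 1) // (p ℕ.* a)
  , cong (λ z → 1ℚ ℚ.- z) (trans (cong (ℚ._* 1 // a) (cong (ℚ._/ p) eq)) (//-* N 1 p a))
  , 0≤// (N ℕ.* 1) (p ℕ.* a)
  , //-mono-≤ (N ℕ.* 1) 1 (p ℕ.* a) 1 (one N N≤)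
  , ℚ.≤-trans (//-mono-≤ (N ℕ.* 1) (suc k) (p ℕ.* a) (p ℕ.* p) (two N pN≤))
      (//-mono-≤ (suc k) (3 ℕ.* suc k) (p ℕ.* p) (suc p ℕ.* suc (suc p)) three)
  where
  a = p ℕ.^ k
  instance
    _ = ℕ.m^n≢0 p k
    _ = ℕ.m*n≢0 p a
  one : ∀ N → N ℕ.≤ a → N ℕ.* 1 ℕ.* 1 ℕ.≤ 1 ℕ.* (p ℕ.* a)
  one N h = subst₂ ℕ._≤_ (NS.solve 1 (λ N → N NS.:= N NS.:* κ 1 NS.:* κ 1) refl N)
    (sym (ℕ.*-identityˡ (p ℕ.* a))) (ℕ.≤-trans h (ℕ.m≤n*m a p))
  two : ∀ N → p ℕ.* N ℕ.≤ suc k ℕ.* a → N ℕ.* 1 ℕ.* (p ℕ.* p) ℕ.≤ suc k ℕ.* (p ℕ.* a)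
  two N h = subst₂ ℕ._≤_
    (NS.solve 2 (λ p N → p NS.:* (p NS.:* N) NS.:= N NS.:* κ 1 NS.:* (p NS.:* p)) refl p N)
    (NS.solve 3 (λ p k a → p NS.:* (k NS.:* a) NS.:= k NS.:* (p NS.:* a)) refl p (suc k) a)
    (ℕ.*-monoʳ-≤ p h)
  three : suc k ℕ.* (suc p ℕ.* suc (suc p)) ℕ.≤ 3 ℕ.* suc k ℕ.* (p ℕ.* p)
  three = ℕ.≤-trans (ℕ.m≤m+n (suc k ℕ.* (suc p ℕ.* suc (suc p))) (suc k ℕ.* (5 ℕ.* i ℕ.+ 2 ℕ.* (i ℕ.* i))))
    (ℕ.≤-reflexive (NS.solve 2 (λ k i → let p = κ 2 NS.:+ i in
      k NS.:* ((κ 1 NS.:+ p) NS.:* (κ 2 NS.:+ p)) NS.:+ k NS.:* (κ 5 NS.:* i NS.:+ κ 2 NS.:* (i NS.:* i))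
      NS.:= κ 3 NS.:* k NS.:* (p NS.:* p)) refl (suc k) i))
C-factor-gap k 0 pr = contradiction (prime⇒nonTrivial pr) λ ()
C-factor-gap k 1 pr = contradiction (prime⇒nonTrivial pr) λ ()

gap : ∀ k .{{_ : ℕ.NonZero k}} p (d : Dec (Prime p)) → Gap k p (when d (C-factor k p))
gap k p (yes pr) = C-factor-gap k p pr
gap k p (no  _)  = 0ℚ , refl , ℚ.≤-refl , ℚ.nonNegative⁻¹ 1ℚ , 0≤// (3 ℕ.* suc k) (suc p ℕ.* suc (suc p))

*-gap-bounds : ∀ {k p P q} → 0ℚ ℚ.≤ P × P ℚ.≤ 1ℚ → Gap k p q → 0ℚ ℚ.≤ P ℚ.* q × P ℚ.* q ℚ.≤ 1ℚ
*-gap-bounds {q = q} (0≤P , P≤1) (t , eq , 0≤t , t≤1 , _) = 0≤* 0≤P 0≤q , *-mono 0≤P P≤1 0≤q q≤1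
  where
  0≤q : 0ℚ ℚ.≤ q
  0≤q = subst (0ℚ ℚ.≤_) (sym eq) (≤⇒0≤ t≤1)
  q≤1 : q ℚ.≤ 1ℚ
  q≤1 = subst (ℚ._≤ 1ℚ) (sym eq) (0≤⇒≤ (subst (0ℚ ℚ.≤_)
    (RS.solve 2 (λ o t → t RS.:= o RS.:- (o RS.:- t)) refl 1ℚ t) 0≤t))

*-gap-increment : ∀ {k p P q} → 0ℚ ℚ.≤ P × P ℚ.≤ 1ℚ → Gap k p q →
  ℚ.∣ P ℚ.* q ℚ.- P ∣ ℚ.≤ (3 ℕ.* suc k) // (suc p ℕ.* suc (suc p))
*-gap-increment {k} {p} {P} {q} (0≤P , P≤1) (t , eq , 0≤t , _ , t≤) =
  subst (ℚ._≤ (3 ℕ.* suc k) // (suc p ℕ.* suc (suc p)))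
    (∣-∣-swap P (P ℚ.* q))
    (increment {P ℚ.* q} (sym (trans (cong (λ z → P ℚ.* z ℚ.+ P ℚ.* t) eq)
        (trans (sym (ℚ.*-distribˡ-+ P (1ℚ ℚ.- t) t)) (trans (cong (P ℚ.*_)
          (RS.solve 2 (λ o t → (o RS.:- t) RS.:+ t RS.:= o) refl 1ℚ t)) (ℚ.*-identityʳ P)))))
      (0≤* 0≤P 0≤t)
      (ℚ.≤-trans (*-mono 0≤P P≤1 0≤t ℚ.≤-refl) (ℚ.≤-trans (ℚ.≤-reflexive (ℚ.*-identityˡ t)) t≤)))

C-bounds : ∀ k .{{_ : ℕ.NonZero k}} m → 0ℚ ℚ.≤ C-approx k m × C-approx k m ℚ.≤ 1ℚ
C-bounds k zero    = ℚ.nonNegative⁻¹ 1ℚ , ℚ.≤-refl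
C-bounds k (suc m) = *-gap-bounds {k} {m} (C-bounds k m) (gap k m (prime? m))

C-increment : ∀ k .{{_ : ℕ.NonZero k}} m →
  ℚ.∣ C-approx k (suc m) ℚ.- C-approx k m ∣ ℚ.≤ (3 ℕ.* suc k) // (suc m ℕ.* suc (suc m))
C-increment k m = *-gap-increment {k} {m} (C-bounds k m) (gap k m (prime? m))

C : (k : ℕ) .{{_ : ℕ.NonZero k}} → ℝ
approx (C k) = C-approx k
cauchy (C k) = summable-cauchy (C-approx k) (3 ℕ.* suc k) (C-increment k)

ψ<p^k : ∀ k .{{_ : ℕ.NonZero k}} p (pr : Prime p) →
  ψ k p {{prime⇒nonZero pr}} ℚ.< (p ℕ.^ k) // 1
ψ<p^k k p@(suc (suc i)) pr = let N , eq , N≤ , _ = ψ-numerator k p in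
  subst (ℚ._< (p ℕ.^ k) // 1) (sym (cong (ℚ._/ p) eq))
    (//-mono-< N (p ℕ.^ k) p 1 (ℕ.≤-<-trans (ℕ.*-monoˡ-≤ 1 N≤)
      (ℕ.*-monoʳ-< (p ℕ.^ k) {{ℕ.m^n≢0 p k}} (s≤s (s≤s z≤n)))))
ψ<p^k k 0 pr = contradiction (prime⇒nonTrivial pr) λ ()
ψ<p^k k 1 pr = contradiction (prime⇒nonTrivial pr) λ ()

f-factor : (k : ℕ) .{{_ : ℕ.NonZero k}} (p : ℕ) → Prime p → ℚ
f-factor k p pr = 1ℚ ℚ.+ ((ℤ.- + 1) ℤ.^ k ℚ./ 1) ℚ.÷ ((p ℕ.^ k) // 1 ℚ.- ψ k p)
  where instance
    _ = prime⇒nonZero pr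
    _ = ℚ.>-nonZero (<⇒0< (ψ<p^k k p pr))

-- for n ≥ 1 every prime divisor of n is at most n
f : (k : ℕ) .{{_ : ℕ.NonZero k}} → ℕ → ℚ
f k n = ∏[ p < suc n ] when (prime? p ×-dec p ℕ.∣? n) (λ (pr , _) → f-factor k p pr)

product : ∀ {m} → Vec ℕ m → ℕ
product = Vec.foldr′ ℕ._*_ 1

IsSolution : ∀ {k} → ℕ → Vec ℕ (suc k) → Set
IsSolution n (x ∷ ys) = n ≡ x ℕ.+ Vec.sum ys × ℕ.gcd x (product ys) ≡ 1

isSolution? : ∀ {k} n → Decidable (IsSolution {k} n)
isSolution? n (x ∷ ys) = n ℕ.≟ x ℕ.+ Vec.sum ys ×-dec ℕ.gcd x (product ys) ℕ.≟ 1

-- entries range over {1, …, n}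
tuples : (m n : ℕ) → List (Vec ℕ m)
tuples zero    n = [] ∷ []
tuples (suc m) n = List.cartesianProductWith _∷_ (List.map suc (List.upTo n)) (tuples m n)

-- Positive integers with sum n are at most n, so restricting the entries to
-- {1, …, n} loses no solution.
A : ℕ → ℕ → ℕ
A k n = List.length (List.filter (isSolution? n) (tuples (suc k) n))

module Submission where

-- Put x = n - Σ y. Möbius inversion over the primes dividing both x and
-- y₁ ⋯ yₖ gives A k n = Σ μ(d) B(d) over the squarefree d < n, where B(d)
-- counts the y such that d divides x and every prime factor of d divides some
-- yᵢ. This condition has period d in each yᵢ and, by the Chinese remainder
-- theorem, density R(d) / dᵏ with R multiplicative and
-- R(p) = ψ k p - (-1)ᵏ [p ∣ n] ≤ k pᵏ⁻² for k ≥ 2. Covering the simplex by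
-- cubes of side d gives B(d) = R(d) / dᵏ · nᵏ / k! up to
-- k² (k + 1)ᵏ⁻¹ nᵏ⁻¹ / k! · k ^ ω(d) / d for d ≤ n; for d ≥ n, where B(d) = 0,
-- the same holds with a further factor n / d. The main terms sum to the Euler
-- product C f nᵏ / k!, and since k ^ ω(d) counts the factorisations of d into k
-- factors, the errors sum to at most (3 + Σ_{2 ≤ i ≤ n} 1 / i)ᵏ times the
-- constant. For n ≥ 2048 this is below the claimed bound; for smaller n so is
-- nᵏ / k!, which dominates both terms. For k = 1 the count is exact.

open import Data.Nat as ℕ using (ℕ; zero; suc; z≤n; s≤s; _!)
import Data.Nat.DivMod as ℕ
import Data.Nat.Divisibility as ℕ
import Data.Nat.GCD as ℕ
import Data.Nat.ListAction as ℕ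
import Data.Nat.Properties as ℕ
open import Data.Nat.Primality using (Prime; euclidsLemma; prime?; prime⇒irreducible; prime⇒nonTrivial; prime⇒nonZero; ¬prime[0])
open import Data.Nat.Properties using (_!≢0)
open import Data.Nat.Tactic.RingSolver using () renaming (solve-∀ to ℕ-solve-∀)
open import Data.Product using (_,_; _×_; proj₁; proj₂; ∃-syntax)
open import Data.Rational as ℚ using (ℚ; 0ℚ; 1ℚ)
import Data.Rational.Properties as ℚ
open import Data.Sum using (inj₁; inj₂)
open import Data.Unit using (tt; ⊤)
open import Data.Vec as Vec using (Vec; []; _∷_)
open import Relation.Binary.PropositionalEquality
open import Relation.Nullary using (Dec; contradiction; no; yes; ¬_)
open import Relation.Nullary.Decidable using (True; _×-dec_; from-yes; toWitness)
open import Tactic.RingSolver using (solve-∀)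

-- No tail of the Euler product is ever estimated. Sieving by the primes below m counts exactly as
-- soon as m > n, and the main term of this sieve is n^k / k! times `f` times the m-th partial
-- product of `C`, so the inequality already holds between the m-th approximations. The price is
-- that d runs over all products of distinct primes below m and that the errors must be summed
-- uniformly in m. An error of order k ^ ω(d) / d alone has no such uniform sum, which is why the
-- extra factor n / d is needed beyond n; it is available because d would have to divide 0 < x < n,
-- so that only the main term is left there.
--
-- The case k = 1 stands apart because R(p) = 1 for p dividing n, which violates R(p) ≤ k p^(k-2).
--
-- The split at 2048 comes from the additive 3 in 3 + Σ 1 / i: the constants left over from the
-- factorials absorb it only once Σ 1 / i exceeds about 5.2.

-- Rational arithmetic, powers, finite sums and products

module Rational where

  open import Defs using (_//_; //-+; //-*; //-cong; //-mono-≤; 0≤//; 0<//; *-mono; 0≤*; ≤⇒0≤; Σ<; ∏<)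
  open import Data.Maybe using (Maybe; just; nothing)
  open import Data.Rational using (_+_; _*_; _-_; _≤_; _<_)
  open import Level using (0ℓ)
  open import Tactic.RingSolver.Core.AlmostCommutativeRing using (AlmostCommutativeRing; fromCommutativeRing)

  isZero? : ∀ q → Maybe (0ℚ ≡ q)
  isZero? q with 0ℚ ℚ.≟ q
  ... | yes h = just h
  ... | no _  = nothing

  ring : AlmostCommutativeRing 0ℓ 0ℓ
  ring = fromCommutativeRing ℚ.+-*-commutativeRing isZero?

  -- Reduces an inequality to a ring identity with an explicit nonnegative difference, which the
  -- ring solver can check.
  ≤-by : ∀ {p q r} → 0ℚ ≤ r → p + r ≡ q → p ≤ q
  ≤-by {p} {q} {r} 0≤r e = subst₂ _≤_ (ℚ.+-identityʳ p) e (ℚ.+-monoʳ-≤ p 0≤r)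

  *-monoˡ : ∀ {a b c} → 0ℚ ≤ c → a ≤ b → c * a ≤ c * b
  *-monoˡ {c = c} 0≤c = ℚ.*-monoˡ-≤-nonNeg c {{ℚ.nonNegative 0≤c}}

  *-monoʳ : ∀ {a b c} → 0ℚ ≤ c → a ≤ b → a * c ≤ b * c
  *-monoʳ {c = c} 0≤c = ℚ.*-monoʳ-≤-nonNeg c {{ℚ.nonNegative 0≤c}}

  0≤1 : 0ℚ ≤ 1ℚ
  0≤1 = ℚ.nonNegative⁻¹ 1ℚ

  p≤p+q : ∀ p {q} → 0ℚ ≤ q → p ≤ p + q
  p≤p+q p 0≤q = ≤-by 0≤q refl

  ⟦_⟧ : ℕ → ℚ
  ⟦ n ⟧ = n // 1

  ⟦+⟧ : ∀ a b → ⟦ a ⟧ + ⟦ b ⟧ ≡ ⟦ a ℕ.+ b ⟧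
  ⟦+⟧ a b = trans (//-+ a b 1 1) (cong ⟦_⟧ (cong₂ ℕ._+_ (ℕ.*-identityʳ a) (ℕ.*-identityʳ b)))

  ⟦*⟧ : ∀ a b → ⟦ a ⟧ * ⟦ b ⟧ ≡ ⟦ a ℕ.* b ⟧
  ⟦*⟧ a b = //-* a b 1 1

  ⟦suc⟧ : ∀ a → ⟦ suc a ⟧ ≡ 1ℚ + ⟦ a ⟧
  ⟦suc⟧ a = sym (⟦+⟧ 1 a)

  ⟦⟧-mono : ∀ {a b} → a ℕ.≤ b → ⟦ a ⟧ ≤ ⟦ b ⟧
  ⟦⟧-mono {a} {b} h = //-mono-≤ a b 1 1 (ℕ.*-monoˡ-≤ 1 h)

  0≤⟦⟧ : ∀ a → 0ℚ ≤ ⟦ a ⟧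
  0≤⟦⟧ a = 0≤// a 1

  1≤⟦⟧ : ∀ a .{{_ : ℕ.NonZero a}} → 1ℚ ≤ ⟦ a ⟧
  1≤⟦⟧ (suc a) = ⟦⟧-mono {1} {suc a} (s≤s z≤n)

  0<⟦⟧ : ∀ a .{{_ : ℕ.NonZero a}} → 0ℚ < ⟦ a ⟧
  0<⟦⟧ a = 0<// a 1

  -- 1 / n, with the junk value 0 at n = 0
  ι : ℕ → ℚ
  ι zero    = 0ℚ
  ι (suc n) = 1 // suc n

  0≤ι : ∀ n → 0ℚ ≤ ι n
  0≤ι zero    = ℚ.≤-refl
  0≤ι (suc n) = 0≤// 1 (suc n)

  ι-inverse : ∀ n .{{_ : ℕ.NonZero n}} → ⟦ n ⟧ * ι n ≡ 1ℚ
  ι-inverse (suc n) = trans (//-* (suc n) 1 1 (suc n))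
    (//-cong (suc n ℕ.* 1) 1 (1 ℕ.* suc n) 1
      (trans (ℕ.*-identityʳ (suc n ℕ.* 1)) (trans (ℕ.*-comm (suc n) 1) (sym (ℕ.*-identityˡ (1 ℕ.* suc n))))))

  ι-* : ∀ m n → ι (m ℕ.* n) ≡ ι m * ι n
  ι-* zero    n       = sym (ℚ.*-zeroˡ (ι n))
  ι-* (suc m) zero    = trans (cong ι (ℕ.*-zeroʳ m)) (sym (ℚ.*-zeroʳ (ι (suc m))))
  ι-* (suc m) (suc n) = sym (//-* 1 1 (suc m) (suc n))

  ι-antimono : ∀ {m n} .{{_ : ℕ.NonZero m}} → m ℕ.≤ n → ι n ≤ ι m
  ι-antimono {suc m} {suc n} h = //-mono-≤ 1 1 (suc n) (suc m) (ℕ.*-monoʳ-≤ 1 h)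

  //≡*ι : ∀ a b .{{_ : ℕ.NonZero b}} → a // b ≡ ⟦ a ⟧ * ι b
  //≡*ι a (suc b) = sym (trans (//-* a 1 1 (suc b))
    (//-cong (a ℕ.* 1) a (1 ℕ.* suc b) (suc b)
      (cong₂ ℕ._*_ (ℕ.*-identityʳ a) (sym (ℕ.*-identityˡ (suc b))))))

  infixr 8 _^_

  _^_ : ℚ → ℕ → ℚ
  q ^ zero  = 1ℚ
  q ^ suc k = q * q ^ k

  0≤^ : ∀ {q} k → 0ℚ ≤ q → 0ℚ ≤ q ^ k
  0≤^ zero    _   = 0≤1
  0≤^ (suc k) 0≤q = 0≤* 0≤q (0≤^ k 0≤q)

  ^-mono : ∀ {p q} k → 0ℚ ≤ p → p ≤ q → p ^ k ≤ q ^ k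
  ^-mono zero    _   _   = ℚ.≤-refl
  ^-mono (suc k) 0≤p p≤q = *-mono 0≤p p≤q (0≤^ k 0≤p) (^-mono k 0≤p p≤q)

  ^-* : ∀ p q k → (p * q) ^ k ≡ p ^ k * q ^ k
  ^-* p q zero    = sym (ℚ.*-identityˡ 1ℚ)
  ^-* p q (suc k) = trans (cong (p * q *_) (^-* p q k)) (lemma p q (p ^ k) (q ^ k))
    where
    lemma : ∀ p q P Q → (p * q) * (P * Q) ≡ (p * P) * (q * Q)
    lemma = solve-∀ ring

  1^ : ∀ k → 1ℚ ^ k ≡ 1ℚ
  1^ zero    = refl
  1^ (suc k) = trans (ℚ.*-identityˡ (1ℚ ^ k)) (1^ k)

  ⟦^⟧ : ∀ n k → ⟦ n ⟧ ^ k ≡ ⟦ n ℕ.^ k ⟧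
  ⟦^⟧ n zero    = refl
  ⟦^⟧ n (suc k) = trans (cong (⟦ n ⟧ *_) (⟦^⟧ n k)) (⟦*⟧ n (n ℕ.^ k))

  -- Mean value inequality with the derivative taken at the larger end. Multiplying the induction
  -- hypothesis by a leaves the slack (a - b) (a^(k+1) - b^(k+1)).
  ^-diff-upper : ∀ {a b} k → 0ℚ ≤ b → b ≤ a →
    a ^ suc k ≤ b ^ suc k + ⟦ suc k ⟧ * (a - b) * a ^ k
  ^-diff-upper {a} {b} zero 0≤b b≤a = ℚ.≤-reflexive (lemma a b)
    where
    lemma : ∀ a b → a * 1ℚ ≡ b * 1ℚ + 1ℚ * (a - b) * 1ℚ
    lemma = solve-∀ ring
  ^-diff-upper {a} {b} (suc k) 0≤b b≤a = ℚ.≤-trans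
    (*-monoˡ (ℚ.≤-trans 0≤b b≤a) (^-diff-upper k 0≤b b≤a))
    (≤-by (0≤* (≤⇒0≤ b≤a) (≤⇒0≤ (^-mono (suc k) 0≤b b≤a)))
      (trans (lemma a b (b ^ k) (a ^ k) ⟦ suc k ⟧)
        (cong (λ z → b ^ suc (suc k) + z * (a - b) * a ^ suc k) (sym (⟦suc⟧ (suc k))))))
    where
    lemma : ∀ a b B A c → a * (b * B + c * (a - b) * A) + (a - b) * (a * A - b * B)
      ≡ b * (b * B) + (1ℚ + c) * (a - b) * (a * A)
    lemma = solve-∀ ring

  -- The counterpart with the derivative at the smaller end; here the slack in the induction is (k +
  -- 1) (a - b)² b^k.
  ^-diff-lower : ∀ {a b} k → 0ℚ ≤ b → b ≤ a →
    b ^ suc k + ⟦ suc k ⟧ * (a - b) * b ^ k ≤ a ^ suc k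
  ^-diff-lower {a} {b} zero 0≤b b≤a = ℚ.≤-reflexive (lemma a b)
    where
    lemma : ∀ a b → b * 1ℚ + 1ℚ * (a - b) * 1ℚ ≡ a * 1ℚ
    lemma = solve-∀ ring
  ^-diff-lower {a} {b} (suc k) 0≤b b≤a = ℚ.≤-trans
    (≤-by (0≤* (0≤⟦⟧ (suc k)) (0≤* (0≤* (≤⇒0≤ b≤a) (≤⇒0≤ b≤a)) (0≤^ k 0≤b)))
      (trans (cong (λ z → b ^ suc (suc k) + z * (a - b) * b ^ suc k + ⟦ suc k ⟧ * ((a - b) * (a - b) * b ^ k)) (⟦suc⟧ (suc k)))
        (lemma a b (b ^ k) ⟦ suc k ⟧)))
    (*-monoˡ (ℚ.≤-trans 0≤b b≤a) (^-diff-lower k 0≤b b≤a))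
    where
    lemma : ∀ a b B c → b * (b * B) + (1ℚ + c) * (a - b) * (b * B) + c * ((a - b) * (a - b) * B)
      ≡ a * (b * B + c * (a - b) * B)
    lemma = solve-∀ ring

  𝟙 : ∀ {P : Set} → Dec P → ℚ
  𝟙 (yes _) = 1ℚ
  𝟙 (no  _) = 0ℚ

  𝟙-yes : ∀ {P : Set} (d : Dec P) → P → 𝟙 d ≡ 1ℚ
  𝟙-yes (yes _) _ = refl
  𝟙-yes (no ¬p) p = contradiction p ¬p

  𝟙-no : ∀ {P : Set} (d : Dec P) → ¬ P → 𝟙 d ≡ 0ℚ
  𝟙-no (yes p) ¬p = contradiction p ¬p
  𝟙-no (no _)  _  = refl

  𝟙-cong : ∀ {P Q : Set} (d : Dec P) (e : Dec Q) → (P → Q) → (Q → P) → 𝟙 d ≡ 𝟙 e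
  𝟙-cong (yes p) e f _ = sym (𝟙-yes e (f p))
  𝟙-cong (no ¬p) e _ g = sym (𝟙-no e (λ q → ¬p (g q)))

  0≤𝟙 : ∀ {P : Set} (d : Dec P) → 0ℚ ≤ 𝟙 d
  0≤𝟙 (yes _) = 0≤1
  0≤𝟙 (no  _) = ℚ.≤-refl

  𝟙≤1 : ∀ {P : Set} (d : Dec P) → 𝟙 d ≤ 1ℚ
  𝟙≤1 (yes _) = ℚ.≤-refl
  𝟙≤1 (no  _) = 0≤1

  Σ-cong : ∀ n {f g : ℕ → ℚ} → (∀ i → i ℕ.< n → f i ≡ g i) → Σ< n f ≡ Σ< n g
  Σ-cong zero    _ = refl
  Σ-cong (suc n) h = cong₂ _+_ (Σ-cong n λ i i<n → h i (ℕ.m<n⇒m<1+n i<n)) (h n (ℕ.n<1+n n))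

  Σ-mono : ∀ n {f g : ℕ → ℚ} → (∀ i → i ℕ.< n → f i ≤ g i) → Σ< n f ≤ Σ< n g
  Σ-mono zero    _ = ℚ.≤-refl
  Σ-mono (suc n) h = ℚ.+-mono-≤ (Σ-mono n λ i i<n → h i (ℕ.m<n⇒m<1+n i<n)) (h n (ℕ.n<1+n n))

  Σ-zero : ∀ n → Σ< n (λ _ → 0ℚ) ≡ 0ℚ
  Σ-zero zero    = refl
  Σ-zero (suc n) = trans (ℚ.+-identityʳ _) (Σ-zero n)

  0≤Σ : ∀ n {f : ℕ → ℚ} → (∀ i → i ℕ.< n → 0ℚ ≤ f i) → 0ℚ ≤ Σ< n f
  0≤Σ n {f} h = subst (_≤ Σ< n f) (Σ-zero n) (Σ-mono n h)

  Σ-+ : ∀ n (f g : ℕ → ℚ) → Σ< n (λ i → f i + g i) ≡ Σ< n f + Σ< n g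
  Σ-+ zero    f g = sym (ℚ.+-identityˡ 0ℚ)
  Σ-+ (suc n) f g = trans (cong (_+ (f n + g n)) (Σ-+ n f g)) (lemma (Σ< n f) (Σ< n g) (f n) (g n))
    where
    lemma : ∀ a b c d → (a + b) + (c + d) ≡ (a + c) + (b + d)
    lemma = solve-∀ ring

  Σ-*ˡ : ∀ n c (f : ℕ → ℚ) → Σ< n (λ i → c * f i) ≡ c * Σ< n f
  Σ-*ˡ zero    c f = sym (ℚ.*-zeroʳ c)
  Σ-*ˡ (suc n) c f = trans (cong (_+ c * f n) (Σ-*ˡ n c f)) (sym (ℚ.*-distribˡ-+ c (Σ< n f) (f n)))

  Σ-*ʳ : ∀ n c (f : ℕ → ℚ) → Σ< n (λ i → f i * c) ≡ Σ< n f * c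
  Σ-*ʳ n c f = trans (Σ-cong n λ i _ → ℚ.*-comm (f i) c) (trans (Σ-*ˡ n c f) (ℚ.*-comm c (Σ< n f)))

  Σ-const : ∀ n c → Σ< n (λ _ → c) ≡ ⟦ n ⟧ * c
  Σ-const zero    c = sym (ℚ.*-zeroˡ c)
  Σ-const (suc n) c = trans (cong (_+ c) (Σ-const n c))
    (trans (lemma ⟦ n ⟧ c) (cong (_* c) (sym (⟦suc⟧ n))))
    where
    lemma : ∀ n c → n * c + c ≡ (1ℚ + n) * c
    lemma = solve-∀ ring

  Σ-head : ∀ n (f : ℕ → ℚ) → Σ< (suc n) f ≡ f 0 + Σ< n (λ i → f (suc i))
  Σ-head zero    f = ℚ.+-comm 0ℚ (f 0)
  Σ-head (suc n) f = trans (cong (_+ f (suc n)) (Σ-head n f)) (ℚ.+-assoc (f 0) _ (f (suc n)))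

  Σ-split : ∀ m n (f : ℕ → ℚ) → Σ< (m ℕ.+ n) f ≡ Σ< m f + Σ< n (λ i → f (m ℕ.+ i))
  Σ-split m zero    f = trans (cong (λ z → Σ< z f) (ℕ.+-identityʳ m)) (sym (ℚ.+-identityʳ (Σ< m f)))
  Σ-split m (suc n) f = trans (cong (λ z → Σ< z f) (ℕ.+-suc m n))
    (trans (cong (_+ f (m ℕ.+ n)) (Σ-split m n f)) (ℚ.+-assoc (Σ< m f) _ (f (m ℕ.+ n))))

  Σ-extend : ∀ {m n} (f : ℕ → ℚ) → m ℕ.≤ n → (∀ i → 0ℚ ≤ f i) → Σ< m f ≤ Σ< n f
  Σ-extend {m} {n} f m≤n 0≤f = subst (λ z → Σ< m f ≤ Σ< z f) (ℕ.m+[n∸m]≡n m≤n)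
    (≤-by (0≤Σ (n ℕ.∸ m) λ i _ → 0≤f (m ℕ.+ i)) (sym (Σ-split m (n ℕ.∸ m) f)))

  Σ-swap : ∀ m n (f : ℕ → ℕ → ℚ) → Σ< m (λ i → Σ< n (f i)) ≡ Σ< n (λ j → Σ< m (λ i → f i j))
  Σ-swap zero    n f = sym (Σ-zero n)
  Σ-swap (suc m) n f = trans (cong (_+ Σ< n (f m)) (Σ-swap m n f)) (sym (Σ-+ n _ _))

  Σ-blocks : ∀ M d (f : ℕ → ℚ) → Σ< (M ℕ.* d) f ≡ Σ[ w < M ] Σ[ r < d ] f (w ℕ.* d ℕ.+ r)
  Σ-blocks zero    d f = refl
  Σ-blocks (suc M) d f = trans (cong (λ z → Σ< z f) (ℕ.+-comm d (M ℕ.* d)))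
    (trans (Σ-split (M ℕ.* d) d f) (cong (_+ (Σ[ r < d ] f (M ℕ.* d ℕ.+ r))) (Σ-blocks M d f)))

  Σ-δ : ∀ n i (f : ℕ → ℚ) → i ℕ.< n → Σ[ z < n ] 𝟙 (z ℕ.≟ i) * f z ≡ f i
  Σ-δ (suc n) i f i<1+n with n ℕ.≟ i
  ... | yes refl = trans (cong (_+ 1ℚ * f n) (trans (Σ-cong n λ z z<n →
        trans (cong (_* f z) (𝟙-no (z ℕ.≟ n) (ℕ.<⇒≢ z<n))) (ℚ.*-zeroˡ (f z))) (Σ-zero n)))
        (trans (ℚ.+-identityˡ (1ℚ * f n)) (ℚ.*-identityˡ (f n)))
  ... | no n≢i = trans (cong ((Σ[ z < n ] 𝟙 (z ℕ.≟ i) * f z) +_) (ℚ.*-zeroˡ (f n)))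
        (trans (ℚ.+-identityʳ _) (Σ-δ n i f (ℕ.≤∧≢⇒< (ℕ.s≤s⁻¹ i<1+n) (λ e → n≢i (sym e)))))

  ∏-cong : ∀ n {f g : ℕ → ℚ} → (∀ i → i ℕ.< n → f i ≡ g i) → ∏< n f ≡ ∏< n g
  ∏-cong zero    _ = refl
  ∏-cong (suc n) h = cong₂ _*_ (∏-cong n λ i i<n → h i (ℕ.m<n⇒m<1+n i<n)) (h n (ℕ.n<1+n n))

  ∏-* : ∀ n (f g : ℕ → ℚ) → ∏< n (λ i → f i * g i) ≡ ∏< n f * ∏< n g
  ∏-* zero    f g = sym (ℚ.*-identityˡ 1ℚ)
  ∏-* (suc n) f g = trans (cong (_* (f n * g n)) (∏-* n f g)) (lemma (∏< n f) (∏< n g) (f n) (g n))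
    where
    lemma : ∀ a b c d → (a * b) * (c * d) ≡ (a * c) * (b * d)
    lemma = solve-∀ ring

-- Sums of periodic functions over boxes and simplices, Chinese remainder theorem

module PeriodicSums where

  open Rational
  open import Defs using (Σ<)
  open import Data.Nat.Coprimality using (Coprime; coprime-Bézout)
  open import Data.Rational using (_+_; _*_; _-_; _≤_)

  Box : ∀ k → ℕ → (Vec ℕ k → ℚ) → ℚ
  Box zero    d F = F []
  Box (suc k) d F = Σ[ z < d ] Box k d (λ v → F (z ∷ v))

  Box-cong : ∀ k d {F G : Vec ℕ k → ℚ} → (∀ v → F v ≡ G v) → Box k d F ≡ Box k d G
  Box-cong zero    d h = h []
  Box-cong (suc k) d h = Σ-cong d λ z _ → Box-cong k d λ v → h (z ∷ v)

  Box-mono : ∀ k d {F G : Vec ℕ k → ℚ} → (∀ v → F v ≤ G v) → Box k d F ≤ Box k d G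
  Box-mono zero    d h = h []
  Box-mono (suc k) d h = Σ-mono d λ z _ → Box-mono k d λ v → h (z ∷ v)

  Box-+ : ∀ k d (F G : Vec ℕ k → ℚ) → Box k d (λ v → F v + G v) ≡ Box k d F + Box k d G
  Box-+ zero    d F G = refl
  Box-+ (suc k) d F G = trans (Σ-cong d λ z _ → Box-+ k d _ _) (Σ-+ d _ _)

  Box-*ˡ : ∀ k d c (F : Vec ℕ k → ℚ) → Box k d (λ v → c * F v) ≡ c * Box k d F
  Box-*ˡ zero    d c F = refl
  Box-*ˡ (suc k) d c F = trans (Σ-cong d λ z _ → Box-*ˡ k d c _) (Σ-*ˡ d c _)

  Box-const : ∀ k d c → Box k d (λ _ → c) ≡ ⟦ d ⟧ ^ k * c
  Box-const zero    d c = sym (ℚ.*-identityˡ c)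
  Box-const (suc k) d c = trans (Σ-cong d λ z _ → Box-const k d c)
    (trans (Σ-const d _) (sym (ℚ.*-assoc ⟦ d ⟧ (⟦ d ⟧ ^ k) c)))

  0≤Box : ∀ k d {F : Vec ℕ k → ℚ} → (∀ v → 0ℚ ≤ F v) → 0ℚ ≤ Box k d F
  0≤Box zero    d h = h []
  0≤Box (suc k) d h = 0≤Σ d λ z _ → 0≤Box k d λ v → h (z ∷ v)

  Box-Σ : ∀ k d m (F : ℕ → Vec ℕ k → ℚ) → Box k d (λ v → Σ[ i < m ] F i v) ≡ Σ[ i < m ] Box k d (F i)
  Box-Σ zero    d m F = refl
  Box-Σ (suc k) d m F = trans (Σ-cong d λ z _ → Box-Σ k d m λ i v → F i (z ∷ v)) (Σ-swap d m _)

  -- The range is `Vec.sum v < N`. With y = v + 1 and n = N + k this says Σ y < n, that is x > 0.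
  -- The strict bound makes the range for N = 0 empty in every dimension.
  Simp : ∀ k → ℕ → (Vec ℕ k → ℚ) → ℚ
  Simp zero    zero    F = 0ℚ
  Simp zero    (suc N) F = F []
  Simp (suc k) N       F = Σ[ z < N ] Simp k (N ℕ.∸ z) (λ v → F (z ∷ v))

  ∸-positive⇒< : ∀ {z N s} → s ℕ.< N ℕ.∸ z → z ℕ.+ s ℕ.< N
  ∸-positive⇒< {zero}          h = h
  ∸-positive⇒< {suc z} {suc N} h = s≤s (∸-positive⇒< {z} h)

  Simp-cong : ∀ k N {F G : Vec ℕ k → ℚ} → (∀ v → Vec.sum v ℕ.< N → F v ≡ G v) → Simp k N F ≡ Simp k N G
  Simp-cong zero    zero    h = refl
  Simp-cong zero    (suc N) h = h [] (s≤s z≤n)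
  Simp-cong (suc k) N       h = Σ-cong N λ z _ → Simp-cong k (N ℕ.∸ z) λ v lt → h (z ∷ v) (∸-positive⇒< {z} lt)

  Simp-mono : ∀ k N {F G : Vec ℕ k → ℚ} → (∀ v → Vec.sum v ℕ.< N → F v ≤ G v) → Simp k N F ≤ Simp k N G
  Simp-mono zero    zero    h = ℚ.≤-refl
  Simp-mono zero    (suc N) h = h [] (s≤s z≤n)
  Simp-mono (suc k) N       h = Σ-mono N λ z _ → Simp-mono k (N ℕ.∸ z) λ v lt → h (z ∷ v) (∸-positive⇒< {z} lt)

  Simp-0 : ∀ k N → Simp k N (λ _ → 0ℚ) ≡ 0ℚ
  Simp-0 zero    zero    = refl
  Simp-0 zero    (suc N) = refl
  Simp-0 (suc k) N       = trans (Σ-cong N λ z _ → Simp-0 k (N ℕ.∸ z)) (Σ-zero N)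

  0≤Simp : ∀ k N {F : Vec ℕ k → ℚ} → (∀ v → 0ℚ ≤ F v) → 0ℚ ≤ Simp k N F
  0≤Simp k N {F} h = subst (_≤ Simp k N F) (Simp-0 k N) (Simp-mono k N λ v _ → h v)

  Simp-+ : ∀ k N (F G : Vec ℕ k → ℚ) → Simp k N (λ v → F v + G v) ≡ Simp k N F + Simp k N G
  Simp-+ zero    zero    F G = sym (ℚ.+-identityˡ 0ℚ)
  Simp-+ zero    (suc N) F G = refl
  Simp-+ (suc k) N       F G = trans (Σ-cong N λ z _ → Simp-+ k (N ℕ.∸ z) _ _) (Σ-+ N _ _)

  Simp-grow : ∀ k {M N} {F : Vec ℕ k → ℚ} → (∀ v → 0ℚ ≤ F v) → M ℕ.≤ N → Simp k M F ≤ Simp k N F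
  Simp-grow zero    {zero}  {N} h _ = 0≤Simp zero N h
  Simp-grow zero    {suc M} {suc N} h _ = ℚ.≤-refl
  Simp-grow (suc k) {M} {N} {F} h M≤N = ℚ.≤-trans
    (Σ-mono M λ z _ → Simp-grow k (λ v → h (z ∷ v)) (ℕ.∸-monoˡ-≤ z M≤N))
    (Σ-extend (λ z → Simp k (N ℕ.∸ z) (λ v → F (z ∷ v))) M≤N λ z → 0≤Simp k (N ℕ.∸ z) λ v → h (z ∷ v))

  T : ℕ → ℕ → ℚ
  T k M = Simp k M (λ _ → 1ℚ)

  Box-simplex : ∀ k n N (F : Vec ℕ k → ℚ) → N ℕ.≤ n →
    Box k n (λ v → 𝟙 (Vec.sum v ℕ.<? N) * F v) ≡ Simp k N F
  Box-simplex zero    n zero    F _ = ℚ.*-zeroˡ (F [])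
  Box-simplex zero    n (suc N) F _ = ℚ.*-identityˡ (F [])
  Box-simplex (suc k) n N F N≤n = trans
    (cong (λ m → Σ[ z < m ] Box k n (λ v → 𝟙 (z ℕ.+ Vec.sum v ℕ.<? N) * F (z ∷ v))) (sym (ℕ.m+[n∸m]≡n N≤n)))
    (trans (Σ-split N (n ℕ.∸ N) _)
      (trans (cong₂ _+_
          (Σ-cong N λ z z<N → trans
            (Box-cong k n λ v → cong (_* F (z ∷ v))
              (𝟙-cong (z ℕ.+ Vec.sum v ℕ.<? N) (Vec.sum v ℕ.<? N ℕ.∸ z)
                (λ h → ℕ.m+n≤o⇒m≤o∸n (suc (Vec.sum v)) (subst (ℕ._≤ N) (cong suc (ℕ.+-comm z (Vec.sum v))) h)) (∸-positive⇒< {z})))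
            (Box-simplex k n (N ℕ.∸ z) (λ v → F (z ∷ v)) (ℕ.≤-trans (ℕ.m∸n≤m N z) N≤n)))
          (trans (Σ-cong (n ℕ.∸ N) λ i _ → trans
              (Box-cong k n {G = λ _ → 0ℚ} λ v → trans (cong (_* F (N ℕ.+ i ∷ v))
                (𝟙-no (N ℕ.+ i ℕ.+ Vec.sum v ℕ.<? N)
                  (ℕ.≤⇒≯ (ℕ.≤-trans (ℕ.m≤m+n N i) (ℕ.m≤m+n (N ℕ.+ i) (Vec.sum v))))))
                (ℚ.*-zeroˡ (F (N ℕ.+ i ∷ v))))
              (trans (Box-const k n 0ℚ) (ℚ.*-zeroʳ (⟦ n ⟧ ^ k))))
            (Σ-zero (n ℕ.∸ N))))
        (ℚ.+-identityʳ _)))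

  Per : ℕ → (ℕ → ℚ) → Set
  Per d f = ∀ z → f (d ℕ.+ z) ≡ f z

  Per-multiple : ∀ {d f} → Per d f → ∀ w r → f (w ℕ.* d ℕ.+ r) ≡ f r
  Per-multiple         per zero    r = refl
  Per-multiple {d} {f} per (suc w) r = trans (cong f (ℕ.+-assoc d (w ℕ.* d) r))
    (trans (per (w ℕ.* d ℕ.+ r)) (Per-multiple per w r))

  Per-* : ∀ {d f} → Per d f → ∀ m → Per (m ℕ.* d) f
  Per-* per m z = Per-multiple per m z

  Σ-period-shift : ∀ {d f} → Per d f → ∀ c → Σ[ z < d ] f (c ℕ.+ z) ≡ Σ< d f
  Σ-period-shift         per zero    = refl
  Σ-period-shift {d} {f} per (suc c) = trans (cancel (f c) _ _ eq) (Σ-period-shift per c)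
    where
    lemma : ∀ a x → x ≡ (a + x) - a
    lemma = solve-∀ ring
    lemma′ : ∀ a y → (y + a) - a ≡ y
    lemma′ = solve-∀ ring
    cancel : ∀ a x y → a + x ≡ y + a → x ≡ y
    cancel a x y e = trans (lemma a x) (trans (cong (_- a) e) (lemma′ a y))
    eq : f c + (Σ[ z < d ] f (suc c ℕ.+ z)) ≡ (Σ[ z < d ] f (c ℕ.+ z)) + f c
    eq = trans (cong₂ (λ i s → f i + s) (sym (ℕ.+-identityʳ c)) (Σ-cong d λ z _ → cong f (sym (ℕ.+-suc c z))))
      (trans (sym (Σ-head d (λ z → f (c ℕ.+ z))))
        (cong ((Σ[ z < d ] f (c ℕ.+ z)) +_) (trans (cong f (ℕ.+-comm c d)) (per c))))

  Periodic : ∀ k → ℕ → (Vec ℕ k → ℚ) → Set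
  Periodic zero    d F = ⊤
  Periodic (suc k) d F = (∀ v → Per d (λ z → F (z ∷ v))) × (∀ z → Periodic k d (λ v → F (z ∷ v)))

  Periodic-* : ∀ k {d F} → Periodic k d F → ∀ m → Periodic k (m ℕ.* d) F
  Periodic-* zero    _       m = tt
  Periodic-* (suc k) (p , q) m = (λ v → Per-* (p v) m) , λ z → Periodic-* k (q z) m

  Periodic-× : ∀ k {d F G} → Periodic k d F → Periodic k d G → Periodic k d (λ v → F v * G v)
  Periodic-× zero    _       _         = tt
  Periodic-× (suc k) (p , q) (p′ , q′) = (λ v z → cong₂ _*_ (p v z) (p′ v z)) , λ z → Periodic-× k (q z) (q′ z)

  -- Cut space into cubes of side d with corners d w. As N ≤ M d, only cubes with Σ w < M meet the
  -- simplex, and by periodicity each contributes at most `Box k d F`.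
  Simp-upper : ∀ k d M N (F : Vec ℕ k → ℚ) → Periodic k d F → (∀ v → 0ℚ ≤ F v) → N ℕ.≤ M ℕ.* d →
    Simp k N F ≤ T k M * Box k d F
  Simp-upper zero d zero    zero    F _ 0≤F _ = ℚ.≤-reflexive (sym (ℚ.*-zeroˡ (F [])))
  Simp-upper zero d zero    (suc N) F _ 0≤F ()
  Simp-upper zero d (suc M) zero    F _ 0≤F _ = subst (0ℚ ≤_) (sym (ℚ.*-identityˡ (F []))) (0≤F [])
  Simp-upper zero d (suc M) (suc N) F _ 0≤F _ = ℚ.≤-reflexive (sym (ℚ.*-identityˡ (F [])))
  Simp-upper (suc k) d M N F (p , q) 0≤F N≤Md = ℚ.≤-trans (Simp-grow (suc k) 0≤F N≤Md)
    (subst₂ _≤_ (sym (Σ-blocks M d _))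
      (trans (Σ-cong M λ w _ → Σ-*ˡ d (T k (M ℕ.∸ w)) (λ r → Box k d (λ v → F (r ∷ v)))) (Σ-*ʳ M _ (λ w → T k (M ℕ.∸ w))))
      (Σ-mono M λ w _ → Σ-mono d λ r _ → ℚ.≤-trans
        (ℚ.≤-reflexive (Simp-cong k _ λ v _ → Per-multiple (p v) w r))
        (Simp-upper k d (M ℕ.∸ w) _ (λ v → F (r ∷ v)) (q r) (λ v → 0≤F (r ∷ v)) (bnd w r))))
    where
    bnd : ∀ w r → M ℕ.* d ℕ.∸ (w ℕ.* d ℕ.+ r) ℕ.≤ (M ℕ.∸ w) ℕ.* d
    bnd w r = ℕ.≤-trans (ℕ.∸-monoʳ-≤ (M ℕ.* d) (ℕ.m≤m+n (w ℕ.* d) r)) (ℕ.≤-reflexive (sym (ℕ.*-distribʳ-∸ d M w)))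

  -- With d = e + 1, the far corner of the cube at d w has coordinate sum d Σ w + k e, at most (M -
  -- 1) d + k e when Σ w < M. The hypothesis puts this below N, so these cubes lie inside the
  -- simplex.
  Simp-lower : ∀ k e M N (F : Vec ℕ k → ℚ) → Periodic k (suc e) F → (∀ v → 0ℚ ≤ F v) →
    M ℕ.* suc e ℕ.+ k ℕ.* e ℕ.≤ N ℕ.+ e → T k M * Box k (suc e) F ≤ Simp k N F
  Simp-lower zero e zero    N       F _ 0≤F _ = ℚ.≤-trans (ℚ.≤-reflexive (ℚ.*-zeroˡ (F []))) (0≤Simp zero N 0≤F)
  Simp-lower zero e (suc M) (suc N) F _ 0≤F _ = ℚ.≤-reflexive (ℚ.*-identityˡ (F []))
  Simp-lower zero e (suc M) zero    F _ 0≤F h =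
    contradiction (ℕ.≤-trans (ℕ.≤-trans (ℕ.m≤m+n (suc e) (M ℕ.* suc e)) (ℕ.m≤m+n _ 0)) h) (ℕ.<⇒≱ (ℕ.n<1+n e))
  Simp-lower (suc k) e M N F (p , q) 0≤F h = subst₂ _≤_
    (trans (Σ-cong M λ w _ → Σ-*ˡ d (T k (M ℕ.∸ w)) (λ r → Box k d (λ v → F (r ∷ v)))) (Σ-*ʳ M _ (λ w → T k (M ℕ.∸ w))))
    refl
    (ℚ.≤-trans
      (Σ-mono M λ w w<M → Σ-mono d λ r r<d → ℚ.≤-trans
        (Simp-lower k e (M ℕ.∸ w) (N ℕ.∸ (w ℕ.* d ℕ.+ r)) (λ v → F (r ∷ v)) (q r) (λ v → 0≤F (r ∷ v)) (bnd w r w<M (ℕ.s≤s⁻¹ r<d)))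
        (ℚ.≤-reflexive (Simp-cong k _ λ v _ → sym (Per-multiple (p v) w r))))
      (ℚ.≤-trans (ℚ.≤-reflexive (sym (Σ-blocks M d (λ z → Simp k (N ℕ.∸ z) (λ v → F (z ∷ v))))))
        (Σ-extend (λ z → Simp k (N ℕ.∸ z) (λ v → F (z ∷ v))) (ℕ.≤-trans (ℕ.m≤m+n (M ℕ.* d) (k ℕ.* e)) h′)
          λ z → 0≤Simp k (N ℕ.∸ z) λ v → 0≤F (z ∷ v))))
    where
    d = suc e
    h′ : M ℕ.* d ℕ.+ k ℕ.* e ℕ.≤ N
    h′ = ℕ.+-cancelʳ-≤ e _ _ (ℕ.≤-trans (ℕ.≤-reflexive (lemma (M ℕ.* d) (k ℕ.* e) e)) h)
      where
      lemma : ∀ a b e → a ℕ.+ b ℕ.+ e ≡ a ℕ.+ (e ℕ.+ b)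
      lemma = ℕ-solve-∀
    bnd : ∀ w r → w ℕ.< M → r ℕ.≤ e → (M ℕ.∸ w) ℕ.* d ℕ.+ k ℕ.* e ℕ.≤ N ℕ.∸ (w ℕ.* d ℕ.+ r) ℕ.+ e
    bnd w r w<M r≤e = ℕ.+-cancelʳ-≤ X _ _ (begin
      (M ℕ.∸ w) ℕ.* d ℕ.+ k ℕ.* e ℕ.+ X       ≡⟨ lemma₁ (M ℕ.∸ w) w d (k ℕ.* e) r ⟩
      (M ℕ.∸ w ℕ.+ w) ℕ.* d ℕ.+ k ℕ.* e ℕ.+ r ≡⟨ cong (λ z → z ℕ.* d ℕ.+ k ℕ.* e ℕ.+ r) (ℕ.m∸n+n≡m (ℕ.<⇒≤ w<M)) ⟩
      M ℕ.* d ℕ.+ k ℕ.* e ℕ.+ r               ≤⟨ ℕ.+-mono-≤ h′ r≤e ⟩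
      N ℕ.+ e                                 ≡⟨ cong (ℕ._+ e) (sym (ℕ.m∸n+n≡m X≤N)) ⟩
      N ℕ.∸ X ℕ.+ X ℕ.+ e                     ≡⟨ lemma₂ (N ℕ.∸ X) X e ⟩
      N ℕ.∸ X ℕ.+ e ℕ.+ X                     ∎)
      where
      open ℕ.≤-Reasoning
      X = w ℕ.* d ℕ.+ r
      X≤N : X ℕ.≤ N
      X≤N = begin
        w ℕ.* d ℕ.+ r ≤⟨ ℕ.+-monoʳ-≤ (w ℕ.* d) (ℕ.m≤n⇒m≤1+n r≤e) ⟩
        w ℕ.* d ℕ.+ d ≡⟨ ℕ.+-comm (w ℕ.* d) d ⟩
        suc w ℕ.* d   ≤⟨ ℕ.*-monoˡ-≤ d w<M ⟩
        M ℕ.* d       ≤⟨ ℕ.m≤m+n _ _ ⟩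
        M ℕ.* d ℕ.+ k ℕ.* e ≤⟨ h′ ⟩
        N ∎
      lemma₁ : ∀ m w d k r → m ℕ.* d ℕ.+ k ℕ.+ (w ℕ.* d ℕ.+ r) ≡ (m ℕ.+ w) ℕ.* d ℕ.+ k ℕ.+ r
      lemma₁ = ℕ-solve-∀
      lemma₂ : ∀ a x e → a ℕ.+ x ℕ.+ e ≡ a ℕ.+ e ℕ.+ x
      lemma₂ = ℕ-solve-∀

  -- The sum is invariant under r ↦ r + a and r ↦ r + b, hence (Bézout) under
  -- r ↦ r + 1; averaging over r then identifies its value.
  Σ-progression : ∀ a b .{{_ : ℕ.NonZero b}} h → Coprime a b → Per b h →
    ∀ r → Σ[ w < b ] h (w ℕ.* a ℕ.+ r) ≡ Σ< b h
  Σ-progression a b h cop per r = trans (const r) (ℚ.≤-antisym (cancel (ℚ.≤-reflexive total)) (cancel (ℚ.≤-reflexive (sym total))))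
    where
    S : ℕ → ℚ
    S r = Σ[ w < b ] h (w ℕ.* a ℕ.+ r)
    S-a : Per a S
    S-a r = trans (Σ-cong b λ w _ → cong h (lemma w a r))
      (Σ-period-shift {b} {λ w → h (w ℕ.* a ℕ.+ r)} (λ w → trans (cong h (lemma′ b w a r)) (Per-* per a (w ℕ.* a ℕ.+ r))) 1)
      where
      lemma : ∀ w a r → w ℕ.* a ℕ.+ (a ℕ.+ r) ≡ (1 ℕ.+ w) ℕ.* a ℕ.+ r
      lemma = ℕ-solve-∀
      lemma′ : ∀ b w a r → (b ℕ.+ w) ℕ.* a ℕ.+ r ≡ a ℕ.* b ℕ.+ (w ℕ.* a ℕ.+ r)
      lemma′ = ℕ-solve-∀
    S-b : Per b S
    S-b r = Σ-cong b λ w _ → trans (cong h (lemma w a b r)) (per (w ℕ.* a ℕ.+ r))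
      where
      lemma : ∀ w a b r → w ℕ.* a ℕ.+ (b ℕ.+ r) ≡ b ℕ.+ (w ℕ.* a ℕ.+ r)
      lemma = ℕ-solve-∀
    S-1 : Per 1 S
    S-1 r with coprime-Bézout cop
    ... | ℕ.Bézout.Identity.+- x y e = trans (sym (Per-* S-b y (suc r)))
          (trans (cong S (trans (ℕ.+-suc (y ℕ.* b) r) (cong (ℕ._+ r) e))) (Per-* S-a x r))
    ... | ℕ.Bézout.Identity.-+ x y e = trans (sym (Per-* S-a x (suc r)))
          (trans (cong S (trans (ℕ.+-suc (x ℕ.* a) r) (cong (ℕ._+ r) e))) (Per-* S-b y r))
    const : ∀ r → S r ≡ S 0
    const zero    = refl
    const (suc r) = trans (S-1 r) (const r)
    total : ⟦ b ⟧ * S 0 ≡ ⟦ b ⟧ * Σ< b h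
    total = trans (sym (Σ-const b (S 0))) (trans (Σ-cong b λ r _ → sym (const r))
      (trans (Σ-swap b b (λ r w → h (w ℕ.* a ℕ.+ r)))
        (trans (Σ-cong b λ w _ → Σ-period-shift per (w ℕ.* a)) (Σ-const b (Σ< b h)))))
    cancel : ∀ {p q} → ⟦ b ⟧ * p ≤ ⟦ b ⟧ * q → p ≤ q
    cancel = ℚ.*-cancelˡ-≤-pos ⟦ b ⟧ {{ℚ.positive (0<⟦⟧ b)}}

  -- Write z = w a + r: then g sees only r, while h runs through a progression of step a, whose sum
  -- does not depend on r.
  Σ-CRT : ∀ a b .{{_ : ℕ.NonZero b}} g h → Coprime a b → Per a g → Per b h →
    Σ[ z < a ℕ.* b ] g z * h z ≡ Σ< a g * Σ< b h
  Σ-CRT a b g h cop p q = trans (cong (λ m → Σ[ z < m ] g z * h z) (ℕ.*-comm a b))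
    (trans (Σ-blocks b a _) (trans (Σ-swap b a _)
      (trans (Σ-cong a λ r _ → trans (Σ-cong b λ w _ → cong (_* h (w ℕ.* a ℕ.+ r)) (Per-multiple p w r))
          (trans (Σ-*ˡ b (g r) _) (cong (g r *_) (Σ-progression a b h cop q r))))
        (Σ-*ʳ a (Σ< b h) g))))

  Box-CRT : ∀ k a b .{{_ : ℕ.NonZero b}} (F G : Vec ℕ k → ℚ) → Coprime a b → Periodic k a F → Periodic k b G →
    Box k (a ℕ.* b) (λ v → F v * G v) ≡ Box k a F * Box k b G
  Box-CRT zero    a b F G cop _       _         = refl
  Box-CRT (suc k) a b F G cop (p , q) (p′ , q′) = trans
    (Σ-cong (a ℕ.* b) λ z _ → Box-CRT k a b (λ v → F (z ∷ v)) (λ v → G (z ∷ v)) cop (q z) (q′ z))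
    (Σ-CRT a b (λ z → Box k a (λ v → F (z ∷ v))) (λ z → Box k b (λ v → G (z ∷ v))) cop
      (λ z → Box-cong k a λ v → p v z) (λ z → Box-cong k b λ v → p′ v z))

-- Counting cubes in the simplex and the resulting error

module SimplexCounts where

  open Rational
  open PeriodicSums
  open import Defs using (0≤*; 0≤+; ∣-∣≤)
  open import Data.Rational using (_+_; _*_; _-_; -_; _≤_; ∣_∣)

  T-suc : ∀ k M → T (suc k) (suc M) ≡ T k (suc M) + T (suc k) M
  T-suc k M = Σ-head M λ w → T k (suc M ℕ.∸ w)

  T-!-suc : ∀ k M → ⟦ suc k ! ⟧ * T (suc k) (suc M)
    ≡ ⟦ suc k ! ⟧ * T (suc k) M + ⟦ suc k ⟧ * (⟦ k ! ⟧ * T k (suc M))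
  T-!-suc k M = trans (cong (⟦ suc k ! ⟧ *_) (T-suc k M))
    (trans (ℚ.*-distribˡ-+ ⟦ suc k ! ⟧ (T k (suc M)) (T (suc k) M))
      (trans (ℚ.+-comm (⟦ suc k ! ⟧ * T k (suc M)) (⟦ suc k ! ⟧ * T (suc k) M))
        (cong (⟦ suc k ! ⟧ * T (suc k) M +_)
          (trans (cong (_* T k (suc M)) (sym (⟦*⟧ (suc k) (k !)))) (ℚ.*-assoc ⟦ suc k ⟧ ⟦ k ! ⟧ (T k (suc M)))))))

  step : ∀ M → ⟦ suc M ⟧ - ⟦ M ⟧ ≡ 1ℚ
  step M = trans (cong (_- ⟦ M ⟧) (⟦suc⟧ M)) (lemma ⟦ M ⟧)
    where
    lemma : ∀ m → (1ℚ + m) - m ≡ 1ℚ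
    lemma = solve-∀ ring

  *step : ∀ c M p → c * (⟦ suc M ⟧ - ⟦ M ⟧) * p ≡ c * p
  *step c M p = cong (_* p) (trans (cong (c *_) (step M)) (ℚ.*-identityʳ c))

  -- `T k (suc M)` is the binomial coefficient of M + k over k, so k! times it is (M + 1) ⋯ (M + k).
  -- The powers here and in `T-upper` bound this product factor by factor. The product itself never
  -- appears: Pascal's recurrence `T-suc` is matched with the difference inequalities for powers.
  T-lower : ∀ k M → ⟦ suc M ⟧ ^ k ≤ ⟦ k ! ⟧ * T k (suc M)
  T-lower-suc : ∀ k M → ⟦ M ⟧ ^ suc k ≤ ⟦ suc k ! ⟧ * T (suc k) M

  T-lower zero    M = ℚ.≤-refl
  T-lower (suc k) M = T-lower-suc k (suc M)

  T-lower-suc k zero    = ℚ.≤-reflexive (trans (ℚ.*-zeroˡ (0ℚ ^ k)) (sym (ℚ.*-zeroʳ ⟦ suc k ! ⟧)))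
  T-lower-suc k (suc M) = ℚ.≤-trans (^-diff-upper k (0≤⟦⟧ M) (⟦⟧-mono (ℕ.n≤1+n M)))
    (subst₂ _≤_ (cong (⟦ M ⟧ ^ suc k +_) (sym (*step ⟦ suc k ⟧ M (⟦ suc M ⟧ ^ k)))) (sym (T-!-suc k M))
      (ℚ.+-mono-≤ (T-lower-suc k M) (*-monoˡ (0≤⟦⟧ (suc k)) (T-lower k M))))

  T-upper : ∀ k M → ⟦ k ! ⟧ * T k (suc M) ≤ ⟦ M ℕ.+ k ⟧ ^ k
  T-upper-suc : ∀ k M → ⟦ suc k ! ⟧ * T (suc k) M ≤ ⟦ M ℕ.+ k ⟧ ^ suc k

  T-upper zero    M = ℚ.≤-refl
  T-upper (suc k) M = subst (λ m → ⟦ suc k ! ⟧ * T (suc k) (suc M) ≤ ⟦ m ⟧ ^ suc k)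
    (sym (ℕ.+-suc M k)) (T-upper-suc k (suc M))

  T-upper-suc k zero    = subst (_≤ ⟦ k ⟧ ^ suc k) (sym (ℚ.*-zeroʳ ⟦ suc k ! ⟧)) (0≤^ (suc k) (0≤⟦⟧ k))
  T-upper-suc k (suc M) = ℚ.≤-trans
    (subst₂ _≤_ (sym (T-!-suc k M)) (cong (⟦ m ⟧ ^ suc k +_) (sym (*step ⟦ suc k ⟧ m (⟦ m ⟧ ^ k))))
      (ℚ.+-mono-≤ (T-upper-suc k M) (*-monoˡ (0≤⟦⟧ (suc k)) (T-upper k M))))
    (^-diff-lower k (0≤⟦⟧ m) (⟦⟧-mono (ℕ.n≤1+n m)))
    where m = M ℕ.+ k

  floor-≤ : ∀ n d .{{_ : ℕ.NonZero d}} → ⟦ n ℕ./ d ⟧ ≤ ⟦ n ⟧ * ι d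
  floor-≤ n d = subst (_≤ ⟦ n ⟧ * ι d)
    (trans (cong (_* ι d) (sym (⟦*⟧ (n ℕ./ d) d)))
      (trans (ℚ.*-assoc ⟦ n ℕ./ d ⟧ ⟦ d ⟧ (ι d)) (trans (cong (⟦ n ℕ./ d ⟧ *_) (ι-inverse d)) (ℚ.*-identityʳ _))))
    (*-monoʳ (0≤ι d) (⟦⟧-mono (ℕ.m/n*n≤m n d)))

  ≤*⇒*ι≤ : ∀ {n m d} .{{_ : ℕ.NonZero d}} → n ℕ.≤ m ℕ.* d → ⟦ n ⟧ * ι d ≤ ⟦ m ⟧
  ≤*⇒*ι≤ {n} {m} {d} h = subst (⟦ n ⟧ * ι d ≤_)
    (trans (cong (_* ι d) (sym (⟦*⟧ m d)))
      (trans (ℚ.*-assoc ⟦ m ⟧ ⟦ d ⟧ (ι d)) (trans (cong (⟦ m ⟧ *_) (ι-inverse d)) (ℚ.*-identityʳ _))))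
    (*-monoʳ (0≤ι d) (⟦⟧-mono h))

  module _ (j e N : ℕ) (F : Vec ℕ (suc j) → ℚ) (per : Periodic (suc j) (suc e) F) (0≤F : ∀ v → 0ℚ ≤ F v) where

    private
      k = suc j
      d = suc e
      n = N ℕ.+ k
      x = ⟦ n ⟧ * ι d
      R = Box k d F
      0≤x : 0ℚ ≤ x
      0≤x = 0≤* (0≤⟦⟧ n) (0≤ι d)
      0≤R : 0ℚ ≤ R
      0≤R = 0≤Box k d 0≤F
      E = ⟦ k ⟧ * ⟦ k ⟧ * (x + ⟦ k ⟧) ^ j * R
      x≤x+k : x ≤ x + ⟦ k ⟧
      x≤x+k = p≤p+q x (0≤⟦⟧ k)

      upper : ⟦ k ! ⟧ * Simp k N F ≤ x ^ k * R + E
      upper = ℚ.≤-trans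
        (*-monoˡ (0≤⟦⟧ (k !)) (Simp-upper k d (suc q) N F per 0≤F N≤))
        (ℚ.≤-trans (ℚ.≤-reflexive (sym (ℚ.*-assoc ⟦ k ! ⟧ (T k (suc q)) R)))
          (ℚ.≤-trans (*-monoʳ 0≤R (ℚ.≤-trans (T-upper k q)
              (ℚ.≤-trans (^-mono k (0≤⟦⟧ (q ℕ.+ k)) (subst (_≤ x + ⟦ k ⟧) (⟦+⟧ q k) (ℚ.+-monoˡ-≤ ⟦ k ⟧ (floor-≤ n d))))
                (^-diff-upper j 0≤x x≤x+k))))
            (ℚ.≤-reflexive (lemma (x ^ k) x ⟦ k ⟧ ((x + ⟦ k ⟧) ^ j) R))))
        where
        q = n ℕ./ d
        N≤ : N ℕ.≤ suc q ℕ.* d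
        N≤ = ℕ.≤-trans (ℕ.m≤m+n N k) (ℕ.≤-trans (ℕ.≤-reflexive (ℕ.m≡m%n+[m/n]*n n d))
          (ℕ.+-monoˡ-≤ (q ℕ.* d) (ℕ.<⇒≤ (ℕ.m%n<n n d))))
        lemma : ∀ X x k Y R → (X + k * ((x + k) - x) * Y) * R ≡ X * R + k * k * Y * R
        lemma = solve-∀ ring

      power-≤ : ∀ M → x ≤ ⟦ M ⟧ + ⟦ k ⟧ → x ^ k ≤ ⟦ M ⟧ ^ k + ⟦ k ⟧ * ⟦ k ⟧ * (x + ⟦ k ⟧) ^ j
      power-≤ M h with ℚ.≤-total x ⟦ M ⟧
      ... | inj₁ x≤M = ℚ.≤-trans (^-mono k 0≤x x≤M) (p≤p+q (⟦ M ⟧ ^ k)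
              (0≤* (0≤* (0≤⟦⟧ k) (0≤⟦⟧ k)) (0≤^ j (0≤+ 0≤x (0≤⟦⟧ k)))))
      ... | inj₂ M≤x = ℚ.≤-trans (^-diff-upper j (0≤⟦⟧ M) M≤x) (ℚ.+-monoʳ-≤ (⟦ M ⟧ ^ k)
              (ℚ.≤-trans (*-monoʳ (0≤^ j 0≤x) (*-monoˡ (0≤⟦⟧ k) x-M≤k))
                (*-monoˡ (0≤* (0≤⟦⟧ k) (0≤⟦⟧ k)) (^-mono j 0≤x x≤x+k))))
        where
        x-M≤k : x - ⟦ M ⟧ ≤ ⟦ k ⟧
        x-M≤k = subst (x - ⟦ M ⟧ ≤_) (lemma ⟦ M ⟧ ⟦ k ⟧) (ℚ.+-monoˡ-≤ (- ⟦ M ⟧) h)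
          where
          lemma : ∀ m k → (m + k) - m ≡ k
          lemma = solve-∀ ring

      -- Adding k to both sides of the condition in `Simp-lower` turns it into (M + k) d ≤ n + e:
      -- passing from N to n = N + k absorbs the k e lost at the far corners.
      Simp-≥ : ∀ M → M ℕ.+ k ℕ.≤ (n ℕ.+ e) ℕ./ d → T k M * R ≤ Simp k N F
      Simp-≥ M h = Simp-lower k e M N F per 0≤F (ℕ.+-cancelʳ-≤ k _ _ (begin
        M ℕ.* suc e ℕ.+ k ℕ.* e ℕ.+ k ≡⟨ lemma M e k ⟩
        (M ℕ.+ k) ℕ.* d               ≤⟨ ℕ.*-monoˡ-≤ d h ⟩
        (n ℕ.+ e) ℕ./ d ℕ.* d         ≤⟨ ℕ.m/n*n≤m (n ℕ.+ e) d ⟩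
        n ℕ.+ e                       ≡⟨ lemma′ N k e ⟩
        N ℕ.+ e ℕ.+ k                 ∎))
        where
        open ℕ.≤-Reasoning
        lemma : ∀ M e k → M ℕ.* (1 ℕ.+ e) ℕ.+ k ℕ.* e ℕ.+ k ≡ (M ℕ.+ k) ℕ.* (1 ℕ.+ e)
        lemma = ℕ-solve-∀
        lemma′ : ∀ N k e → N ℕ.+ k ℕ.+ e ≡ N ℕ.+ e ℕ.+ k
        lemma′ = ℕ-solve-∀

      x≤q : x ≤ ⟦ (n ℕ.+ e) ℕ./ d ⟧
      x≤q = ≤*⇒*ι≤ {n} {(n ℕ.+ e) ℕ./ d} {d} (ℕ.+-cancelʳ-≤ e _ _ (begin
        n ℕ.+ e                                      ≡⟨ ℕ.m≡m%n+[m/n]*n (n ℕ.+ e) d ⟩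
        (n ℕ.+ e) ℕ.% d ℕ.+ (n ℕ.+ e) ℕ./ d ℕ.* d    ≡⟨ ℕ.+-comm ((n ℕ.+ e) ℕ.% d) _ ⟩
        (n ℕ.+ e) ℕ./ d ℕ.* d ℕ.+ (n ℕ.+ e) ℕ.% d    ≤⟨ ℕ.+-monoʳ-≤ _ (ℕ.s≤s⁻¹ (ℕ.m%n<n (n ℕ.+ e) d)) ⟩
        (n ℕ.+ e) ℕ./ d ℕ.* d ℕ.+ e                  ∎))
        where open ℕ.≤-Reasoning

      lower : x ^ k * R ≤ ⟦ k ! ⟧ * Simp k N F + E
      lower = ℚ.≤-trans (*-monoʳ 0≤R (power-≤ M x≤M+k))
        (ℚ.≤-trans (ℚ.≤-reflexive (ℚ.*-distribʳ-+ R (⟦ M ⟧ ^ k) _))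
          (ℚ.+-monoˡ-≤ E (ℚ.≤-trans (*-monoʳ 0≤R (T-lower-suc j M))
            (ℚ.≤-trans (ℚ.≤-reflexive (ℚ.*-assoc ⟦ k ! ⟧ (T k M) R)) (*-monoˡ (0≤⟦⟧ (k !)) T≤)))))
        where
        -- q is n / d rounded up. For q ≤ k the truncated difference M is 0 and `T k M` vanishes, so
        -- that the lower bound becomes trivial.
        q = (n ℕ.+ e) ℕ./ d
        M = q ℕ.∸ k
        x≤M+k : x ≤ ⟦ M ⟧ + ⟦ k ⟧
        x≤M+k = ℚ.≤-trans x≤q (subst (⟦ q ⟧ ≤_) (sym (⟦+⟧ M k))
          (⟦⟧-mono (subst (q ℕ.≤_) (ℕ.+-comm k M) (ℕ.m≤n+m∸n q k))))
        T≤ : T k M * R ≤ Simp k N F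
        T≤ with ℕ.≤-total k q
        ... | inj₁ k≤q = Simp-≥ M (ℕ.≤-reflexive (ℕ.m∸n+n≡m k≤q))
        ... | inj₂ q≤k = subst (_≤ Simp k N F)
                (sym (trans (cong (λ m → T k m * R) (ℕ.m≤n⇒m∸n≡0 q≤k)) (ℚ.*-zeroˡ R))) (0≤Simp k N 0≤F)

    Simp-error : ∣ ⟦ k ! ⟧ * Simp k N F - x ^ k * R ∣ ≤ E
    Simp-error = ∣-∣≤ upper lower

-- Residue vectors modulo a prime

module Residues where

  open Rational
  open PeriodicSums
  open SimplexCounts using (step)
  open import Defs using (Σ<; 0≤*; ≤⇒0≤; *-mono)
  open import Data.Rational using (_+_; _*_; _-_; -_; _≤_)

  module Local (n : ℕ) where

    onto : ∀ {k} → ℕ → ℕ → Vec ℕ k → ℚ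
    onto q s []      = 𝟙 (s ℕ.% suc q ℕ.≟ n ℕ.% suc q)
    onto q s (z ∷ v) = onto q (s ℕ.+ suc z) v

    avoid : ℕ → ℕ → ℚ
    avoid q z = 1ℚ - 𝟙 (suc q ℕ.∣? suc z)

    avoids : ∀ {k} → ℕ → Vec ℕ k → ℚ
    avoids q []      = 1ℚ
    avoids q (z ∷ v) = avoid q z * avoids q v

    -- For y = v + 1 and p = q + 1 the indicator of
    -- "Σ y ≡ n (mod p) and p divides some y i".
    g : ∀ {k} → ℕ → Vec ℕ k → ℚ
    g q v = onto q 0 v * (1ℚ - avoids q v)

    0≤onto : ∀ {k} q s (v : Vec ℕ k) → 0ℚ ≤ onto q s v
    0≤onto q s []      = 0≤𝟙 (s ℕ.% suc q ℕ.≟ n ℕ.% suc q)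
    0≤onto q s (z ∷ v) = 0≤onto q (s ℕ.+ suc z) v

    onto≤1 : ∀ {k} q s (v : Vec ℕ k) → onto q s v ≤ 1ℚ
    onto≤1 q s []      = 𝟙≤1 (s ℕ.% suc q ℕ.≟ n ℕ.% suc q)
    onto≤1 q s (z ∷ v) = onto≤1 q (s ℕ.+ suc z) v

    1-p≤1 : ∀ {p} → 0ℚ ≤ p → 1ℚ - p ≤ 1ℚ
    1-p≤1 {p} h = ≤-by h (lemma p)
      where
      lemma : ∀ p → 1ℚ - p + p ≡ 1ℚ
      lemma = solve-∀ ring

    0≤avoid : ∀ q z → 0ℚ ≤ avoid q z
    0≤avoid q z = ≤⇒0≤ (𝟙≤1 (suc q ℕ.∣? suc z))

    avoid≤1 : ∀ q z → avoid q z ≤ 1ℚ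
    avoid≤1 q z = 1-p≤1 (0≤𝟙 (suc q ℕ.∣? suc z))

    0≤avoids : ∀ {k} q (v : Vec ℕ k) → 0ℚ ≤ avoids q v
    0≤avoids q []      = 0≤1
    0≤avoids q (z ∷ v) = 0≤* (0≤avoid q z) (0≤avoids q v)

    avoids≤1 : ∀ {k} q (v : Vec ℕ k) → avoids q v ≤ 1ℚ
    avoids≤1 q []      = ℚ.≤-refl
    avoids≤1 q (z ∷ v) = *-mono (0≤avoid q z) (avoid≤1 q z) (0≤avoids q v) (avoids≤1 q v)

    0≤g : ∀ {k} q (v : Vec ℕ k) → 0ℚ ≤ g q v
    0≤g q v = 0≤* (0≤onto q 0 v) (≤⇒0≤ (avoids≤1 q v))

    g≤1 : ∀ {k} q (v : Vec ℕ k) → g q v ≤ 1ℚ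
    g≤1 q v = *-mono (0≤onto q 0 v) (onto≤1 q 0 v) (≤⇒0≤ (avoids≤1 q v)) (1-p≤1 (0≤avoids q v))

    onto-shift : ∀ {k} q s (v : Vec ℕ k) → onto q (suc q ℕ.+ s) v ≡ onto q s v
    onto-shift q s []      = cong (λ r → 𝟙 (r ℕ.≟ n ℕ.% suc q))
      (trans (cong (ℕ._% suc q) (ℕ.+-comm (suc q) s)) (ℕ.[m+n]%n≡m%n s (suc q)))
    onto-shift q s (z ∷ v) = trans (cong (λ t → onto q t v) (ℕ.+-assoc (suc q) s (suc z))) (onto-shift q (s ℕ.+ suc z) v)

    onto-periodic : ∀ k q s → Periodic k (suc q) (onto q s)
    onto-periodic zero    q s = tt
    onto-periodic (suc k) q s = (λ v z → trans (cong (λ t → onto q t v) (lemma s (suc q) z)) (onto-shift q (s ℕ.+ suc z) v))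
      , λ z → onto-periodic k q (s ℕ.+ suc z)
      where
      lemma : ∀ s p z → s ℕ.+ (1 ℕ.+ (p ℕ.+ z)) ≡ p ℕ.+ (s ℕ.+ (1 ℕ.+ z))
      lemma = ℕ-solve-∀

    avoid-periodic : ∀ q → Per (suc q) (avoid q)
    avoid-periodic q z = cong (λ t → 1ℚ - t) (𝟙-cong (suc q ℕ.∣? suc (suc q ℕ.+ z)) (suc q ℕ.∣? suc z)
      (λ h → ℕ.∣m+n∣m⇒∣n (subst (suc q ℕ.∣_) (sym (ℕ.+-suc (suc q) z)) h) ℕ.∣-refl)
      (λ h → subst (suc q ℕ.∣_) (ℕ.+-suc (suc q) z) (ℕ.∣m∣n⇒∣m+n ℕ.∣-refl h)))

    -- stated with a function of avoids, since v ↦ 1 - avoids q v is no product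
    avoids-periodic : ∀ k q (φ : ℚ → ℚ) → Periodic k (suc q) (λ v → φ (avoids q v))
    avoids-periodic zero    q φ = tt
    avoids-periodic (suc k) q φ = (λ v z → cong (λ t → φ (t * avoids q v)) (avoid-periodic q z))
      , λ z → avoids-periodic k q (λ t → φ (avoid q z * t))

    g-periodic : ∀ k q → Periodic k (suc q) (g {k} q)
    g-periodic k q = Periodic-× k (onto-periodic k q 0) (avoids-periodic k q (λ t → 1ℚ - t))

    module _ (q : ℕ) where

      private
        p : ℕ
        p = suc q

      residue-sum : ∀ c → Σ[ z < p ] 𝟙 ((c ℕ.+ z) ℕ.% p ℕ.≟ n ℕ.% p) ≡ 1ℚ
      residue-sum c = trans (Σ-period-shift {p} {λ z → 𝟙 (z ℕ.% p ℕ.≟ n ℕ.% p)}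
          (λ z → cong (λ r → 𝟙 (r ℕ.≟ n ℕ.% p)) (trans (cong (ℕ._% p) (ℕ.+-comm p z)) (ℕ.[m+n]%n≡m%n z p))) c)
        (trans (Σ-cong p λ z z<p → trans (cong (λ r → 𝟙 (r ℕ.≟ n ℕ.% p)) (ℕ.m<n⇒m%n≡m z<p)) (sym (ℚ.*-identityʳ _)))
          (Σ-δ p (n ℕ.% p) (λ _ → 1ℚ) (ℕ.m%n<n n p)))

      -- Whatever the other coordinates are, exactly one residue of the free one makes the total
      -- congruent to n.
      onto-sum : ∀ {k} s (v : Vec ℕ k) → Σ[ z < p ] onto q (s ℕ.+ suc z) v ≡ 1ℚ
      onto-sum s []      = trans (Σ-cong p λ z _ → cong (λ t → 𝟙 (t ℕ.% p ℕ.≟ n ℕ.% p)) (ℕ.+-suc s z)) (residue-sum (suc s))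
      onto-sum s (y ∷ v) = trans (Σ-cong p λ z _ → cong (λ t → onto q t v) (lemma s z y)) (onto-sum (s ℕ.+ suc y) v)
        where
        lemma : ∀ s z y → s ℕ.+ (1 ℕ.+ z) ℕ.+ (1 ℕ.+ y) ≡ s ℕ.+ (1 ℕ.+ y) ℕ.+ (1 ℕ.+ z)
        lemma = ℕ-solve-∀

      -- Among y = 1, ..., p only the last, y = p, is divisible by p.
      avoid-sum : ∀ H → Σ[ z < p ] avoid q z * H z ≡ Σ< q H
      avoid-sum H = trans (cong₂ _+_
          (Σ-cong q λ z z<q → trans (cong (λ t → (1ℚ - t) * H z) (𝟙-no (p ℕ.∣? suc z) (λ d → ℕ.<⇒≱ (s≤s z<q) (ℕ.∣⇒≤ d))))
            (ℚ.*-identityˡ (H z)))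
          (trans (cong (λ t → (1ℚ - t) * H q) (𝟙-yes (p ℕ.∣? p) ℕ.∣-refl)) (ℚ.*-zeroˡ (H q))))
        (ℚ.+-identityʳ (Σ< q H))

      -- Both count residue vectors y modulo p with s + Σ y congruent to n: `V` all of them, `U`
      -- those without an entry divisible by p.
      V U : ℕ → ℕ → ℚ
      V k s = Box k p (onto q s)
      U k s = Box k p (λ v → onto q s v * avoids q v)

      V-suc : ∀ k s → V (suc k) s ≡ ⟦ p ⟧ ^ k
      V-suc k s = trans (sym (Box-Σ k p p (λ z v → onto q (s ℕ.+ suc z) v)))
        (trans (Box-cong k p (onto-sum s)) (trans (Box-const k p 1ℚ) (ℚ.*-identityʳ _)))

      Box-avoids : ∀ k → Box k p (avoids q) ≡ ⟦ q ⟧ ^ k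
      Box-avoids zero    = refl
      Box-avoids (suc k) = trans (Σ-cong p λ z _ → trans (Box-*ˡ k p (avoid q z) (avoids q)) (cong (avoid q z *_) (Box-avoids k)))
        (trans (avoid-sum (λ _ → ⟦ q ⟧ ^ k)) (Σ-const q (⟦ q ⟧ ^ k)))

      U-sum : ∀ k s → Σ[ z < p ] U k (s ℕ.+ suc z) ≡ ⟦ q ⟧ ^ k
      U-sum k s = trans (sym (Box-Σ k p p (λ z v → onto q (s ℕ.+ suc z) v * avoids q v)))
        (trans (Box-cong k p λ v → trans (Σ-*ʳ p (avoids q v) (λ z → onto q (s ℕ.+ suc z) v))
            (trans (cong (_* avoids q v) (onto-sum s v)) (ℚ.*-identityˡ _)))
          (Box-avoids k))

      -- The two terms are the contributions of y = 1, ..., p - 1 and of y = p for one extra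
      -- coordinate. Together they leave that coordinate free, and it is then determined by the k
      -- others, each of which has q values.
      U-suc : ∀ k s → U (suc k) s + U k s ≡ ⟦ q ⟧ ^ k
      U-suc k s = trans (cong₂ _+_
          (trans (Σ-cong p λ z _ → trans
              (Box-cong k p λ v → lemma (onto q (s ℕ.+ suc z) v) (avoid q z) (avoids q v))
              (Box-*ˡ k p (avoid q z) (λ v → onto q (s ℕ.+ suc z) v * avoids q v)))
            (avoid-sum (λ z → U k (s ℕ.+ suc z))))
          (Box-cong k p λ v → cong (_* avoids q v)
            (trans (sym (onto-shift q s v)) (cong (λ t → onto q t v) (ℕ.+-comm p s)))))
        (U-sum k s)
        where
        lemma : ∀ a b c → a * (b * c) ≡ b * (a * c)
        lemma = solve-∀ ring

      U≤V : ∀ k s → U k s ≤ V k s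
      U≤V k s = Box-mono k p λ v → subst (onto q s v * avoids q v ≤_) (ℚ.*-identityʳ _) (*-monoˡ (0≤onto q s v) (avoids≤1 q v))

      -- Solution of the first-order recurrence `U-suc`; the alternating sign and the dependence on
      -- s stem from the initial value, the indicator of s ≡ n.
      U-closed : ∀ k s → ⟦ p ⟧ * U k s ≡ ⟦ q ⟧ ^ k + (- 1ℚ) ^ k * (⟦ p ⟧ * 𝟙 (s ℕ.% p ℕ.≟ n ℕ.% p) - 1ℚ)
      U-closed zero    s = lemma ⟦ p ⟧ (𝟙 (s ℕ.% p ℕ.≟ n ℕ.% p))
        where
        lemma : ∀ p d → p * (d * 1ℚ) ≡ 1ℚ + 1ℚ * (p * d - 1ℚ)
        lemma = solve-∀ ring
      U-closed (suc k) s = trans (lemma₁ ⟦ p ⟧ (U (suc k) s) (U k s))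
        (trans (cong₂ (λ a b → ⟦ p ⟧ * a - b) (U-suc k s) (U-closed k s))
          (trans (cong (λ a → a * ⟦ q ⟧ ^ k - (⟦ q ⟧ ^ k + (- 1ℚ) ^ k * (⟦ p ⟧ * δ - 1ℚ))) (⟦suc⟧ q))
            (lemma₂ ⟦ q ⟧ (⟦ q ⟧ ^ k) ((- 1ℚ) ^ k) (⟦ p ⟧ * δ - 1ℚ))))
        where
        δ = 𝟙 (s ℕ.% p ℕ.≟ n ℕ.% p)
        lemma₁ : ∀ p a b → p * a ≡ p * (a + b) - p * b
        lemma₁ = solve-∀ ring
        lemma₂ : ∀ q Q e D → (1ℚ + q) * Q - (Q + e * D) ≡ q * Q + (- 1ℚ) * e * D
        lemma₂ = solve-∀ ring

      ρ : ℕ → ℚ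
      ρ k = Box k p (g q)

      ρ+U : ∀ k → ρ k + U k 0 ≡ V k 0
      ρ+U k = trans (sym (Box-+ k p (g q) (λ v → onto q 0 v * avoids q v))) (Box-cong k p λ v → lemma (onto q 0 v) (avoids q v))
        where
        lemma : ∀ a b → a * (1ℚ - b) + a * b ≡ a
        lemma = solve-∀ ring

      -- For k = i + 2, `U-suc` gives ρ k = p^(k-1) - q^(k-1) + U (k-1). The difference of powers is
      -- at most (k - 1) p^(k-2), and U (k-1) ≤ V (k-1) = p^(k-2); the last equality needs k ≥ 2.
      ρ-bound : ∀ i → ρ (suc (suc i)) ≤ ⟦ suc (suc i) ⟧ * ⟦ p ⟧ ^ i
      ρ-bound i = ℚ.≤-trans (ℚ.≤-reflexive eq) (ℚ.≤-trans (ℚ.+-mono-≤ diff u)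
        (ℚ.≤-reflexive (trans (lemma ⟦ suc i ⟧ (⟦ p ⟧ ^ i)) (cong (_* ⟦ p ⟧ ^ i) (sym (⟦suc⟧ (suc i)))))))
        where
        P = ⟦ p ⟧ ^ suc i
        Q = ⟦ q ⟧ ^ suc i
        u : U (suc i) 0 ≤ ⟦ p ⟧ ^ i
        u = subst (U (suc i) 0 ≤_) (V-suc i 0) (U≤V (suc i) 0)
        eq : ρ (suc (suc i)) ≡ (P - Q) + U (suc i) 0
        eq = trans (lemma₁ (ρ (suc (suc i))) (U (suc (suc i)) 0) (U (suc i) 0))
          (trans (cong₂ (λ a b → a - b + U (suc i) 0) (trans (ρ+U (suc (suc i))) (V-suc (suc i) 0)) (U-suc (suc i) 0)) refl)
          where
          lemma₁ : ∀ r a b → r ≡ (r + a) - (a + b) + b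
          lemma₁ = solve-∀ ring
        diff : P - Q ≤ ⟦ suc i ⟧ * ⟦ p ⟧ ^ i
        diff = subst (P - Q ≤_)
          (trans (lemma₂ Q _) (cong (_* ⟦ p ⟧ ^ i) (trans (cong (⟦ suc i ⟧ *_) (step q)) (ℚ.*-identityʳ ⟦ suc i ⟧))))
          (ℚ.+-monoˡ-≤ (- Q) (^-diff-upper i (0≤⟦⟧ q) (⟦⟧-mono (ℕ.n≤1+n q))))
          where
          lemma₂ : ∀ Q x → (Q + x) - Q ≡ x
          lemma₂ = solve-∀ ring
        lemma : ∀ c P → c * P + P ≡ (1ℚ + c) * P
        lemma = solve-∀ ring

      ρ-closed : ∀ j → let k = suc j in
        ⟦ p ⟧ * ρ k ≡ ⟦ p ⟧ ^ k - ⟦ q ⟧ ^ k + (- 1ℚ) ^ k - (- 1ℚ) ^ k * (⟦ p ⟧ * 𝟙 (0 ℕ.% p ℕ.≟ n ℕ.% p))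
      ρ-closed j = trans (lemma₁ ⟦ p ⟧ (ρ (suc j)) (U (suc j) 0))
        (trans (cong₂ (λ a b → ⟦ p ⟧ * a - b) (trans (ρ+U (suc j)) (V-suc j 0)) (U-closed (suc j) 0))
          (lemma₂ (⟦ p ⟧ ^ suc j) (⟦ q ⟧ ^ suc j) ((- 1ℚ) ^ suc j) _))
        where
        lemma₁ : ∀ p a b → p * a ≡ p * (a + b) - p * b
        lemma₁ = solve-∀ ring
        lemma₂ : ∀ P Q e D → P - (Q + e * (D - 1ℚ)) ≡ P - Q + e - e * D
        lemma₂ = solve-∀ ring

-- Weighted sums over products of distinct primes

module PrimeWeights where

  open Rational
  open SimplexCounts using (floor-≤; ≤*⇒*ι≤)
  open import Defs using (Σ<; 0≤*; 0≤+)
  open import Data.Nat.Divisibility using (_∣_; divides)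
  open import Data.Rational using (_+_; _*_; _≤_; _⊓_)

  -- The sum of c ^ (number of primes of s) φ (s d) over the products s of
  -- distinct primes below j.
  W : ℚ → ℕ → (ℕ → ℚ) → ℕ → ℚ
  W c zero    φ d = φ d
  W c (suc j) φ d = W c j φ d + 𝟙 (prime? j) * (c * W c j φ (j ℕ.* d))

  module _ {c : ℚ} (0≤c : 0ℚ ≤ c) where

    W-mono : ∀ j {φ χ : ℕ → ℚ} → (∀ d → φ d ≤ χ d) → ∀ d → W c j φ d ≤ W c j χ d
    W-mono zero    h d = h d
    W-mono (suc j) h d = ℚ.+-mono-≤ (W-mono j h d)
      (*-monoˡ (0≤𝟙 (prime? j)) (*-monoˡ 0≤c (W-mono j h (j ℕ.* d))))

    0≤W : ∀ j {φ : ℕ → ℚ} → (∀ d → 0ℚ ≤ φ d) → ∀ d → 0ℚ ≤ W c j φ d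
    0≤W zero    h d = h d
    0≤W (suc j) h d = 0≤+ (0≤W j h d) (0≤* (0≤𝟙 (prime? j)) (0≤* 0≤c (0≤W j h (j ℕ.* d))))

  W-+φ : ∀ c j (φ χ : ℕ → ℚ) d → W c j (λ d → φ d + χ d) d ≡ W c j φ d + W c j χ d
  W-+φ c zero    φ χ d = refl
  W-+φ c (suc j) φ χ d = trans (cong₂ (λ x y → x + 𝟙 (prime? j) * (c * y)) (W-+φ c j φ χ d) (W-+φ c j φ χ (j ℕ.* d)))
    (lemma (W c j φ d) (W c j χ d) (𝟙 (prime? j)) c (W c j φ (j ℕ.* d)) (W c j χ (j ℕ.* d)))
    where
    lemma : ∀ a b i c x y → a + b + i * (c * (x + y)) ≡ (a + i * (c * x)) + (b + i * (c * y))
    lemma = solve-∀ ring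

  W-*φ : ∀ c j b (φ : ℕ → ℚ) d → W c j (λ d → b * φ d) d ≡ b * W c j φ d
  W-*φ c zero    b φ d = refl
  W-*φ c (suc j) b φ d = trans (cong₂ (λ x y → x + 𝟙 (prime? j) * (c * y)) (W-*φ c j b φ d) (W-*φ c j b φ (j ℕ.* d)))
    (lemma b (W c j φ d) (𝟙 (prime? j)) c (W c j φ (j ℕ.* d)))
    where
    lemma : ∀ b a i c x → b * a + i * (c * (b * x)) ≡ b * (a + i * (c * x))
    lemma = solve-∀ ring

  W-dilate : ∀ c j m (φ : ℕ → ℚ) d → W c j (λ d → φ (m ℕ.* d)) d ≡ W c j φ (m ℕ.* d)
  W-dilate c zero    m φ d = refl
  W-dilate c (suc j) m φ d = cong₂ (λ x y → x + 𝟙 (prime? j) * (c * y)) (W-dilate c j m φ d)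
    (trans (W-dilate c j m φ (j ℕ.* d)) (cong (W c j φ) (lemma m j d)))
    where
    lemma : ∀ m j d → m ℕ.* (j ℕ.* d) ≡ j ℕ.* (m ℕ.* d)
    lemma = ℕ-solve-∀

  -- A set of primes with a two-colouring is a pair of disjoint sets of primes.
  W-+ : ∀ {a b} → 0ℚ ≤ a → 0ℚ ≤ b → ∀ j {φ : ℕ → ℚ} → (∀ d → 0ℚ ≤ φ d) → ∀ d →
        W (a + b) j φ d ≤ W a j (W b j φ) d
  W-+ 0≤a 0≤b zero    0≤φ d = ℚ.≤-refl
  W-+ {a} {b} 0≤a 0≤b (suc j) {φ} 0≤φ d = ℚ.≤-trans
    (ℚ.+-mono-≤ (W-+ 0≤a 0≤b j 0≤φ d) (*-monoˡ 0≤i (*-monoˡ (0≤+ 0≤a 0≤b) (W-+ 0≤a 0≤b j 0≤φ jd))))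
    (ℚ.≤-trans (ℚ.≤-reflexive (lemma (W a j ψ d) (W a j ψ jd) i a b))
      (ℚ.+-mono-≤ (ℚ.≤-reflexive (sym (trans (W-+φ a j ψ (λ d → i * (b * ψ (j ℕ.* d))) d)
          (cong (W a j ψ d +_) (trans (W-*φ a j i (λ d → b * ψ (j ℕ.* d)) d)
            (cong (i *_) (trans (W-*φ a j b (λ d → ψ (j ℕ.* d)) d) (cong (b *_) (W-dilate a j j ψ d)))))))))
        (*-monoˡ 0≤i (*-monoˡ 0≤a (W-mono 0≤a j ψ≤ jd)))))
    where
    i = 𝟙 (prime? j)
    0≤i = 0≤𝟙 (prime? j)
    jd = j ℕ.* d
    ψ = W b j φ
    ψ≤ : ∀ d → ψ d ≤ W b (suc j) φ d
    ψ≤ d = p≤p+q (ψ d) (0≤* 0≤i (0≤* 0≤b (0≤W 0≤b j 0≤φ (j ℕ.* d))))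
    lemma : ∀ x y i a b → x + i * ((a + b) * y) ≡ (x + i * (b * y)) + i * (a * y)
    lemma = solve-∀ ring

  W-zero : ∀ j (φ : ℕ → ℚ) d → W 0ℚ j φ d ≡ φ d
  W-zero zero    φ d = refl
  W-zero (suc j) φ d = trans (cong (W 0ℚ j φ d +_)
      (trans (cong (𝟙 (prime? j) *_) (ℚ.*-zeroˡ (W 0ℚ j φ (j ℕ.* d)))) (ℚ.*-zeroʳ (𝟙 (prime? j)))))
    (trans (ℚ.+-identityʳ _) (W-zero j φ d))

  -- By `W-+` the weight k = 1 + ⋯ + 1 is dominated by k successive applications of `W 1ℚ`, and each
  -- of them costs φ a factor B.
  W-power : ∀ {B} j {φ : ℕ → ℚ} → 0ℚ ≤ B → (∀ d → 0ℚ ≤ φ d) → (∀ d → W 1ℚ j φ d ≤ B * φ d) →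
    ∀ k d → W ⟦ k ⟧ j φ d ≤ B ^ k * φ d
  W-power     j {φ} 0≤B 0≤φ h zero    d = ℚ.≤-reflexive (trans (W-zero j φ d) (sym (ℚ.*-identityˡ (φ d))))
  W-power {B} j {φ} 0≤B 0≤φ h (suc k) d = ℚ.≤-trans
    (ℚ.≤-reflexive (cong (λ c → W c j φ d) (⟦suc⟧ k)))
    (ℚ.≤-trans (W-+ 0≤1 (0≤⟦⟧ k) j 0≤φ d)
      (ℚ.≤-trans (W-mono 0≤1 j (W-power j 0≤B 0≤φ h k) d)
        (ℚ.≤-trans (ℚ.≤-reflexive (W-*φ 1ℚ j (B ^ k) φ d))
          (ℚ.≤-trans (*-monoˡ (0≤^ k 0≤B) (h d)) (ℚ.≤-reflexive (lemma (B ^ k) B (φ d)))))))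
    where
    lemma : ∀ P B x → P * (B * x) ≡ B * P * x
    lemma = solve-∀ ring

  quotient-indicator : (ℕ → ℚ) → ∀ {p e} → Dec (p ∣ e) → ℚ
  quotient-indicator χ (yes (divides c _)) = χ c
  quotient-indicator χ (no _)              = 0ℚ

  -- χ is the indicator of the products of distinct primes below j; unique
  -- factorisation is the inequality χ ≤ 1.
  record Squarefree (j : ℕ) : Set where
    field
      L     : ℕ
      χ     : ℕ → ℚ
      0≤χ   : ∀ e → 0ℚ ≤ χ e
      χ≤1   : ∀ e → χ e ≤ 1ℚ
      χ-∣   : ∀ {p e} → Prime p → j ℕ.≤ p → p ∣ e → χ e ≡ 0ℚ
      W≤    : ∀ {φ : ℕ → ℚ} → (∀ d → 0ℚ ≤ φ d) → ∀ d → W 1ℚ j φ d ≤ Σ[ e < L ] χ e * φ (e ℕ.* d)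

  -- At a prime j the new products are j c with c built from smaller primes. By `χ-∣` the old χ
  -- vanishes on multiples of j, so the two summands of `χ′` are never both nonzero and `χ≤1`
  -- survives. Euclid's lemma carries `χ-∣` over to the products j c.
  squarefree : ∀ j → Squarefree j
  squarefree zero = record
    { L   = 2
    ; χ   = λ e → 𝟙 (e ℕ.≟ 1)
    ; 0≤χ = λ e → 0≤𝟙 (e ℕ.≟ 1)
    ; χ≤1 = λ e → 𝟙≤1 (e ℕ.≟ 1)
    ; χ-∣ = λ {p} {e} pr _ p∣e → 𝟙-no (e ℕ.≟ 1) λ { refl →
        contradiction (ℕ.∣1⇒≡1 p∣e) (ℕ.nonTrivial⇒≢1 {{prime⇒nonTrivial pr}}) }
    ; W≤  = λ {φ} 0≤φ d → ℚ.≤-reflexive (trans (cong φ (sym (ℕ.*-identityˡ d))) (lemma (φ 0) (φ (1 ℕ.* d))))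
    }
    where
    lemma : ∀ a b → b ≡ 0ℚ + 0ℚ * a + 1ℚ * b
    lemma = solve-∀ ring
  squarefree (suc j) with squarefree j | prime? j in eq
  ... | S | no ¬pr = record
    { L   = L
    ; χ   = χ
    ; 0≤χ = 0≤χ
    ; χ≤1 = χ≤1
    ; χ-∣ = λ pr 1+j≤p → χ-∣ pr (ℕ.<⇒≤ 1+j≤p)
    ; W≤  = λ {φ} 0≤φ d → ℚ.≤-trans (ℚ.≤-reflexive (lemma φ d)) (W≤ 0≤φ d)
    }
    where
    open Squarefree S
    lemma : ∀ φ d → W 1ℚ j φ d + 𝟙 (prime? j) * (1ℚ * W 1ℚ j φ (j ℕ.* d)) ≡ W 1ℚ j φ d
    lemma φ d = trans (cong (λ i → W 1ℚ j φ d + i * (1ℚ * W 1ℚ j φ (j ℕ.* d))) (cong 𝟙 eq))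
      (trans (cong (W 1ℚ j φ d +_) (ℚ.*-zeroˡ (1ℚ * W 1ℚ j φ (j ℕ.* d)))) (ℚ.+-identityʳ _))
  ... | S | yes pr = record
    { L   = L ℕ.* j
    ; χ   = χ′
    ; 0≤χ = λ e → 0≤+ (0≤χ e) (0≤quotient (j ℕ.∣? e))
    ; χ≤1 = λ e → χ′≤1 e (j ℕ.∣? e)
    ; χ-∣ = λ {p} {e} pr′ j<p p∣e → trans (cong₂ _+_ (χ-∣ pr′ (ℕ.<⇒≤ j<p) p∣e) (quotient-∣ pr′ j<p p∣e (j ℕ.∣? e))) refl
    ; W≤  = W≤′
    }
    where
    open Squarefree S
    instance
      _ = prime⇒nonZero pr
    χ′ : ℕ → ℚ
    χ′ e = χ e + quotient-indicator χ (j ℕ.∣? e)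
    0≤quotient : ∀ {e} (d : Dec (j ∣ e)) → 0ℚ ≤ quotient-indicator χ d
    0≤quotient (yes (divides c _)) = 0≤χ c
    0≤quotient (no _)              = ℚ.≤-refl
    χ′≤1 : ∀ e (d : Dec (j ∣ e)) → χ e + quotient-indicator χ d ≤ 1ℚ
    χ′≤1 e (yes j∣e@(divides c _)) = subst (λ z → z + χ c ≤ 1ℚ) (sym (χ-∣ pr ℕ.≤-refl j∣e))
      (subst (_≤ 1ℚ) (sym (ℚ.+-identityˡ (χ c))) (χ≤1 c))
    χ′≤1 e (no _) = subst (_≤ 1ℚ) (sym (ℚ.+-identityʳ (χ e))) (χ≤1 e)
    quotient-∣ : ∀ {p e} → Prime p → j ℕ.< p → p ∣ e → (d : Dec (j ∣ e)) → quotient-indicator χ d ≡ 0ℚ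
    quotient-∣ pr′ j<p p∣e (no _) = refl
    quotient-∣ {p} pr′ j<p p∣e (yes (divides c refl)) with euclidsLemma c j pr′ p∣e
    ... | inj₁ p∣c = χ-∣ pr′ (ℕ.<⇒≤ j<p) p∣c
    ... | inj₂ p∣j = contradiction (ℕ.∣⇒≤ p∣j) (ℕ.<⇒≱ j<p)
    quotient-at : ∀ w (d : Dec (j ∣ w ℕ.* j)) → quotient-indicator χ d ≡ χ w
    quotient-at w (yes (divides c e)) = cong χ (ℕ.*-cancelʳ-≡ c w j (sym e))
    quotient-at w (no ∤) = contradiction (ℕ.n∣m*n w) ∤
    head : ∀ m .{{_ : ℕ.NonZero m}} (F : ℕ → ℚ) → (∀ i → 0ℚ ≤ F i) → F 0 ≤ Σ< m F
    head (suc m) F h = ℚ.≤-trans (p≤p+q (F 0) (0≤Σ m λ i _ → h (suc i))) (ℚ.≤-reflexive (sym (Σ-head m F)))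
    W≤′ : ∀ {φ : ℕ → ℚ} → (∀ d → 0ℚ ≤ φ d) → ∀ d → W 1ℚ (suc j) φ d ≤ Σ[ e < L ℕ.* j ] χ′ e * φ (e ℕ.* d)
    W≤′ {φ} 0≤φ d = ℚ.≤-trans
      (ℚ.+-mono-≤
        (ℚ.≤-trans (W≤ 0≤φ d)
          (Σ-extend (λ e → χ e * φ (e ℕ.* d)) (ℕ.m≤m*n L j) λ e → 0≤* (0≤χ e) (0≤φ (e ℕ.* d))))
        (ℚ.≤-trans (ℚ.≤-reflexive (trans (cong (_* (1ℚ * W 1ℚ j φ (j ℕ.* d))) (cong 𝟙 eq))
            (trans (ℚ.*-identityˡ _) (ℚ.*-identityˡ _))))
          (ℚ.≤-trans (W≤ 0≤φ (j ℕ.* d))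
            -- The index w j heads the w-th block of length j in the sum over `L ℕ.* j`; the rest of
            -- the block is nonnegative and may be added.
            (ℚ.≤-trans (Σ-mono L λ w _ → ℚ.≤-trans
                (ℚ.≤-reflexive (sym (trans (cong F (ℕ.+-identityʳ (w ℕ.* j)))
                  (cong₂ _*_ (quotient-at w (j ℕ.∣? w ℕ.* j)) (cong φ (ℕ.*-assoc w j d))))))
                (head j (λ r → F (w ℕ.* j ℕ.+ r)) λ r → 0≤F (w ℕ.* j ℕ.+ r)))
              (ℚ.≤-reflexive (sym (Σ-blocks L j F)))))))
      (ℚ.≤-reflexive (trans (sym (Σ-+ (L ℕ.* j) (λ e → χ e * φ (e ℕ.* d)) F))
        (Σ-cong (L ℕ.* j) λ e _ → sym (ℚ.*-distribʳ-+ (φ (e ℕ.* d)) (χ e) _))))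
      where
      F : ℕ → ℚ
      F e = quotient-indicator χ (j ℕ.∣? e) * φ (e ℕ.* d)
      0≤F : ∀ e → 0ℚ ≤ F e
      0≤F e = 0≤* (0≤quotient (j ℕ.∣? e)) (0≤φ (e ℕ.* d))

  W₁-≤ : ∀ j → ∃[ L ] (∀ {φ : ℕ → ℚ} → (∀ d → 0ℚ ≤ φ d) → ∀ d → W 1ℚ j φ d ≤ Σ[ e < L ] φ (e ℕ.* d))
  W₁-≤ j = L , λ {φ} 0≤φ d → ℚ.≤-trans (W≤ 0≤φ d) (Σ-mono L λ e _ →
    subst (χ e * φ (e ℕ.* d) ≤_) (ℚ.*-identityˡ _) (*-monoʳ (0≤φ (e ℕ.* d)) (χ≤1 e)))
    where open Squarefree (squarefree j)

  ι-telescope : ∀ m .{{_ : ℕ.NonZero m}} → ι (suc m) * ι (suc m) + ι (suc m) ≤ ι m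
  ι-telescope m = subst (ι (suc m) * ι (suc m) + ι (suc m) ≤_) (sym eq)
    (ℚ.+-monoˡ-≤ (ι (suc m)) (*-monoʳ (0≤ι (suc m)) (ι-antimono (ℕ.n≤1+n m))))
    where
    lemma : ∀ a b m → a * ((1ℚ + m) * b) ≡ a * b + (m * a) * b
    lemma = solve-∀ ring
    eq : ι m ≡ ι m * ι (suc m) + ι (suc m)
    eq = trans (sym (ℚ.*-identityʳ (ι m)))
      (trans (cong (ι m *_) (sym (trans (cong (_* ι (suc m)) (sym (⟦suc⟧ m))) (ι-inverse (suc m)))))
        (trans (lemma (ι m) (ι (suc m)) ⟦ m ⟧)
          (cong (ι m * ι (suc m) +_) (trans (cong (_* ι (suc m)) (ι-inverse m)) (ℚ.*-identityˡ _)))))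

  Σ-squares : ∀ q .{{_ : ℕ.NonZero q}} L → (Σ[ i < L ] ι (suc q ℕ.+ i) * ι (suc q ℕ.+ i)) + ι (q ℕ.+ L) ≤ ι q
  Σ-squares q zero    = ℚ.≤-reflexive (trans (ℚ.+-identityˡ _) (cong ι (ℕ.+-identityʳ q)))
  Σ-squares q (suc L) = ℚ.≤-trans
    (ℚ.≤-reflexive (trans (ℚ.+-assoc S (x * x) (ι (q ℕ.+ suc L)))
      (cong (λ y → S + (x * x + y)) (cong ι (ℕ.+-suc q L)))))
    (ℚ.≤-trans (ℚ.+-monoʳ-≤ S (ι-telescope (q ℕ.+ L) {{ℕ.>-nonZero (ℕ.≤-trans (ℕ.>-nonZero⁻¹ q) (ℕ.m≤m+n q L))}})) (Σ-squares q L))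
    where
    x = ι (suc q ℕ.+ L)
    S = Σ[ i < L ] ι (suc q ℕ.+ i) * ι (suc q ℕ.+ i)

  Σ-squares-tail : ∀ q .{{_ : ℕ.NonZero q}} L → Σ[ i < L ] ι (suc q ℕ.+ i) * ι (suc q ℕ.+ i) ≤ ι q
  Σ-squares-tail q L = ℚ.≤-trans (p≤p+q _ (0≤ι (q ℕ.+ L))) (Σ-squares q L)

  module Weight (n : ℕ) where

    -- The shape of the error at level d: 1 / d up to n and n / d² beyond. The faster decay bounds
    -- the sum of φ (e d) over all e, independently of how many primes are sieved. As `ι 0` is 0, so
    -- is φ 0.
    φ : ℕ → ℚ
    φ d = ι d * (1ℚ ⊓ (⟦ n ⟧ * ι d))

    0≤⊓ : ∀ {p} → 0ℚ ≤ p → 0ℚ ≤ 1ℚ ⊓ p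
    0≤⊓ h = ℚ.⊓-glb 0≤1 h

    0≤φ : ∀ d → 0ℚ ≤ φ d
    0≤φ d = 0≤* (0≤ι d) (0≤⊓ (0≤* (0≤⟦⟧ n) (0≤ι d)))

    H : ℚ
    H = Σ[ i < n ] ι (suc i)

    0≤H : 0ℚ ≤ H
    0≤H = 0≤Σ n λ i _ → 0≤ι (suc i)

    B : ℚ
    B = H + ⟦ 2 ⟧

    0≤B : 0ℚ ≤ B
    0≤B = 0≤+ 0≤H (0≤⟦⟧ 2)

    φ-small : ∀ e d → φ (e ℕ.* d) ≤ ι d * ι e
    φ-small e d = ℚ.≤-trans (*-monoˡ (0≤ι (e ℕ.* d)) (ℚ.p⊓q≤p 1ℚ (⟦ n ⟧ * ι (e ℕ.* d))))
      (ℚ.≤-reflexive (trans (ℚ.*-identityʳ _) (trans (ι-* e d) (ℚ.*-comm (ι e) (ι d)))))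

    φ-large : ∀ e d → φ (e ℕ.* d) ≤ ι d * (⟦ n ⟧ * ι d) * (ι e * ι e)
    φ-large e d = ℚ.≤-trans (*-monoˡ (0≤ι (e ℕ.* d)) (ℚ.p⊓q≤q 1ℚ (⟦ n ⟧ * ι (e ℕ.* d))))
      (ℚ.≤-reflexive (trans (cong (λ z → z * (⟦ n ⟧ * z)) (ι-* e d)) (lemma (ι e) (ι d) ⟦ n ⟧)))
      where
      lemma : ∀ a b n → a * b * (n * (a * b)) ≡ b * (n * b) * (a * a)
      lemma = solve-∀ ring

    -- For d ≥ n the terms are at most φ d / e², and Σ 1 / e² ≤ 2. For d ≤ n cut at q = ⌊n / d⌋: the
    -- terms with e ≤ q give at most H / d, those beyond at most (n / d²) / q ≤ 2 / d, because n ≤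
    -- (q + 1) d ≤ 2 q d. Hence B = H + 2.
    Σφ-≤ : ∀ L d → Σ[ e < L ] φ (e ℕ.* d) ≤ B * φ d
    Σφ-≤ L zero = ℚ.≤-reflexive (trans
      (trans (Σ-cong L λ e _ → trans (cong φ (ℕ.*-zeroʳ e)) (ℚ.*-zeroˡ (1ℚ ⊓ (⟦ n ⟧ * ι 0)))) (Σ-zero L))
      (sym (trans (cong (B *_) (ℚ.*-zeroˡ (1ℚ ⊓ (⟦ n ⟧ * ι 0)))) (ℚ.*-zeroʳ B))))
    Σφ-≤ L d@(suc _) with ℕ.≤-total n d
    ... | inj₁ n≤d = ℚ.≤-trans (Σ-extend (λ e → φ (e ℕ.* d)) (ℕ.m≤n+m L 2) λ e → 0≤φ (e ℕ.* d))
      (ℚ.≤-trans (Σ-mono (2 ℕ.+ L) λ e _ → φ-large e d)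
        (ℚ.≤-trans (ℚ.≤-reflexive (Σ-*ˡ (2 ℕ.+ L) (ι d * x) (λ e → ι e * ι e)))
          (ℚ.≤-trans (*-monoˡ (0≤* (0≤ι d) 0≤x) squares)
            (ℚ.≤-reflexive (trans (ℚ.*-comm (ι d * x) B) (cong (λ z → B * (ι d * z)) (sym (ℚ.p≥q⇒p⊓q≡q x≤1))))))))
      where
      x = ⟦ n ⟧ * ι d
      0≤x = 0≤* (0≤⟦⟧ n) (0≤ι d)
      x≤1 : x ≤ 1ℚ
      x≤1 = ≤*⇒*ι≤ {n} {1} {d} (subst (n ℕ.≤_) (sym (ℕ.*-identityˡ d)) n≤d)
      squares : Σ[ e < 2 ℕ.+ L ] ι e * ι e ≤ B
      squares = ℚ.≤-trans (ℚ.≤-reflexive (Σ-split 2 L (λ e → ι e * ι e)))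
        (ℚ.≤-trans (ℚ.+-monoʳ-≤ 1ℚ (Σ-squares-tail 1 L)) (≤-by 0≤H (ℚ.+-comm ⟦ 2 ⟧ H)))
    ... | inj₂ d≤n = ℚ.≤-trans (Σ-extend (λ e → φ (e ℕ.* d)) (ℕ.m≤n+m L (suc q)) λ e → 0≤φ (e ℕ.* d))
      (ℚ.≤-trans (ℚ.≤-reflexive (Σ-split (suc q) L (λ e → φ (e ℕ.* d))))
        (ℚ.≤-trans (ℚ.+-mono-≤ head tail)
          (ℚ.≤-reflexive (trans (lemma H ⟦ 2 ⟧ (ι d)) (cong (λ z → B * (ι d * z)) (sym (ℚ.p≤q⇒p⊓q≡p 1≤x)))))))
      where
      x = ⟦ n ⟧ * ι d
      0≤x = 0≤* (0≤⟦⟧ n) (0≤ι d)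
      q = n ℕ./ d
      instance
        q≢0 : ℕ.NonZero q
        q≢0 = ℕ.>-nonZero (ℕ.m≥n⇒m/n>0 d≤n)
      1≤x : 1ℚ ≤ x
      1≤x = ℚ.≤-trans (1≤⟦⟧ q) (floor-≤ n d)
      lemma : ∀ H t i → i * H + i * t ≡ (H + t) * (i * 1ℚ)
      lemma = solve-∀ ring
      head : Σ[ e < suc q ] φ (e ℕ.* d) ≤ ι d * H
      head = ℚ.≤-trans (Σ-mono (suc q) λ e _ → φ-small e d)
        (ℚ.≤-trans (ℚ.≤-reflexive (trans (Σ-*ˡ (suc q) (ι d) ι) (cong (ι d *_) (trans (Σ-head q ι) (ℚ.+-identityˡ _)))))
          (*-monoˡ (0≤ι d) (Σ-extend (λ i → ι (suc i)) (ℕ.m/n≤m n d) λ i → 0≤ι (suc i))))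
      xι≤2 : x * ι q ≤ ⟦ 2 ⟧
      xι≤2 = ℚ.≤-trans
        (*-monoʳ (0≤ι q) (≤*⇒*ι≤ {n} {2 ℕ.* q} {d} (begin
          n                        ≡⟨ ℕ.m≡m%n+[m/n]*n n d ⟩
          n ℕ.% d ℕ.+ q ℕ.* d      ≤⟨ ℕ.+-monoˡ-≤ (q ℕ.* d) (ℕ.≤-trans (ℕ.<⇒≤ (ℕ.m%n<n n d)) (ℕ.m≤n*m d q)) ⟩
          q ℕ.* d ℕ.+ q ℕ.* d      ≡⟨ twice q d ⟩
          2 ℕ.* q ℕ.* d            ∎)))
        (ℚ.≤-reflexive (trans (cong (_* ι q) (sym (⟦*⟧ 2 q))) (trans (ℚ.*-assoc ⟦ 2 ⟧ ⟦ q ⟧ (ι q))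
          (trans (cong (⟦ 2 ⟧ *_) (ι-inverse q)) (ℚ.*-identityʳ ⟦ 2 ⟧)))))
        where
        open ℕ.≤-Reasoning
        twice : ∀ q d → q ℕ.* d ℕ.+ q ℕ.* d ≡ 2 ℕ.* q ℕ.* d
        twice = ℕ-solve-∀
      tail : Σ[ i < L ] φ ((suc q ℕ.+ i) ℕ.* d) ≤ ι d * ⟦ 2 ⟧
      tail = ℚ.≤-trans (Σ-mono L λ i _ → φ-large (suc q ℕ.+ i) d)
        (ℚ.≤-trans (ℚ.≤-reflexive (Σ-*ˡ L (ι d * x) (λ i → ι (suc q ℕ.+ i) * ι (suc q ℕ.+ i))))
          (ℚ.≤-trans (*-monoˡ (0≤* (0≤ι d) 0≤x) (Σ-squares-tail q L))
            (ℚ.≤-trans (ℚ.≤-reflexive (ℚ.*-assoc (ι d) x (ι q))) (*-monoˡ (0≤ι d) xι≤2))))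

    Wφ-≤ : ∀ k j d → W ⟦ k ⟧ j φ d ≤ B ^ k * φ d
    Wφ-≤ k j d = W-power j 0≤B 0≤φ (λ d → ℚ.≤-trans (proj₂ (W₁-≤ j) 0≤φ d) (Σφ-≤ (proj₁ (W₁-≤ j)) d)) k d

-- Inclusion-exclusion over the primes

module PrimeSieve where

  open Rational
  open PeriodicSums
  open Residues
  open PrimeWeights using (W)
  open import Defs using (∏<; 0≤*; *-mono)
  open import Data.Nat.Coprimality as Coprime using (Coprime)
  open import Data.Nat.Divisibility using (_∣_; _∤_; divides)
  open import Data.Rational using (_+_; _*_; _-_; _≤_; ∣_∣)

  prime-coprime : ∀ {p d} → Prime p → p ∤ d → Coprime p d
  prime-coprime pr p∤d (i∣p , i∣d) with prime⇒irreducible pr i∣p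
  ... | inj₁ i≡1  = i≡1
  ... | inj₂ refl = contradiction i∣d p∤d

  module Sieve (n k N : ℕ) (D : ℚ) where

    open Local n

    gₚ : ℕ → Vec ℕ k → ℚ
    gₚ zero    v = 0ℚ
    gₚ (suc q) v = g q v

    rₚ : ℕ → ℚ
    rₚ p = Box k p (gₚ p) * ι p ^ k

    sieve : ℕ → Vec ℕ k → ℚ
    sieve m v = ∏[ p < m ] 1ℚ - 𝟙 (prime? p) * gₚ p v

    density : ℕ → ℚ
    density m = ∏[ p < m ] 1ℚ - 𝟙 (prime? p) * rₚ p

    X : ℕ → (Vec ℕ k → ℚ) → ℚ
    X m G = Simp k N (λ v → G v * sieve m v)

    M : ℕ → ℕ → (Vec ℕ k → ℚ) → ℚ
    M m d G = D * (Box k d G * ι d ^ k) * density m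

    module _ (Sp : Vec ℕ k → Set) (h : Vec ℕ k → ℕ) (β : ℕ → ℚ) where

      -- In use, G is the product of `g` over the primes dividing d, c is κ to their number, and
      -- `rough` says that these primes are at least m. `small` bounds the residue count R(d). In
      -- `supported`, `h` is x for k ≥ 2, so that nothing survives for d ≥ n; for k = 1 it is n, so
      -- that only divisors of n matter.
      record State (m : ℕ) (c : ℚ) (d : ℕ) (G : Vec ℕ k → ℚ) : Set where
        field
          d≢0       : ℕ.NonZero d
          0≤c       : 0ℚ ≤ c
          0≤G       : ∀ v → 0ℚ ≤ G v
          periodic  : Periodic k d G
          rough     : ∀ {p} → Prime p → p ℕ.< m → p ∤ d
          small     : Box k d G ≤ c * β d
          supported : ∀ v → Sp v → d ∤ h v → G v ≡ 0ℚ

      module _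
        (κ : ℚ) (0≤κ : 0ℚ ≤ κ)
        (0≤β : ∀ d → 0ℚ ≤ β d) (β-* : ∀ a b → β (a ℕ.* b) ≡ β a * β b)
        (ρ≤ : ∀ q → Prime (suc q) → ρ q k ≤ κ * β (suc q))
        (g-supported : ∀ q → Prime (suc q) → ∀ v → Sp v → suc q ∤ h v → g q v ≡ 0ℚ)
        (E : ℕ → ℚ)
        (base : ∀ {c d G} → State 0 c d G → ∣ Simp k N G - D * (Box k d G * ι d ^ k) ∣ ≤ c * E d)
        where

        weaken : ∀ {m c d G} → State (suc m) c d G → State m c d G
        weaken S = record
          { d≢0 = d≢0 ; 0≤c = 0≤c ; 0≤G = 0≤G ; periodic = periodic ; small = small ; supported = supported
          ; rough = λ pr p<m → rough pr (ℕ.m<n⇒m<1+n p<m) }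
          where open State S

        module _ {q c d G} (pr : Prime (suc q)) (S : State (suc (suc q)) c d G) where

          open State S
          private
            p = suc q
            instance
              _ = d≢0
            gG : Vec ℕ k → ℚ
            gG v = g q v * G v
            p⊥d : Coprime p d
            p⊥d = prime-coprime pr (rough pr ℕ.≤-refl)

          Box-extend : Box k (p ℕ.* d) gG ≡ ρ q k * Box k d G
          Box-extend = Box-CRT k p d (g q) G p⊥d (g-periodic k q) periodic

          extend : State p (κ * c) (p ℕ.* d) gG
          extend = record
            { d≢0       = ℕ.m*n≢0 p d
            ; 0≤c       = 0≤* 0≤κ 0≤c
            ; 0≤G       = λ v → 0≤* (0≤g q v) (0≤G v)
            ; periodic  = Periodic-× k
                (subst (λ m → Periodic k m (g q)) (ℕ.*-comm d p) (Periodic-* k (g-periodic k q) d))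
                (Periodic-* k periodic p)
            ; rough     = rough′
            ; small     = ℚ.≤-trans (ℚ.≤-reflexive Box-extend)
                (ℚ.≤-trans (*-mono (0≤Box k p (0≤g q)) (ρ≤ q pr) (0≤Box k d 0≤G) small)
                  (ℚ.≤-reflexive (trans (lemma κ (β p) c (β d)) (cong (κ * c *_) (sym (β-* p d))))))
            ; supported = supported′
            }
            where
            lemma : ∀ a b c d → a * b * (c * d) ≡ a * c * (b * d)
            lemma = solve-∀ ring
            rough′ : ∀ {r} → Prime r → r ℕ.< p → r ∤ p ℕ.* d
            rough′ {r} pr′ r<p r∣ with euclidsLemma p d pr′ r∣
            ... | inj₂ r∣d = rough pr′ (ℕ.m<n⇒m<1+n r<p) r∣d
            ... | inj₁ r∣p with prime⇒irreducible pr r∣p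
            ...   | inj₁ refl = contradiction pr′ λ ()
            ...   | inj₂ refl = ℕ.<-irrefl refl r<p
            supported′ : ∀ v → Sp v → p ℕ.* d ∤ h v → gG v ≡ 0ℚ
            supported′ v sp ∤ with p ℕ.∣? h v
            ... | no p∤ = trans (cong (_* G v) (g-supported q pr v sp p∤)) (ℚ.*-zeroˡ (G v))
            -- If d divided t p, then, being coprime to p, it would divide t, and p d would divide
            -- `h v`. So here d does not divide `h v`, and G vanishes.
            ... | yes (divides t eq) = trans (cong (g q v *_) (supported v sp λ d∣ →
                    ∤ (subst (p ℕ.* d ∣_) (trans (ℕ.*-comm p t) (sym eq)) (ℕ.*-monoʳ-∣ p (Coprime.coprime-divisor (Coprime.sym p⊥d)
                      (subst (d ∣_) (trans eq (ℕ.*-comm t p)) d∣))))))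
                  (ℚ.*-zeroʳ (g q v))

          X-split : X (suc p) G + X p gG ≡ X p G
          X-split = trans (sym (Simp-+ k N _ _)) (Simp-cong k N λ v _ →
            trans (cong (λ i → G v * (sieve p v * (1ℚ - i * g q v)) + gG v * sieve p v) (𝟙-yes (prime? p) pr))
              (lemma (G v) (sieve p v) (g q v)))
            where
            lemma : ∀ G P g → G * (P * (1ℚ - 1ℚ * g)) + g * G * P ≡ G * P
            lemma = solve-∀ ring

          -- The predicted main term obeys the recursion `X-split` of the sieved sum because R(p d)
          -- = R(p) R(d); hence so does the difference of the two.
          M-split : M (suc p) d G + M p (p ℕ.* d) gG ≡ M p d G
          M-split = trans (cong₂ (λ i b → D * (Box k d G * ι d ^ k) * (density p * (1ℚ - i * rₚ p)) + D * b * density p)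
              (𝟙-yes (prime? p) pr)
              (cong₂ _*_ Box-extend (trans (cong (_^ k) (ι-* p d)) (^-* (ι p) (ι d) k))))
            (lemma D (Box k d G) (ι d ^ k) (density p) (ρ q k) (ι p ^ k))
            where
            lemma : ∀ D R x Q r y → D * (R * x) * (Q * (1ℚ - 1ℚ * (r * y))) + D * (r * R * (y * x)) * Q ≡ D * (R * x) * Q
            lemma = solve-∀ ring

        -- The inclusion-exclusion tree is descended prime by prime, the largest first, so that no
        -- Möbius function is needed. Each prime splits the error into one at d and one at p d with
        -- weight κ c, which is the recursion of `W`. At the leaves no prime is left and `base`
        -- applies.
        sieve-error : ∀ m {c d G} → State m c d G → ∣ X m G - M m d G ∣ ≤ c * W κ m E d
        sieve-error-step : ∀ m → Dec (Prime m) → ∀ {c d G} → State (suc m) c d G →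
          ∣ X (suc m) G - M (suc m) d G ∣ ≤ c * W κ (suc m) E d

        sieve-error zero {c} {d} {G} S = subst₂ (λ a b → ∣ a - b ∣ ≤ c * E d)
          (Simp-cong k N λ v _ → sym (ℚ.*-identityʳ (G v))) (sym (ℚ.*-identityʳ _)) (base S)
        sieve-error (suc m) S = sieve-error-step m (prime? m) S

        sieve-error-step m (no ¬pr) {c} {d} {G} S = subst₂ _≤_
          (cong₂ (λ a b → ∣ a - b ∣)
            (Simp-cong k N λ v _ → cong (G v *_) (sym (trans (cong (λ i → sieve m v * (1ℚ - i * gₚ m v)) 𝟙≡0)
              (lemma (sieve m v) (gₚ m v)))))
            (cong (D * (Box k d G * ι d ^ k) *_) (sym (trans (cong (λ i → density m * (1ℚ - i * rₚ m)) 𝟙≡0)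
              (lemma (density m) (rₚ m))))))
          (cong (c *_) (sym (trans (cong (λ i → W κ m E d + i * (κ * W κ m E (m ℕ.* d))) 𝟙≡0) (lemma′ (W κ m E d) (κ * W κ m E (m ℕ.* d))))))
          (sieve-error m (weaken S))
          where
          𝟙≡0 = 𝟙-no (prime? m) ¬pr
          lemma : ∀ P g → P * (1ℚ - 0ℚ * g) ≡ P
          lemma = solve-∀ ring
          lemma′ : ∀ a b → a + 0ℚ * b ≡ a
          lemma′ = solve-∀ ring
        sieve-error-step zero    (yes pr) S = contradiction pr ¬prime[0]
        sieve-error-step (suc q) (yes pr) {c} {d} {G} S = subst₂ _≤_
          (cong ∣_∣ (trans (cong₂ (λ a b → (a - b) - (x′ - M p (p ℕ.* d) gG)) (sym (X-split pr S)) (sym (M-split pr S)))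
            (lemma (X (suc p) G) x′ (M (suc p) d G) (M p (p ℕ.* d) gG))))
          (trans (lemma′ c (W κ p E d) κ (W κ p E (p ℕ.* d)))
            (cong (λ i → c * (W κ p E d + i * (κ * W κ p E (p ℕ.* d)))) (sym (𝟙-yes (prime? p) pr))))
          (ℚ.≤-trans (ℚ.∣p-q∣≤∣p∣+∣q∣ (X p G - M p d G) (x′ - M p (p ℕ.* d) gG))
            (ℚ.+-mono-≤ (sieve-error (suc q) (weaken S)) (sieve-error (suc q) (extend pr S))))
          where
          p = suc q
          gG : Vec ℕ k → ℚ
          gG v = g q v * G v
          x′ = X p gG
          lemma : ∀ a a′ b b′ → ((a + a′) - (b + b′)) - (a′ - b′) ≡ a - b
          lemma = solve-∀ ring
          lemma′ : ∀ c w κ w′ → c * w + κ * c * w′ ≡ c * (w + 1ℚ * (κ * w′))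
          lemma′ = solve-∀ ring

-- From coprime tuples to the sieve

module CoprimeTuples where

  open Rational
  open PeriodicSums
  open Residues
  open PrimeSieve
  open import Defs using (Σ<; ∏<; A; tuples; product; isSolution?)
  open import Data.List as List using (List; []; _∷_; _++_)
  import Data.List.Properties as List
  open import Data.List.Relation.Unary.All using (_∷_)
  open import Data.Nat.Divisibility using (_∣_; divides)
  open import Data.Nat.Primality.Factorisation using (factorise)
  open import Data.Rational using (_+_; _*_; _-_; _≤_; ∣_∣)
  open import Relation.Unary using (Decidable)

  count : ∀ {A : Set} {P : A → Set} → Decidable P → List A → ℚ
  count P? xs = ⟦ List.length (List.filter P? xs) ⟧

  count-++ : ∀ {A : Set} {P : A → Set} (P? : Decidable P) xs ys → count P? (xs ++ ys) ≡ count P? xs + count P? ys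
  count-++ P? xs ys = trans (cong (λ l → ⟦ List.length l ⟧) (List.filter-++ P? xs ys))
    (trans (cong ⟦_⟧ (List.length-++ (List.filter P? xs))) (sym (⟦+⟧ (List.length (List.filter P? xs)) (List.length (List.filter P? ys)))))

  length-filter-map : ∀ {A B : Set} {P : B → Set} (P? : Decidable P) (f : A → B) xs →
    List.length (List.filter P? (List.map f xs)) ≡ List.length (List.filter (λ x → P? (f x)) xs)
  length-filter-map P? f [] = refl
  length-filter-map P? f (x ∷ xs) with P? (f x)
  ... | yes _ = cong suc (length-filter-map P? f xs)
  ... | no _  = length-filter-map P? f xs

  count-product : ∀ {m} {P : Vec ℕ (suc m) → Set} (P? : Decidable P) n (f : ℕ → ℕ) ts →
    count P? (List.cartesianProductWith _∷_ (List.applyUpTo f n) ts) ≡ Σ[ z < n ] count (λ v → P? (f z ∷ v)) ts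
  count-product P? zero    f ts = refl
  count-product P? (suc n) f ts = trans (count-++ P? (List.map (f 0 ∷_) ts) _)
    (trans (cong₂ _+_ (cong ⟦_⟧ (length-filter-map P? (f 0 ∷_) ts)) (count-product P? n (λ i → f (suc i)) ts))
      (sym (Σ-head n λ z → count (λ v → P? (f z ∷ v)) ts)))

  count-tuples : ∀ m n {P : Vec ℕ m → Set} (P? : Decidable P) → count P? (tuples m n) ≡ Box m n (λ v → 𝟙 (P? (Vec.map suc v)))
  count-tuples zero n P? with P? []
  ... | yes _ = refl
  ... | no _  = refl
  count-tuples (suc m) n P? = trans
    (cong (λ l → count P? (List.cartesianProductWith _∷_ l (tuples m n))) (List.map-upTo suc n))
    (trans (count-product P? n suc (tuples m n)) (Σ-cong n λ z _ → count-tuples m n (λ v → P? (suc z ∷ v))))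

  sum-map-suc : ∀ {k} (v : Vec ℕ k) → Vec.sum (Vec.map suc v) ≡ Vec.sum v ℕ.+ k
  sum-map-suc []      = refl
  sum-map-suc {suc k} (z ∷ v) = trans (cong (λ s → suc (z ℕ.+ s)) (sum-map-suc v)) (lemma z (Vec.sum v) k)
    where
    lemma : ∀ z s k → 1 ℕ.+ (z ℕ.+ (s ℕ.+ k)) ≡ z ℕ.+ s ℕ.+ (1 ℕ.+ k)
    lemma = ℕ-solve-∀

  𝟙-× : ∀ {P Q : Set} (d : Dec P) (e : Dec Q) → 𝟙 (d ×-dec e) ≡ 𝟙 d * 𝟙 e
  𝟙-× (yes _) (yes _) = refl
  𝟙-× (yes _) (no _)  = refl
  𝟙-× (no _)  e       = sym (ℚ.*-zeroˡ (𝟙 e))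

  -- Summing over the first entry leaves an indicator: it is determined by the others when
  -- `Vec.sum v < N` and has no admissible value otherwise.
  A-Simp : ∀ k N → let n = N ℕ.+ k in
    ⟦ A k n ⟧ ≡ Simp k N (λ v → 𝟙 (ℕ.gcd (n ℕ.∸ (Vec.sum v ℕ.+ k)) (product (Vec.map suc v)) ℕ.≟ 1))
  A-Simp k N = trans (count-tuples (suc k) n (isSolution? n))
    (trans (sym (Box-Σ k n n (λ x v → 𝟙 (isSolution? n (suc x ∷ Vec.map suc v)))))
      (trans (Box-cong k n inner) (Box-simplex k n N _ (ℕ.m≤m+n N k))))
    where
    n = N ℕ.+ k
    inner : ∀ v → (Σ[ x < n ] 𝟙 (isSolution? n (suc x ∷ Vec.map suc v)))
      ≡ 𝟙 (Vec.sum v ℕ.<? N) * 𝟙 (ℕ.gcd (n ℕ.∸ (Vec.sum v ℕ.+ k)) (product (Vec.map suc v)) ℕ.≟ 1)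
    inner v with Vec.sum v ℕ.<? N
    ... | no s≮N = trans (Σ-cong n λ x _ → 𝟙-no (isSolution? n (suc x ∷ Vec.map suc v)) λ (e , _) → s≮N (begin
            suc (Vec.sum v)            ≤⟨ ℕ.m≤n+m (suc (Vec.sum v)) x ⟩
            x ℕ.+ suc (Vec.sum v)      ≡⟨ ℕ.+-cancelʳ-≡ k _ N (trans (lemma x (Vec.sum v) k)
                                          (trans (cong (suc x ℕ.+_) (sym (sum-map-suc v))) (sym e))) ⟩
            N                          ∎))
          (trans (Σ-zero n) (sym (ℚ.*-zeroˡ (𝟙 (ℕ.gcd (n ℕ.∸ (Vec.sum v ℕ.+ k)) (product (Vec.map suc v)) ℕ.≟ 1)))))
      where
      open ℕ.≤-Reasoning
      lemma : ∀ x s k → x ℕ.+ (1 ℕ.+ s) ℕ.+ k ≡ (1 ℕ.+ x) ℕ.+ (s ℕ.+ k)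
      lemma = ℕ-solve-∀
    ... | yes s<N = trans (Σ-cong n λ x _ → trans (𝟙-× (n ℕ.≟ suc x ℕ.+ s) (ℕ.gcd (suc x) P ℕ.≟ 1))
            (cong (_* 𝟙 (ℕ.gcd (suc x) P ℕ.≟ 1)) (𝟙-cong (n ℕ.≟ suc x ℕ.+ s) (x ℕ.≟ i) (unique x) (solves x))))
          (trans (Σ-δ n i (λ x → 𝟙 (ℕ.gcd (suc x) P ℕ.≟ 1)) i<n)
            (trans (cong (λ y → 𝟙 (ℕ.gcd y P ℕ.≟ 1)) suc-i) (sym (ℚ.*-identityˡ _))))
      where
      s = Vec.sum (Vec.map suc v)
      P = product (Vec.map suc v)
      i = N ℕ.∸ suc (Vec.sum v)
      i+ : suc i ℕ.+ Vec.sum v ≡ N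
      i+ = trans (sym (ℕ.+-suc i (Vec.sum v))) (ℕ.m∸n+n≡m s<N)
      n≡ : n ≡ suc i ℕ.+ (Vec.sum v ℕ.+ k)
      n≡ = trans (cong (ℕ._+ k) (sym i+)) (ℕ.+-assoc (suc i) (Vec.sum v) k)
      suc-i : suc i ≡ n ℕ.∸ (Vec.sum v ℕ.+ k)
      suc-i = sym (trans (cong (ℕ._∸ (Vec.sum v ℕ.+ k)) n≡) (ℕ.m+n∸n≡m (suc i) (Vec.sum v ℕ.+ k)))
      i<n : i ℕ.< n
      i<n = subst (suc i ℕ.≤_) (sym n≡) (ℕ.m≤m+n (suc i) _)
      solves : ∀ x → x ≡ i → n ≡ suc x ℕ.+ s
      solves x refl = trans n≡ (cong (suc i ℕ.+_) (sym (sum-map-suc v)))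
      unique : ∀ x → n ≡ suc x ℕ.+ s → x ≡ i
      unique x e = ℕ.suc-injective (ℕ.+-cancelʳ-≡ s (suc x) (suc i) (trans (sym e) (solves i refl)))

  prime-divisor : ∀ m .{{_ : ℕ.NonZero m}} → m ≢ 1 → ∃[ p ] (Prime p × p ∣ m)
  prime-divisor m m≢1 with factorise m
  ... | record { factors = []     ; isFactorisation = e } = contradiction e m≢1
  ... | record { factors = p ∷ ps ; isFactorisation = e ; factorsPrime = pr ∷ _ } =
    p , pr , divides (ℕ.product ps) (trans e (ℕ.*-comm p (ℕ.product ps)))

  ∏-one : ∀ n {f : ℕ → ℚ} → (∀ i → i ℕ.< n → f i ≡ 1ℚ) → ∏< n f ≡ 1ℚ
  ∏-one zero    h = refl
  ∏-one (suc n) h = cong₂ _*_ (∏-one n λ i i<n → h i (ℕ.m<n⇒m<1+n i<n)) (h n (ℕ.n<1+n n))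

  ∏-zero : ∀ {n i} {f : ℕ → ℚ} → i ℕ.< n → f i ≡ 0ℚ → ∏< n f ≡ 0ℚ
  ∏-zero {suc n} {i} {f} i<1+n e with i ℕ.≟ n
  ... | yes refl = trans (cong (∏< n f *_) e) (ℚ.*-zeroʳ (∏< n f))
  ... | no i≢n   = trans (cong (_* f n) (∏-zero (ℕ.≤∧≢⇒< (ℕ.s≤s⁻¹ i<1+n) i≢n) e)) (ℚ.*-zeroˡ (f n))

  ∣∸⇒%≡ : ∀ {p s n} .{{_ : ℕ.NonZero p}} → s ℕ.≤ n → p ∣ n ℕ.∸ s → s ℕ.% p ≡ n ℕ.% p
  ∣∸⇒%≡ {p} {s} {n} s≤n (divides c e) = trans (sym (ℕ.[m+kn]%n≡m%n s c p))
    (cong (ℕ._% p) (trans (cong (s ℕ.+_) (sym e)) (ℕ.m+[n∸m]≡n s≤n)))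

  %≡⇒∣∸ : ∀ {p s n} .{{_ : ℕ.NonZero p}} → s ℕ.% p ≡ n ℕ.% p → p ∣ n ℕ.∸ s
  %≡⇒∣∸ {p} {s} {n} e = divides (n ℕ./ p ℕ.∸ s ℕ./ p)
    (trans (cong₂ ℕ._∸_ (ℕ.m≡m%n+[m/n]*n n p) (trans (ℕ.m≡m%n+[m/n]*n s p) (cong (ℕ._+ s ℕ./ p ℕ.* p) e)))
      (trans (ℕ.[m+n]∸[m+o]≡n∸o (n ℕ.% p) _ _) (sym (ℕ.*-distribʳ-∸ p (n ℕ./ p) (s ℕ./ p)))))

  module _ (n : ℕ) where

    open Local n

    onto-sum-form : ∀ {k} q t (v : Vec ℕ k) → onto q t v ≡ 𝟙 ((t ℕ.+ (Vec.sum v ℕ.+ k)) ℕ.% suc q ℕ.≟ n ℕ.% suc q)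
    onto-sum-form q t []      = cong (λ s → 𝟙 (s ℕ.% suc q ℕ.≟ n ℕ.% suc q)) (sym (ℕ.+-identityʳ t))
    onto-sum-form {suc k} q t (z ∷ v) = trans (onto-sum-form q (t ℕ.+ suc z) v)
      (cong (λ s → 𝟙 (s ℕ.% suc q ℕ.≟ n ℕ.% suc q)) (lemma t z (Vec.sum v) k))
      where
      lemma : ∀ t z s k → t ℕ.+ (1 ℕ.+ z) ℕ.+ (s ℕ.+ k) ≡ t ℕ.+ (z ℕ.+ s ℕ.+ (1 ℕ.+ k))
      lemma = ℕ-solve-∀

    onto-∣ : ∀ {k} q (v : Vec ℕ k) → let s = Vec.sum v ℕ.+ k in s ℕ.≤ n → onto q 0 v ≡ 𝟙 (suc q ℕ.∣? n ℕ.∸ s)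
    onto-∣ {k} q v s≤n = trans (onto-sum-form q 0 v)
      (𝟙-cong ((Vec.sum v ℕ.+ k) ℕ.% suc q ℕ.≟ n ℕ.% suc q) (suc q ℕ.∣? n ℕ.∸ (Vec.sum v ℕ.+ k))
        (%≡⇒∣∸ {suc q} {Vec.sum v ℕ.+ k} {n}) (∣∸⇒%≡ s≤n))

    avoids-∣ : ∀ {k} q (v : Vec ℕ k) → Prime (suc q) → 1ℚ - avoids q v ≡ 𝟙 (suc q ℕ.∣? product (Vec.map suc v))
    avoids-∣ q [] pr = sym (𝟙-no (suc q ℕ.∣? 1) λ h → ℕ.nonTrivial⇒≢1 {{prime⇒nonTrivial pr}} (ℕ.∣1⇒≡1 h))
    avoids-∣ q (z ∷ v) pr with suc q ℕ.∣? suc z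
    ... | yes p∣z = trans (lemma (avoids q v)) (sym (𝟙-yes (suc q ℕ.∣? suc z ℕ.* product (Vec.map suc v)) (ℕ.∣m⇒∣m*n _ p∣z)))
      where
      lemma : ∀ a → 1ℚ - (1ℚ - 1ℚ) * a ≡ 1ℚ
      lemma = solve-∀ ring
    ... | no p∤z = trans (lemma (avoids q v)) (trans (avoids-∣ q v pr)
            (𝟙-cong (suc q ℕ.∣? product (Vec.map suc v)) (suc q ℕ.∣? suc z ℕ.* product (Vec.map suc v)) (ℕ.∣n⇒∣m*n (suc z)) back))
      where
      lemma : ∀ a → 1ℚ - (1ℚ - 0ℚ) * a ≡ 1ℚ - a
      lemma = solve-∀ ring
      back : suc q ∣ suc z ℕ.* product (Vec.map suc v) → suc q ∣ product (Vec.map suc v)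
      back h with euclidsLemma (suc z) (product (Vec.map suc v)) pr h
      ... | inj₁ p∣z = contradiction p∣z p∤z
      ... | inj₂ p∣P = p∣P

    g-∣ : ∀ {k} q (v : Vec ℕ k) → Prime (suc q) → let s = Vec.sum v ℕ.+ k in s ℕ.≤ n →
      g q v ≡ 𝟙 (suc q ℕ.∣? n ℕ.∸ s) * 𝟙 (suc q ℕ.∣? product (Vec.map suc v))
    g-∣ q v pr s≤n = cong₂ _*_ (onto-∣ q v s≤n) (avoids-∣ q v pr)

    -- A prime dividing the gcd divides 0 < n - s ≤ n < m, so the sieve up to m misses none. That
    -- any such m will do is what allows m to tend to infinity with n fixed.
    gcd-sieve : ∀ {k} N D m (v : Vec ℕ k) → let open Sieve n k N D ; s = Vec.sum v ℕ.+ k in s ℕ.< n → n ℕ.< m →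
      𝟙 (ℕ.gcd (n ℕ.∸ s) (product (Vec.map suc v)) ℕ.≟ 1) ≡ sieve m v
    gcd-sieve {k} N D m v s<n n<m with ℕ.gcd (n ℕ.∸ (Vec.sum v ℕ.+ k)) (product (Vec.map suc v)) ℕ.≟ 1
    ... | yes gcd≡1 = sym (∏-one m λ p _ → trans (cong (λ t → 1ℚ - t) (factor p (prime? p))) refl)
      where
      open Sieve n k N D
      s = Vec.sum v ℕ.+ k
      P = product (Vec.map suc v)
      factor : ∀ p (d : Dec (Prime p)) → 𝟙 d * gₚ p v ≡ 0ℚ
      factor p (no _) = ℚ.*-zeroˡ (gₚ p v)
      factor zero (yes pr) = contradiction pr ¬prime[0]
      factor (suc q) (yes pr) = trans (ℚ.*-identityˡ (g q v)) (trans (g-∣ q v pr (ℕ.<⇒≤ s<n)) (both (suc q ℕ.∣? n ℕ.∸ s) (suc q ℕ.∣? P)))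
        where
        both : (d : Dec (suc q ∣ n ℕ.∸ s)) (e : Dec (suc q ∣ P)) → 𝟙 d * 𝟙 e ≡ 0ℚ
        both (no _)    e       = ℚ.*-zeroˡ (𝟙 e)
        both (yes _)   (no _)  = refl
        both (yes p∣x) (yes p∣P) = contradiction (ℕ.∣1⇒≡1 (subst (suc q ∣_) gcd≡1 (ℕ.gcd-greatest p∣x p∣P)))
          (ℕ.nonTrivial⇒≢1 {{prime⇒nonTrivial pr}})
    ... | no gcd≢1 with prime-divisor (ℕ.gcd (n ℕ.∸ (Vec.sum v ℕ.+ k)) (product (Vec.map suc v)))
                         {{ℕ.≢-nonZero (ℕ.gcd[m,n]≢0 (n ℕ.∸ (Vec.sum v ℕ.+ k)) (product (Vec.map suc v)) (inj₁ (ℕ.m>n⇒m∸n≢0 s<n)))}} gcd≢1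
    ...   | zero  , pr , _ = contradiction pr ¬prime[0]
    ...   | suc q , pr , p∣gcd = sym (∏-zero {m} {suc q} p<m (trans
              (cong₂ (λ a b → 1ℚ - a * b) (𝟙-yes (prime? (suc q)) pr)
                (trans (g-∣ q v pr (ℕ.<⇒≤ s<n)) (cong₂ _*_
                  (𝟙-yes (suc q ℕ.∣? n ℕ.∸ s) p∣x)
                  (𝟙-yes (suc q ℕ.∣? P) (ℕ.∣-trans p∣gcd (ℕ.gcd[m,n]∣n (n ℕ.∸ s) P)))))) refl))
      where
      s = Vec.sum v ℕ.+ k
      P = product (Vec.map suc v)
      p∣x : suc q ∣ n ℕ.∸ s
      p∣x = ℕ.∣-trans p∣gcd (ℕ.gcd[m,n]∣m (n ℕ.∸ s) P)
      p<m : suc q ℕ.< m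
      p<m = ℕ.≤-<-trans (ℕ.∣⇒≤ {{ℕ.≢-nonZero (ℕ.m>n⇒m∸n≢0 s<n)}} p∣x) (ℕ.≤-<-trans (ℕ.m∸n≤m n s) n<m)

-- Local densities and the Euler factors of `C` and `f`

module LocalDensities where

  open Rational
  open PeriodicSums
  open Residues
  open PrimeSieve
  open import Defs using (_//_; /-toℚᵘ; ∏<; 0≤*; *-mono; ≤⇒0≤; <⇒0<; ψ; when; C-factor; C-approx; f-factor; ψ<p^k; f)
  open import Data.Integer as ℤ using (ℤ; +_)
  import Data.Integer.Properties as ℤ
  open import Data.Integer.Tactic.RingSolver renaming (solve-∀ to ℤ-solve-∀) using ()
  open import Data.Nat.Divisibility using (_∣_; _∤_)
  open import Data.Rational using (_+_; _*_; _-_; -_; _≤_)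
  open import Data.Rational.Unnormalised as ℚᵘ using (*≡*)
  import Data.Rational.Unnormalised.Properties as ℚᵘ

  ζ : ℤ → ℚ
  ζ i = i ℚ./ 1

  ζ-+ : ∀ i j → ζ (i ℤ.+ j) ≡ ζ i + ζ j
  ζ-+ i j = ℚ.toℚᵘ-injective (ℚᵘ.≃-trans (/-toℚᵘ (i ℤ.+ j) 0)
    (ℚᵘ.≃-trans (*≡* (lemma i j)) (ℚᵘ.≃-sym (ℚᵘ.≃-trans (ℚ.toℚᵘ-homo-+ (ζ i) (ζ j))
      (ℚᵘ.+-cong (/-toℚᵘ i 0) (/-toℚᵘ j 0))))))
    where
    lemma : ∀ i j → (i ℤ.+ j) ℤ.* + 1 ≡ (i ℤ.* + 1 ℤ.+ j ℤ.* + 1) ℤ.* + 1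
    lemma = ℤ-solve-∀

  ζ-* : ∀ i j → ζ (i ℤ.* j) ≡ ζ i * ζ j
  ζ-* i j = ℚ.toℚᵘ-injective (ℚᵘ.≃-trans (/-toℚᵘ (i ℤ.* j) 0)
    (ℚᵘ.≃-sym (ℚᵘ.≃-trans (ℚ.toℚᵘ-homo-* (ζ i) (ζ j)) (ℚᵘ.*-cong (/-toℚᵘ i 0) (/-toℚᵘ j 0)))))

  ζ-sub : ∀ i j → ζ (i ℤ.- j) ≡ ζ i - ζ j
  ζ-sub i j = trans (lemma (ζ (i ℤ.- j)) (ζ j)) (cong (_- ζ j) (trans (sym (ζ-+ (i ℤ.- j) j)) (cong ζ (lemma′ i j))))
    where
    lemma : ∀ a b → a ≡ (a + b) - b
    lemma = solve-∀ ring
    lemma′ : ∀ i j → i ℤ.- j ℤ.+ j ≡ i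
    lemma′ = ℤ-solve-∀

  ζ-^ : ∀ i k → ζ (i ℤ.^ k) ≡ ζ i ^ k
  ζ-^ i zero    = refl
  ζ-^ i (suc k) = trans (ζ-* i (i ℤ.^ k)) (cong (ζ i *_) (ζ-^ i k))

  *-/ : ∀ i q → ⟦ suc q ⟧ * (i ℚ./ suc q) ≡ ζ i
  *-/ i q = ℚ.toℚᵘ-injective (ℚᵘ.≃-trans (ℚ.toℚᵘ-homo-* ⟦ suc q ⟧ (i ℚ./ suc q))
    (ℚᵘ.≃-trans (ℚᵘ.*-cong (/-toℚᵘ (+ suc q) 0) (/-toℚᵘ i q))
      (ℚᵘ.≃-trans (*≡* (trans (lemma (+ suc q) i) (cong (λ d → i ℤ.* + d) (sym (ℕ.*-identityˡ (suc q))))))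
        (ℚᵘ.≃-sym (/-toℚᵘ i 0)))))
    where
    lemma : ∀ p i → (p ℤ.* i) ℤ.* + 1 ≡ i ℤ.* p
    lemma = ℤ-solve-∀

  *-ψ : ∀ k q → ⟦ suc q ⟧ * ψ k (suc q) ≡ ⟦ suc q ⟧ ^ k - ⟦ q ⟧ ^ k + (- 1ℚ) ^ k
  *-ψ k q = trans (*-/ ((+ suc q) ℤ.^ k ℤ.- (+ suc q ℤ.- + 1) ℤ.^ k ℤ.+ (ℤ.- + 1) ℤ.^ k) q)
    (trans (ζ-+ ((+ suc q) ℤ.^ k ℤ.- (+ q) ℤ.^ k) ((ℤ.- + 1) ℤ.^ k))
      (cong₂ _+_ (trans (ζ-sub ((+ suc q) ℤ.^ k) ((+ q) ℤ.^ k)) (cong₂ _-_ (ζ-^ (+ suc q) k) (ζ-^ (+ q) k)))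
        (ζ-^ (ℤ.- + 1) k)))

  ι-^ : ∀ n k → ι (n ℕ.^ k) ≡ ι n ^ k
  ι-^ n zero    = refl
  ι-^ n (suc k) = trans (ι-* n (n ℕ.^ k)) (cong (ι n *_) (ι-^ n k))

  ^-inverse : ∀ p k .{{_ : ℕ.NonZero p}} → ⟦ p ⟧ ^ k * ι p ^ k ≡ 1ℚ
  ^-inverse p k = trans (sym (^-* ⟦ p ⟧ (ι p) k)) (trans (cong (_^ k) (ι-inverse p)) (1^ k))

  1//≡ι : ∀ b .{{_ : ℕ.NonZero b}} → 1 // b ≡ ι b
  1//≡ι (suc b) = refl

  module Density (n j N : ℕ) (D : ℚ) .{{_ : ℕ.NonZero n}} where

    private
      k = suc j
    open Sieve n k N D
    open Local n

    private
      residue : ℕ → ℚ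
      residue q = 𝟙 (0 ℕ.% suc q ℕ.≟ n ℕ.% suc q)

      ε : ℚ
      ε = (- 1ℚ) ^ k

    ρ≡ψ : ∀ q → ρ q k ≡ ψ k (suc q) - ε * residue q
    ρ≡ψ q = trans (sym (cancel (ρ q k))) (trans (cong (ι p *_) eq) (cancel (ψ k p - ε * residue q)))
      where
      p = suc q
      cancel : ∀ x → ι p * (⟦ p ⟧ * x) ≡ x
      cancel x = trans (sym (ℚ.*-assoc (ι p) ⟦ p ⟧ x))
        (trans (cong (_* x) (trans (ℚ.*-comm (ι p) ⟦ p ⟧) (ι-inverse p))) (ℚ.*-identityˡ x))
      lemma : ∀ p x e d → p * x - e * (p * d) ≡ p * (x - e * d)
      lemma = solve-∀ ring
      eq : ⟦ p ⟧ * ρ q k ≡ ⟦ p ⟧ * (ψ k p - ε * residue q)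
      eq = trans (ρ-closed q j) (trans (cong (_- ε * (⟦ p ⟧ * residue q)) (sym (*-ψ k q))) (lemma ⟦ p ⟧ (ψ k p) ε (residue q)))

    residue-yes : ∀ q → suc q ∣ n → residue q ≡ 1ℚ
    residue-yes q p∣n = 𝟙-yes (0 ℕ.% suc q ℕ.≟ n ℕ.% suc q) (sym (ℕ.n∣m⇒m%n≡0 n (suc q) p∣n))

    residue-no : ∀ q → suc q ∤ n → residue q ≡ 0ℚ
    residue-no q p∤n = 𝟙-no (0 ℕ.% suc q ℕ.≟ n ℕ.% suc q) λ e → p∤n (ℕ.m%n≡0⇒n∣m n (suc q) (sym e))

    C-factor≡ : ∀ q (pr : Prime (suc q)) → C-factor k (suc q) pr ≡ 1ℚ - ψ k (suc q) * ι (suc q) ^ k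
    C-factor≡ q pr = cong (λ y → 1ℚ - ψ k p * y) (trans (1//≡ι (p ℕ.^ k)) (ι-^ p k))
      where
      p = suc q
      instance
        _ = ℕ.m^n≢0 p k

    -- With y = p^(-k) the first factor is 1 - ψ y = (p^k - ψ) y, so the denominator of `f-factor`
    -- cancels.
    C-f-factor : ∀ q (pr : Prime (suc q)) →
      C-factor k (suc q) pr * f-factor k (suc q) pr ≡ 1ℚ - (ψ k (suc q) - ε) * ι (suc q) ^ k
    C-f-factor q pr = trans (cong₂ _*_ (trans (C-factor≡ q pr) (cong (_- ψ k p * y) (sym Py)))
        (cong (λ e → 1ℚ + e * i) (ζ-^ (ℤ.- + 1) k)))
      (trans (lemma P (ψ k p) y ε i)
        (trans (cong₂ (λ a b → a - ψ k p * y + ε * y * b) Py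
            (trans (cong (λ z → (z - ψ k p) * i) (⟦^⟧ p k)) (ℚ.*-inverseʳ d)))
          (lemma′ (ψ k p) y ε)))
      where
      p = suc q
      y = ι p ^ k
      P = ⟦ p ⟧ ^ k
      Py = ^-inverse p k
      d = (p ℕ.^ k) // 1 - ψ k p
      instance
        d≢0 : ℚ.NonZero d
        d≢0 = ℚ.>-nonZero (<⇒0< (ψ<p^k k p pr))
      i : ℚ
      i = ℚ.1/ d
      lemma : ∀ P s y e i → (P * y - s * y) * (1ℚ + e * i) ≡ P * y - s * y + e * y * ((P - s) * i)
      lemma = solve-∀ ring
      lemma′ : ∀ s y e → 1ℚ - s * y + e * y * 1ℚ ≡ 1ℚ - (s - e) * y
      lemma′ = solve-∀ ring

    F-factor : ∀ p → Dec (Prime p) → ℚ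
    F-factor p d = when (d ×-dec p ℕ.∣? n) (λ (pr , _) → f-factor k p pr)

    factor : ∀ p (d : Dec (Prime p)) → 1ℚ - 𝟙 d * rₚ p ≡ when d (C-factor k p) * F-factor p d
    factor p (no _) = lemma (rₚ p)
      where
      lemma : ∀ r → 1ℚ - 0ℚ * r ≡ 1ℚ * 1ℚ
      lemma = solve-∀ ring
    factor zero    (yes pr) = contradiction pr ¬prime[0]
    factor (suc q) (yes pr) = trans (cong (λ r → 1ℚ - 1ℚ * (r * ι (suc q) ^ k)) (ρ≡ψ q)) (by (suc q ℕ.∣? n))
      where
      lemma₁ : ∀ s e y → 1ℚ - 1ℚ * ((s - e * 1ℚ) * y) ≡ 1ℚ - (s - e) * y
      lemma₁ = solve-∀ ring
      lemma₀ : ∀ s e y → 1ℚ - 1ℚ * ((s - e * 0ℚ) * y) ≡ (1ℚ - s * y) * 1ℚ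
      lemma₀ = solve-∀ ring
      by : (e : Dec (suc q ∣ n)) → 1ℚ - 1ℚ * ((ψ k (suc q) - ε * residue q) * ι (suc q) ^ k)
        ≡ C-factor k (suc q) pr * when (yes pr ×-dec e) (λ (pr , _) → f-factor k (suc q) pr)
      by (yes p∣n) = trans (cong (λ r → 1ℚ - 1ℚ * ((ψ k (suc q) - ε * r) * ι (suc q) ^ k)) (residue-yes q p∣n))
        (trans (lemma₁ (ψ k (suc q)) ε (ι (suc q) ^ k)) (sym (C-f-factor q pr)))
      by (no p∤n) = trans (cong (λ r → 1ℚ - 1ℚ * ((ψ k (suc q) - ε * r) * ι (suc q) ^ k)) (residue-no q p∤n))
        (trans (lemma₀ (ψ k (suc q)) ε (ι (suc q) ^ k)) (cong (_* 1ℚ) (sym (C-factor≡ q pr))))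

    ∏-extend : ∀ m (F : ℕ → ℚ) {i} → i ℕ.≤ m → (∀ p → i ℕ.≤ p → F p ≡ 1ℚ) → ∏< m F ≡ ∏< i F
    ∏-extend zero    F z≤n h = refl
    ∏-extend (suc m) F {i} i≤1+m h with i ℕ.≟ suc m
    ... | yes refl = refl
    ... | no i≢    = trans (cong₂ _*_ (∏-extend m F i≤m h) (h m i≤m)) (ℚ.*-identityʳ _)
      where i≤m = ℕ.s≤s⁻¹ (ℕ.≤∧≢⇒< i≤1+m i≢)

    -- The product `f` stops at n, but its factors at the primes between n and m would be 1, since
    -- such primes do not divide n. Both products can thus be taken over p < m and compared factor
    -- by factor.
    density≡C*f : ∀ m → n ℕ.< m → density m ≡ C-approx k m * f k n
    density≡C*f m n<m = trans (∏-cong m λ p _ → factor p (prime? p))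
      (trans (∏-* m (λ p → when (prime? p) (C-factor k p)) (λ p → F-factor p (prime? p)))
        (cong (C-approx k m *_) (∏-extend m (λ p → F-factor p (prime? p)) n<m λ p n<p → large p n<p (prime? p ×-dec p ℕ.∣? n))))
      where
      large : ∀ p → n ℕ.< p → (d : Dec (Prime p × p ∣ n)) → when d (λ (pr , _) → f-factor k p pr) ≡ 1ℚ
      large p n<p (no _)          = refl
      large p n<p (yes (_ , p∣n)) = contradiction (ℕ.∣⇒≤ p∣n) (ℕ.<⇒≱ n<p)

    0≤rₚ : ∀ p → 0ℚ ≤ rₚ p
    0≤rₚ zero    = 0≤* (0≤Box k 0 λ _ → ℚ.≤-refl) (0≤^ k ℚ.≤-refl)
    0≤rₚ (suc q) = 0≤* (0≤Box k (suc q) (0≤g q)) (0≤^ k (0≤ι (suc q)))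

    rₚ≤1 : ∀ p → rₚ p ≤ 1ℚ
    rₚ≤1 zero    = ℚ.≤-trans (ℚ.≤-reflexive (ℚ.*-zeroˡ (ι 0 ^ k))) 0≤1
    rₚ≤1 (suc q) = ℚ.≤-trans (*-monoʳ (0≤^ k (0≤ι (suc q))) (Box-mono k (suc q) (g≤1 q)))
      (ℚ.≤-reflexive (trans (cong (_* ι (suc q) ^ k) (trans (Box-const k (suc q) 1ℚ) (ℚ.*-identityʳ (⟦ suc q ⟧ ^ k)))) (^-inverse (suc q) k)))

    density-bounds : ∀ m → 0ℚ ≤ density m × density m ≤ 1ℚ
    density-bounds zero    = 0≤1 , ℚ.≤-refl
    density-bounds (suc m) = 0≤* (proj₁ (density-bounds m)) 0≤t , *-mono (proj₁ (density-bounds m)) (proj₂ (density-bounds m)) 0≤t t≤1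
      where
      x = 𝟙 (prime? m) * rₚ m
      0≤t : 0ℚ ≤ 1ℚ - x
      0≤t = ≤⇒0≤ (*-mono (0≤𝟙 (prime? m)) (𝟙≤1 (prime? m)) (0≤rₚ m) (rₚ≤1 m))
      t≤1 : 1ℚ - x ≤ 1ℚ
      t≤1 = 1-p≤1 (0≤* (0≤𝟙 (prime? m)) (0≤rₚ m))

-- Error estimates for the count: k = 1 exactly, k ≥ 2 with bounds

module ErrorTerm where

  open Rational
  open PeriodicSums
  open SimplexCounts
  open Residues
  open PrimeWeights
  open PrimeSieve
  open CoprimeTuples
  open LocalDensities
  open import Defs using (_//_; Σ<; 0≤*; 0≤+; *-mono; ≤⇒0≤; ∣-∣⇒≤; ∣-∣≤; ∣-∣-swap; A; C-approx; f; product)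
  open import Data.Nat.Divisibility using (_∣_; _∤_; divides)
  open import Data.Rational using (_+_; _*_; _-_; -_; _≤_; _<_; ∣_∣)

  Periodic-const : ∀ k d c → Periodic k d (λ _ → c)
  Periodic-const zero    d c = tt
  Periodic-const (suc k) d c = (λ _ _ → refl) , λ _ → Periodic-const k d c

  ≡⇒∣-∣≡0 : ∀ {p q} → p ≡ q → ∣ p - q ∣ ≡ 0ℚ
  ≡⇒∣-∣≡0 {p} refl = cong ∣_∣ (ℚ.+-inverseʳ p)

  ∣-∣≤0⇒≡ : ∀ p q → ∣ p - q ∣ ≤ 0ℚ → p ≡ q
  ∣-∣≤0⇒≡ p q h = ℚ.≤-antisym
    (subst (p ≤_) (ℚ.+-identityʳ q) (∣-∣⇒≤ h))
    (subst (q ≤_) (ℚ.+-identityʳ p) (∣-∣⇒≤ (subst (_≤ 0ℚ) (∣-∣-swap p q) h)))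

  main-term : (k n m : ℕ) .{{_ : ℕ.NonZero k}} → ℚ
  main-term k n m = C-approx k m * f k n * _//_ (n ℕ.^ k) (k !) {{k ℕ.!≢0}}

  volume : ℕ → ℕ → ℚ
  volume k n = ⟦ n ⟧ ^ k * ι (k !)

  0≤volume : ∀ k n → 0ℚ ≤ volume k n
  0≤volume k n = 0≤* (0≤^ k (0≤⟦⟧ n)) (0≤ι (k !))

  volume≡ : ∀ k n → _//_ (n ℕ.^ k) (k !) {{k ℕ.!≢0}} ≡ volume k n
  volume≡ k n = trans (//≡*ι (n ℕ.^ k) (k !) {{k ℕ.!≢0}}) (cong (_* ι (k !)) (sym (⟦^⟧ n k)))

  module _ (j n N : ℕ) (D : ℚ) .{{_ : ℕ.NonZero n}} where
    private
      k = suc j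
    open Sieve n k N D
    open Density n j N D

    main-term≡ : ∀ m → n ℕ.< m → main-term k n m ≡ volume k n * density m
    main-term≡ m n<m = trans (cong₂ _*_ (sym (density≡C*f m n<m)) (volume≡ k n)) (ℚ.*-comm (density m) (volume k n))

    module _ (Sp : Vec ℕ k → Set) (h : Vec ℕ k → ℕ) (β : ℕ → ℚ) (β-1 : β 1 ≡ 1ℚ) where

      initial : ∀ m → State Sp h β m 1ℚ 1 (λ _ → 1ℚ)
      initial m = record
        { d≢0       = _
        ; 0≤c       = 0≤1
        ; 0≤G       = λ _ → 0≤1
        ; periodic  = Periodic-const k 1 1ℚ
        ; rough     = λ pr _ p∣1 → ℕ.nonTrivial⇒≢1 {{prime⇒nonTrivial pr}} (ℕ.∣1⇒≡1 p∣1)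
        ; small     = ℚ.≤-reflexive (trans (Box-const k 1 1ℚ) (trans (cong (_* 1ℚ) (1^ k)) (cong (1ℚ *_) (sym β-1))))
        ; supported = λ v _ 1∤ → contradiction (ℕ.1∣ (h v)) 1∤
        }

    X-1 : ∀ m → X m (λ _ → 1ℚ) ≡ Simp k N (sieve m)
    X-1 m = Simp-cong k N λ v _ → ℚ.*-identityˡ (sieve m v)

    M-1 : ∀ m → M m 1 (λ _ → 1ℚ) ≡ D * density m
    M-1 m = cong (_* density m) (trans (cong (D *_) (trans (cong₂ _*_ (trans (Box-const k 1 1ℚ) (cong (_* 1ℚ) (1^ k))) (1^ k)) refl))
      (ℚ.*-identityʳ D))

  A-sieve : ∀ k N D m → let n = N ℕ.+ k in n ℕ.< m → ⟦ A k n ⟧ ≡ Simp k N (Sieve.sieve n k N D m)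
  A-sieve k N D m n<m = trans (A-Simp k N) (Simp-cong k N λ v s<N → gcd-sieve (N ℕ.+ k) N D m v (ℕ.+-monoˡ-< k s<N) n<m)

  -- For k = 1 every point 0 < y ≤ n counts (at y = n the indicator vanishes),
  -- and n is a multiple of each relevant period, so no error arises.
  module Totient (n′ m : ℕ) (n<m : suc (suc n′) ℕ.< m) where

    private
      n = suc (suc n′)
      D = volume 1 n
    open Sieve n 1 n D
    open Local n

    private
      Sp : Vec ℕ 1 → Set
      Sp _ = ⊤
      h : Vec ℕ 1 → ℕ
      h _ = n
      one : ℕ → ℚ
      one _ = 1ℚ

      Simp-1 : ∀ N (G : Vec ℕ 1 → ℚ) → Simp 1 N G ≡ Σ[ z < N ] G (z ∷ [])
      Simp-1 N G = Σ-cong N λ z z<N → point (ℕ.m<n⇒0<n∸m z<N)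
        where
        point : ∀ {M} {F : Vec ℕ 0 → ℚ} → 0 ℕ.< M → Simp 0 M F ≡ F []
        point {suc M} _ = refl

      ρ≤ : ∀ q → Prime (suc q) → ρ q 1 ≤ 1ℚ * one (suc q)
      ρ≤ q _ = ≤-by (0≤Box 1 (suc q) λ v → 0≤* (0≤onto q 0 v) (0≤avoids q v)) (trans (ρ+U q 1) (V-suc q 0 0))

      -- From p ∣ y and y ≡ n modulo p it follows that p ∣ n.
      g-supported : ∀ q → Prime (suc q) → ∀ v → Sp v → suc q ∤ h v → g q v ≡ 0ℚ
      g-supported q pr (z ∷ []) _ p∤n = trans (cong (onto q 0 (z ∷ []) *_) (avoids-∣ n q (z ∷ []) pr)) (by (suc q ℕ.∣? suc z ℕ.* 1))
        where
        by : (d : Dec (suc q ∣ suc z ℕ.* 1)) → onto q 0 (z ∷ []) * 𝟙 d ≡ 0ℚ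
        by (no _)    = ℚ.*-zeroʳ (onto q 0 (z ∷ []))
        by (yes p∣z) = trans (cong (_* 1ℚ) (𝟙-no (suc z ℕ.% suc q ℕ.≟ n ℕ.% suc q) λ e → p∤n
          (ℕ.m%n≡0⇒n∣m n (suc q) (trans (sym e) (ℕ.n∣m⇒m%n≡0 (suc z) (suc q) (subst (suc q ∣_) (ℕ.*-identityʳ (suc z)) p∣z)))))) refl

      -- If d does not divide n, G vanishes identically and both sides are 0; if n = w d, the range
      -- consists of w full periods.
      exact : ∀ {c d G} → State Sp h one 0 c d G → Simp 1 n G ≡ D * (Box 1 d G * ι d ^ 1)
      exact {c} {d} {G} S with d ℕ.∣? n
      ... | no d∤n = trans (Simp-cong 1 n {G = λ _ → 0ℚ} λ v _ → State.supported S v tt d∤n) (trans (Simp-0 1 n)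
              (sym (trans (cong (λ b → D * (b * ι d ^ 1)) (trans (Box-cong 1 d {G = λ _ → 0ℚ} λ v → State.supported S v tt d∤n)
                  (trans (Box-const 1 d 0ℚ) (ℚ.*-zeroʳ (⟦ d ⟧ ^ 1)))))
                (trans (cong (D *_) (ℚ.*-zeroˡ (ι d ^ 1))) (ℚ.*-zeroʳ D)))))
      ... | yes (divides w n≡wd) = trans (Simp-1 n G)
              (trans (cong (λ t → Σ[ z < t ] G (z ∷ [])) n≡wd)
                (trans (Σ-blocks w d (λ z → G (z ∷ [])))
                  (trans (Σ-cong w λ a _ → Σ-cong d λ r _ → Per-multiple (proj₁ periodic []) a r)
                    (trans (Σ-const w (Box 1 d G))
                      (sym (trans (cong (λ t → t * 1ℚ * 1ℚ * (Box 1 d G * (ι d * 1ℚ))) (trans (cong ⟦_⟧ n≡wd) (sym (⟦*⟧ w d))))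
                        (trans (lemma ⟦ w ⟧ ⟦ d ⟧ (ι d) (Box 1 d G))
                          (trans (cong (λ t → ⟦ w ⟧ * t * Box 1 d G) (ι-inverse d {{d≢0}})) (cong (_* Box 1 d G) (ℚ.*-identityʳ ⟦ w ⟧))))))))))
        where
        open State S
        lemma : ∀ w d i b → w * d * 1ℚ * 1ℚ * (b * (i * 1ℚ)) ≡ w * (d * i) * b
        lemma = solve-∀ ring

      base : ∀ {c d G} → State Sp h one 0 c d G → ∣ Simp 1 n G - D * (Box 1 d G * ι d ^ 1) ∣ ≤ c * 0ℚ
      base {c} S = ℚ.≤-reflexive (trans (≡⇒∣-∣≡0 (exact S)) (sym (ℚ.*-zeroʳ c)))

      W-0 : ∀ j d → W 1ℚ j (λ _ → 0ℚ) d ≡ 0ℚ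
      W-0 zero    d = refl
      W-0 (suc j) d = trans (cong₂ (λ x y → x + 𝟙 (prime? j) * (1ℚ * y)) (W-0 j d) (W-0 j (j ℕ.* d)))
        (trans (ℚ.+-identityˡ _) (ℚ.*-zeroʳ (𝟙 (prime? j))))

      X≡M : X m (λ _ → 1ℚ) ≡ M m 1 (λ _ → 1ℚ)
      X≡M = ∣-∣≤0⇒≡ (X m (λ _ → 1ℚ)) (M m 1 (λ _ → 1ℚ)) err
        where
        err : ∣ X m (λ _ → 1ℚ) - M m 1 (λ _ → 1ℚ) ∣ ≤ 0ℚ
        err = ℚ.≤-trans
          (sieve-error Sp h one 1ℚ 0≤1 (λ _ → 0≤1) (λ _ _ → refl) ρ≤ g-supported (λ _ → 0ℚ) base m (initial 0 n n D Sp h one refl m))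
          (ℚ.≤-reflexive (trans (cong (1ℚ *_) (W-0 m 1)) refl))

      last-zero : sieve m (suc n′ ∷ []) ≡ 0ℚ
      last-zero with prime-divisor n (λ ())
      ... | zero  , pr , _ = contradiction pr ¬prime[0]
      ... | suc q , pr , p∣n = ∏-zero {m} {suc q} (ℕ.≤-<-trans (ℕ.∣⇒≤ p∣n) n<m) (cong₂ (λ a b → 1ℚ - a * b) (𝟙-yes (prime? (suc q)) pr)
              (cong₂ _*_ (𝟙-yes (n ℕ.% suc q ℕ.≟ n ℕ.% suc q) refl)
                (trans (avoids-∣ n q (suc n′ ∷ []) pr) (𝟙-yes (suc q ℕ.∣? n ℕ.* 1) (subst (suc q ∣_) (sym (ℕ.*-identityʳ n)) p∣n)))))

    A-totient : ⟦ A 1 n ⟧ ≡ main-term 1 n m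
    A-totient = begin
      ⟦ A 1 n ⟧                            ≡⟨ cong (λ t → ⟦ A 1 t ⟧) (sym (ℕ.+-comm (suc n′) 1)) ⟩
      ⟦ A 1 (suc n′ ℕ.+ 1) ⟧               ≡⟨ A-sieve 1 (suc n′) D m (subst (ℕ._< m) (sym (ℕ.+-comm (suc n′) 1)) n<m) ⟩
      Simp 1 (suc n′) (Sieve.sieve (suc n′ ℕ.+ 1) 1 (suc n′) D m)
        ≡⟨ cong (λ t → Simp 1 (suc n′) (Sieve.sieve t 1 (suc n′) D m)) (ℕ.+-comm (suc n′) 1) ⟩
      Simp 1 (suc n′) (sieve m)            ≡⟨ Simp-1 (suc n′) (sieve m) ⟩
      Σ[ z < suc n′ ] sieve m (z ∷ [])     ≡⟨ sym (trans (cong (S +_) last-zero) (ℚ.+-identityʳ S)) ⟩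
      Σ[ z < n ] sieve m (z ∷ [])          ≡⟨ sym (Simp-1 n (sieve m)) ⟩
      Simp 1 n (sieve m)                   ≡⟨ sym (X-1 0 n n D m) ⟩
      X m (λ _ → 1ℚ)                       ≡⟨ X≡M ⟩
      M m 1 (λ _ → 1ℚ)                     ≡⟨ M-1 0 n n D m ⟩
      D * density m                        ≡⟨ sym (main-term≡ 0 n n D m n<m) ⟩
      main-term 1 n m                      ∎
      where
      open ≡-Reasoning
      S = Σ[ z < suc n′ ] sieve m (z ∷ [])

  module General (i N m : ℕ) (n<m : N ℕ.+ suc (suc i) ℕ.< m) where

    private
      j = suc i
      k = suc j
      n = N ℕ.+ k
      D = volume k n
      instance
        n≢0 : ℕ.NonZero n
        n≢0 = ℕ.>-nonZero (ℕ.≤-trans (s≤s z≤n) (ℕ.m≤n+m k N))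
    open Sieve n k N D
    open Local n
    open Weight n

    K : ℚ
    K = ⟦ k ⟧ * ⟦ k ⟧ * (1ℚ + ⟦ k ⟧) ^ j

    private
      Sp : Vec ℕ k → Set
      Sp v = Vec.sum v ℕ.< N
      h : Vec ℕ k → ℕ
      h v = n ℕ.∸ (Vec.sum v ℕ.+ k)
      β : ℕ → ℚ
      β d = ⟦ d ⟧ ^ i
      c₀ = ⟦ n ⟧ ^ j * ι (k !)
      0≤c₀ : 0ℚ ≤ c₀
      0≤c₀ = 0≤* (0≤^ j (0≤⟦⟧ n)) (0≤ι (k !))
      0≤K : 0ℚ ≤ K
      0≤K = 0≤* (0≤* (0≤⟦⟧ k) (0≤⟦⟧ k)) (0≤^ j (0≤+ 0≤1 (0≤⟦⟧ k)))
      1≤K : 1ℚ ≤ K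
      1≤K = *-mono 0≤1 (*-mono 0≤1 (1≤⟦⟧ k) 0≤1 (1≤⟦⟧ k)) 0≤1
        (subst (_≤ (1ℚ + ⟦ k ⟧) ^ j) (1^ j) (^-mono j 0≤1 (p≤p+q 1ℚ (0≤⟦⟧ k))))
      E : ℕ → ℚ
      E d = K * c₀ * φ d

      g-supported : ∀ q → Prime (suc q) → ∀ v → Sp v → suc q ∤ h v → g q v ≡ 0ℚ
      g-supported q pr v s<N p∤x = trans (g-∣ n q v pr (ℕ.<⇒≤ (ℕ.+-monoˡ-< k s<N)))
        (trans (cong (_* P) (𝟙-no (suc q ℕ.∣? h v) p∤x)) (ℚ.*-zeroˡ P))
        where P = 𝟙 (suc q ℕ.∣? product (Vec.map suc v))

      module _ {c d G} (S : State Sp h β 0 c d G) where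
        open State S
        private
          instance
            _ = d≢0
          R = Box k d G
          x = ⟦ n ⟧ * ι d
          0≤x : 0ℚ ≤ x
          0≤x = 0≤* (0≤⟦⟧ n) (0≤ι d)
          0≤R : 0ℚ ≤ R
          0≤R = 0≤Box k d 0≤G

        β-ι : β d * ι d ^ i ≡ 1ℚ
        β-ι = ^-inverse d i

        -- Here x = n / d ≥ 1 gives x + k ≤ (1 + k) x, whence `K`. As R ≤ c d^(k-2), what remains is
        -- x^(k-1) d^(k-2) = n^(k-1) / d.
        base-small : d ℕ.≤ n → ∣ Simp k N G - D * (R * ι d ^ k) ∣ ≤ c * E d
        base-small d≤n = ℚ.≤-trans (ℚ.≤-reflexive (trans (cong ∣_∣ scale) (trans (ℚ.∣p*q∣≡∣p∣*∣q∣ (ι (k !)) Δ)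
              (cong (_* ∣ Δ ∣) (ℚ.0≤p⇒∣p∣≡p (0≤ι (k !)))))))
          (ℚ.≤-trans (*-monoˡ (0≤ι (k !)) error)
            (ℚ.≤-trans (*-monoˡ (0≤ι (k !)) (*-mono
                (0≤* (0≤* (0≤⟦⟧ k) (0≤⟦⟧ k)) (0≤^ j (0≤+ 0≤x (0≤⟦⟧ k))))
                (*-monoˡ (0≤* (0≤⟦⟧ k) (0≤⟦⟧ k)) (^-mono j (0≤+ 0≤x (0≤⟦⟧ k))
                  (≤-by (0≤* (0≤⟦⟧ k) (≤⇒0≤ 1≤x)) (lemma₁ x ⟦ k ⟧))))
                0≤R small))
              (ℚ.≤-reflexive (trans (cong (λ z → ι (k !) * (⟦ k ⟧ * ⟦ k ⟧ * z * (c * β d)))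
                  (trans (^-* (1ℚ + ⟦ k ⟧) x j) (cong ((1ℚ + ⟦ k ⟧) ^ j *_) (^-* ⟦ n ⟧ (ι d) j))))
                (trans (lemma₂ (ι (k !)) (⟦ k ⟧ * ⟦ k ⟧) ((1ℚ + ⟦ k ⟧) ^ j) (⟦ n ⟧ ^ j) (ι d) (ι d ^ i) c (β d))
                  (trans (cong (λ z → c * (K * c₀ * (ι d * z))) β-ι)
                    (cong (λ z → c * (K * c₀ * (ι d * z))) (sym (ℚ.p≤q⇒p⊓q≡p 1≤x)))))))))
          where
          Δ = ⟦ k ! ⟧ * Simp k N G - x ^ k * R
          lemma₁ : ∀ x k → x + k + k * (x - 1ℚ) ≡ (1ℚ + k) * x
          lemma₁ = solve-∀ ring
          lemma₂ : ∀ f kk p nj a ai c b → f * (kk * (p * (nj * (a * ai))) * (c * b)) ≡ c * (kk * p * (nj * f) * (a * (b * ai)))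
          lemma₂ = solve-∀ ring
          lemma₃ : ∀ f F s X R → f * F * s - X * f * R ≡ f * (F * s - X * R)
          lemma₃ = solve-∀ ring
          lemma₄ : ∀ nk f R a → nk * f * (R * a) ≡ nk * a * f * R
          lemma₄ = solve-∀ ring
          1≤x : 1ℚ ≤ x
          1≤x = subst (_≤ x) (ι-inverse d) (*-monoʳ (0≤ι d) (⟦⟧-mono d≤n))
          scale : Simp k N G - D * (R * ι d ^ k) ≡ ι (k !) * Δ
          scale = trans (cong₂ _-_
              (sym (trans (cong (_* Simp k N G) (trans (ℚ.*-comm (ι (k !)) ⟦ k ! ⟧) (ι-inverse (k !) {{k ℕ.!≢0}}))) (ℚ.*-identityˡ (Simp k N G))))
              (trans (lemma₄ (⟦ n ⟧ ^ k) (ι (k !)) R (ι d ^ k)) (cong (λ z → z * ι (k !) * R) (sym (^-* ⟦ n ⟧ (ι d) k)))))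
            (lemma₃ (ι (k !)) ⟦ k ! ⟧ (Simp k N G) (x ^ k) R)
          error : ∣ Δ ∣ ≤ ⟦ k ⟧ * ⟦ k ⟧ * (x + ⟦ k ⟧) ^ j * R
          error = by d periodic
            where
            by : ∀ d .{{_ : ℕ.NonZero d}} → Periodic k d G → ∣ ⟦ k ! ⟧ * Simp k N G - (⟦ n ⟧ * ι d) ^ k * Box k d G ∣
              ≤ ⟦ k ⟧ * ⟦ k ⟧ * (⟦ n ⟧ * ι d + ⟦ k ⟧) ^ j * Box k d G
            by (suc e) per = Simp-error j e N G per 0≤G

        -- The sum is 0, as 0 < n - Σ y < n ≤ d leaves no multiple of d. The main term alone is
        -- small: R / d^k ≤ c / d² turns it into at most c c₀ n / d².
        base-large : n ℕ.≤ d → ∣ Simp k N G - D * (R * ι d ^ k) ∣ ≤ c * E d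
        base-large n≤d = ℚ.≤-trans (ℚ.≤-reflexive (trans (cong (λ s → ∣ s - Y ∣) Simp≡0)
              (trans (cong ∣_∣ (ℚ.+-identityˡ (- Y))) (trans (ℚ.∣-p∣≡∣p∣ Y) (ℚ.0≤p⇒∣p∣≡p 0≤Y)))))
          (ℚ.≤-trans (*-monoˡ (0≤volume k n) (*-monoʳ (0≤^ k (0≤ι d)) small))
            (ℚ.≤-trans (ℚ.≤-reflexive (trans (lemma ⟦ n ⟧ (⟦ n ⟧ ^ j) (ι (k !)) c (β d) (ι d) (ι d ^ i))
                (cong₂ (λ z w → c * (1ℚ * c₀ * (ι d * (z * w)))) (sym (ℚ.p≥q⇒p⊓q≡q x≤1)) β-ι)))
              (*-monoˡ 0≤c (subst (λ z → 1ℚ * c₀ * (ι d * z) ≤ E d) (sym (ℚ.*-identityʳ _))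
                (*-monoʳ (0≤φ d) (*-monoʳ 0≤c₀ 1≤K))))))
          where
          Y = D * (R * ι d ^ k)
          0≤Y : 0ℚ ≤ Y
          0≤Y = 0≤* (0≤volume k n) (0≤* 0≤R (0≤^ k (0≤ι d)))
          x≤1 : x ≤ 1ℚ
          x≤1 = subst (x ≤_) (ι-inverse d) (*-monoʳ (0≤ι d) (⟦⟧-mono n≤d))
          Simp≡0 : Simp k N G ≡ 0ℚ
          Simp≡0 = trans (Simp-cong k N {G = λ _ → 0ℚ} λ v s<N → supported v s<N λ d∣x →
              ℕ.<⇒≱ (ℕ.<-≤-trans (ℕ.∸-monoʳ-< (ℕ.≤-trans (s≤s z≤n) (ℕ.m≤n+m k (Vec.sum v))) (ℕ.<⇒≤ (ℕ.+-monoˡ-< k s<N))) n≤d)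
                (ℕ.∣⇒≤ {{ℕ.≢-nonZero (ℕ.m>n⇒m∸n≢0 (ℕ.+-monoˡ-< k s<N))}} d∣x))
            (Simp-0 k N)
          lemma : ∀ n nj f c b a ai → n * nj * f * (c * b * (a * (a * ai))) ≡ c * (1ℚ * (nj * f) * (a * (n * a * (b * ai))))
          lemma = solve-∀ ring

        base : ∣ Simp k N G - D * (R * ι d ^ k) ∣ ≤ c * E d
        base with ℕ.≤-total d n
        ... | inj₁ d≤n = base-small d≤n
        ... | inj₂ n≤d = base-large n≤d

      X≡A : X m (λ _ → 1ℚ) ≡ ⟦ A k n ⟧
      X≡A = trans (X-1 j n N D m) (sym (A-sieve k N D m n<m))

      M≡main : M m 1 (λ _ → 1ℚ) ≡ main-term k n m
      M≡main = trans (M-1 j n N D m) (sym (main-term≡ j n N D m n<m))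

    A-error : ∣ ⟦ A k n ⟧ - main-term k n m ∣ ≤ K * B ^ k * (⟦ n ⟧ ^ j * ι (k !))
    A-error = subst₂ (λ a b → ∣ a - b ∣ ≤ K * B ^ k * c₀) X≡A M≡main (ℚ.≤-trans
      (sieve-error Sp h β ⟦ k ⟧ (0≤⟦⟧ k) (λ d → 0≤^ i (0≤⟦⟧ d))
        (λ a b → trans (cong (_^ i) (sym (⟦*⟧ a b))) (^-* ⟦ a ⟧ ⟦ b ⟧ i)) (λ q _ → ρ-bound q i) g-supported E base m
        (initial j n N D Sp h β (1^ i) m))
      (ℚ.≤-trans (ℚ.≤-reflexive (trans (ℚ.*-identityˡ _) (W-*φ ⟦ k ⟧ m (K * c₀) φ 1)))
        (ℚ.≤-trans (*-monoˡ (0≤* 0≤K 0≤c₀) (ℚ.≤-trans (Wφ-≤ k m 1) (*-monoˡ (0≤^ k 0≤B) φ1≤1)))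
          (ℚ.≤-reflexive (lemma K c₀ (B ^ k))))))
      where
      φ1≤1 : φ 1 ≤ 1ℚ
      φ1≤1 = ℚ.≤-trans (ℚ.≤-reflexive (ℚ.*-identityˡ _)) (ℚ.p⊓q≤p 1ℚ (⟦ n ⟧ * ι 1))
      lemma : ∀ K c B → K * c * (B * 1ℚ) ≡ K * B * c
      lemma = solve-∀ ring

    private
      0≤sieve : ∀ v → 0ℚ ≤ sieve m v × sieve m v ≤ 1ℚ
      0≤sieve v = bnd m
        where
        0≤gₚ : ∀ p → 0ℚ ≤ gₚ p v × gₚ p v ≤ 1ℚ
        0≤gₚ zero    = ℚ.≤-refl , 0≤1
        0≤gₚ (suc q) = 0≤g q v , g≤1 q v
        bnd : ∀ m → 0ℚ ≤ sieve m v × sieve m v ≤ 1ℚ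
        bnd zero    = 0≤1 , ℚ.≤-refl
        bnd (suc m) = let 0≤s , s≤1 = bnd m ; 0≤t , t≤1 = 0≤gₚ m ; 0≤u = ≤⇒0≤ (*-mono (0≤𝟙 (prime? m)) (𝟙≤1 (prime? m)) 0≤t t≤1)
          in 0≤* 0≤s 0≤u , *-mono 0≤s s≤1 0≤u (1-p≤1 (0≤* (0≤𝟙 (prime? m)) 0≤t))

    -- Both numbers lie between 0 and n^k / k!: the main term because the density is at most 1, the
    -- count because the simplex has at most that many points.
    A-trivial : ∣ ⟦ A k n ⟧ - main-term k n m ∣ ≤ volume k n
    A-trivial = ∣-∣≤ (ℚ.≤-trans A≤ (≤-by 0≤main (ℚ.+-comm (volume k n) (main-term k n m))))
        (ℚ.≤-trans main≤ (≤-by (0≤⟦⟧ (A k n)) (ℚ.+-comm (volume k n) ⟦ A k n ⟧)))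
      where
      open Density n j N D
      dens = density-bounds m
      0≤main : 0ℚ ≤ main-term k n m
      0≤main = subst (0ℚ ≤_) (sym (main-term≡ j n N D m n<m)) (0≤* (0≤volume k n) (proj₁ dens))
      main≤ : main-term k n m ≤ volume k n
      main≤ = subst (_≤ volume k n) (sym (main-term≡ j n N D m n<m))
        (subst (volume k n * density m ≤_) (ℚ.*-identityʳ _) (*-monoˡ (0≤volume k n) (proj₂ dens)))
      A≤ : ⟦ A k n ⟧ ≤ volume k n
      A≤ = subst (_≤ volume k n) (sym (A-sieve k N D m n<m)) (ℚ.≤-trans (Simp-mono k N λ v _ → proj₂ (0≤sieve v))
        (ℚ.≤-trans (ℚ.≤-reflexive (sym (trans (cong (_* T k N) (trans (ℚ.*-comm (ι (k !)) ⟦ k ! ⟧) (ι-inverse (k !) {{k ℕ.!≢0}}))) (ℚ.*-identityˡ _))))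
          (ℚ.≤-trans (ℚ.≤-reflexive (trans (ℚ.*-assoc (ι (k !)) ⟦ k ! ⟧ (T k N)) (ℚ.*-comm (ι (k !)) _)))
            (*-monoʳ (0≤ι (k !)) (ℚ.≤-trans (T-upper-suc j N) (^-mono k (0≤⟦⟧ (N ℕ.+ j)) (⟦⟧-mono (ℕ.+-monoʳ-≤ N (ℕ.n≤1+n j)))))))))

-- Explicit inequalities for the constants

module Numerics where

  open Rational
  open PrimeWeights using (module Weight)
  open ErrorTerm using (volume)
  open import Defs using (_//_; //-cong; 0≤*; 0≤+; 0<*; 0≤//; *-mono; ≤⇒0≤; harmonic; harmonic-lower; harmonic-split; log-approx)
  open import Data.Rational using (½; _+_; _*_; _-_; -_; _≤_)

  0≤square : ∀ p → 0ℚ ≤ p * p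
  0≤square p with ℚ.≤-total 0ℚ p
  ... | inj₁ 0≤p = 0≤* 0≤p 0≤p
  ... | inj₂ p≤0 = subst (0ℚ ≤_) (lemma p) (0≤* (ℚ.neg-antimono-≤ p≤0) (ℚ.neg-antimono-≤ p≤0))
    where
    lemma : ∀ p → (- p) * (- p) ≡ p * p
    lemma = solve-∀ ring

  -- (1 + 1 / m) ^ i ≤ 1 + i / m + (i / m)² for i ≤ m, cleared of denominators
  compound : ∀ m i → i ℕ.≤ m → let u = ⟦ m ⟧ in
    (1ℚ + u) ^ i * (u * u) ≤ (u * u + ⟦ i ⟧ * u + ⟦ i ⟧ * ⟦ i ⟧) * u ^ i
  compound m zero    _ = ℚ.≤-reflexive (lemma ⟦ m ⟧)
    where
    lemma : ∀ u → 1ℚ * (u * u) ≡ (u * u + 0ℚ * u + 0ℚ * 0ℚ) * 1ℚ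
    lemma = solve-∀ ring
  compound m (suc i) i<m = ℚ.≤-trans
    (ℚ.≤-trans (ℚ.≤-reflexive (ℚ.*-assoc (1ℚ + u) ((1ℚ + u) ^ i) (u * u)))
      (*-monoˡ (0≤+ 0≤1 (0≤⟦⟧ m)) (compound m i (ℕ.<⇒≤ i<m))))
    (≤-by (0≤* (0≤+ (0≤* (0≤⟦⟧ i) (≤⇒0≤ (⟦⟧-mono (ℕ.<⇒≤ i<m)))) (0≤⟦⟧ m)) (0≤^ i (0≤⟦⟧ m)))
      (trans (lemma u ⟦ i ⟧ (u ^ i)) (cong (λ t → (u * u + t * u + t * t) * u ^ suc i) (sym (⟦suc⟧ i)))))
    where
    u = ⟦ m ⟧
    lemma : ∀ u i U → (1ℚ + u) * ((u * u + i * u + i * i) * U) + (i * (u - i) + u) * U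
      ≡ (u * u + (1ℚ + i) * u + (1ℚ + i) * (1ℚ + i)) * (u * U)
    lemma = solve-∀ ring

  compound≤3 : ∀ m .{{_ : ℕ.NonZero m}} → ⟦ suc m ⟧ ^ m ≤ ⟦ 3 ⟧ * ⟦ m ⟧ ^ m
  compound≤3 m = ℚ.*-cancelʳ-≤-pos (u * u) {{ℚ.positive (0<* (0<⟦⟧ m) (0<⟦⟧ m))}}
    (subst₂ _≤_ (cong (λ t → t ^ m * (u * u)) (sym (⟦suc⟧ m))) (lemma u (u ^ m)) (compound m m ℕ.≤-refl))
    where
    u = ⟦ m ⟧
    lemma : ∀ u U → (u * u + u * u + u * u) * U ≡ ⟦ 3 ⟧ * U * (u * u)
    lemma = solve-∀ ring

  -- Equality at k = 2. Passing to k + 1 multiplies the right side by 3 (k + 1) and the left side,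
  -- by `compound≤3`, by at most that.
  factorial-lower : ∀ i → let k = suc (suc i) in ⟦ 2 ⟧ * ⟦ suc k ⟧ ^ k ≤ ⟦ 3 ⟧ ^ k * ⟦ k ! ⟧
  factorial-lower zero    = ℚ.≤-refl
  factorial-lower (suc i) = ℚ.≤-trans
    (*-monoˡ (0≤⟦⟧ 2) (compound≤3 (suc k)))
    (ℚ.≤-trans (ℚ.≤-reflexive (lemma₁ ⟦ suc k ⟧ (⟦ suc k ⟧ ^ k)))
      (ℚ.≤-trans (*-monoˡ (0≤* (0≤⟦⟧ 3) (0≤⟦⟧ (suc k))) (factorial-lower i))
        (ℚ.≤-reflexive (trans (lemma₂ ⟦ suc k ⟧ (⟦ 3 ⟧ ^ k) ⟦ k ! ⟧) (cong (⟦ 3 ⟧ ^ suc k *_) (⟦*⟧ (suc k) (k !)))))))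
    where
    k = suc (suc i)
    lemma₁ : ∀ u U → ⟦ 2 ⟧ * (⟦ 3 ⟧ * (u * U)) ≡ ⟦ 3 ⟧ * u * (⟦ 2 ⟧ * U)
    lemma₁ = solve-∀ ring
    lemma₂ : ∀ u T f → ⟦ 3 ⟧ * u * (T * f) ≡ ⟦ 3 ⟧ * T * (u * f)
    lemma₂ = solve-∀ ring

  -- k² alone outgrows the factor 3 / 2 for small k, so the induction needs lower terms. For this
  -- quadratic, 3 / 2 times its value exceeds the next value by (k - 5/4)² + 7/16, and k = 0 gives
  -- equality.
  quadratic≤exponential : ∀ k → ⟦ 2 ⟧ * (⟦ k ⟧ * ⟦ k ⟧) + ⟦ 3 ⟧ * ⟦ k ⟧ + ⟦ 14 ⟧ ≤ ⟦ 14 ⟧ * (3 // 2) ^ k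
  quadratic≤exponential zero    = ℚ.≤-refl
  quadratic≤exponential (suc k) = ℚ.≤-trans
    (≤-by (0≤+ (0≤square (⟦ k ⟧ - 5 // 4)) (0≤// 7 16))
      (trans (cong (λ t → ⟦ 2 ⟧ * (t * t) + ⟦ 3 ⟧ * t + ⟦ 14 ⟧ + ((⟦ k ⟧ - 5 // 4) * (⟦ k ⟧ - 5 // 4) + 7 // 16)) (⟦suc⟧ k)) (lemma ⟦ k ⟧)))
    (ℚ.≤-trans (*-monoˡ (0≤// 3 2) (quadratic≤exponential k)) (ℚ.≤-reflexive (lemma′ ((3 // 2) ^ k))))
    where
    lemma : ∀ k → ⟦ 2 ⟧ * ((1ℚ + k) * (1ℚ + k)) + ⟦ 3 ⟧ * (1ℚ + k) + ⟦ 14 ⟧ + ((k - 5 // 4) * (k - 5 // 4) + 7 // 16)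
      ≡ 3 // 2 * (⟦ 2 ⟧ * (k * k) + ⟦ 3 ⟧ * k + ⟦ 14 ⟧)
    lemma = solve-∀ ring
    lemma′ : ∀ t → 3 // 2 * (⟦ 14 ⟧ * t) ≡ ⟦ 14 ⟧ * (3 // 2 * t)
    lemma′ = solve-∀ ring

  square≤exponential : ∀ k → ⟦ k ⟧ * ⟦ k ⟧ ≤ ⟦ 7 ⟧ * (3 // 2) ^ k
  square≤exponential k = ℚ.*-cancelˡ-≤-pos ⟦ 2 ⟧ (ℚ.≤-trans
    (≤-by (0≤+ (0≤* (0≤⟦⟧ 3) (0≤⟦⟧ k)) (0≤⟦⟧ 14)) (sym (ℚ.+-assoc (⟦ 2 ⟧ * (⟦ k ⟧ * ⟦ k ⟧)) (⟦ 3 ⟧ * ⟦ k ⟧) ⟦ 14 ⟧)))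
    (ℚ.≤-trans (quadratic≤exponential k) (ℚ.≤-reflexive (lemma ((3 // 2) ^ k)))))
    where
    lemma : ∀ t → ⟦ 14 ⟧ * t ≡ ⟦ 2 ⟧ * (⟦ 7 ⟧ * t)
    lemma = solve-∀ ring

  ℓ : ℕ → ℚ
  ℓ n = harmonic 1 (n ℕ.∸ 1)

  0≤harmonic : ∀ a j → 0ℚ ≤ harmonic a j
  0≤harmonic a j = 0≤Σ j λ i _ → 0≤// 1 (suc (a ℕ.+ i))

  harmonic-mono : ∀ {i j} → i ℕ.≤ j → harmonic 1 i ≤ harmonic 1 j
  harmonic-mono i≤j = Σ-extend _ i≤j λ i → 0≤// 1 (suc (1 ℕ.+ i))

  -- Refining a right Riemann sum of the decreasing function 1 / t only increases it: on the
  -- interval ending at w + 2 each of the M terms is at least 1 / ((w + 2) M).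
  ℓ≤log-approx : ∀ n m → ℓ n ≤ log-approx n m
  ℓ≤log-approx n m = ℚ.≤-trans
    (Σ-mono (n ℕ.∸ 1) λ w _ → ℚ.≤-trans (ℚ.≤-reflexive (sym (trans (Σ-const M (ι ((2 ℕ.+ w) ℕ.* M))) (mean w))))
      (Σ-mono M λ r r<M → ι-antimono (bnd w r r<M)))
    (ℚ.≤-reflexive (sym (Σ-blocks (n ℕ.∸ 1) M (λ i → ι (suc (M ℕ.+ i))))))
    where
    M = suc m
    mean : ∀ w → ⟦ M ⟧ * ι ((2 ℕ.+ w) ℕ.* M) ≡ ι (2 ℕ.+ w)
    mean w = trans (cong (⟦ M ⟧ *_) (ι-* (2 ℕ.+ w) M)) (trans (lemma ⟦ M ⟧ (ι (2 ℕ.+ w)) (ι M))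
      (trans (cong (_* ι (2 ℕ.+ w)) (ι-inverse M)) (ℚ.*-identityˡ _)))
      where
      lemma : ∀ m w i → m * (w * i) ≡ m * i * w
      lemma = solve-∀ ring
    bnd : ∀ w r → r ℕ.< M → suc (M ℕ.+ (w ℕ.* M ℕ.+ r)) ℕ.≤ (2 ℕ.+ w) ℕ.* M
    bnd w r r<M = ℕ.≤-trans (ℕ.≤-reflexive (lemma M (w ℕ.* M) r))
      (ℕ.≤-trans (ℕ.+-monoʳ-≤ (M ℕ.+ w ℕ.* M) r<M) (ℕ.≤-reflexive (lemma′ M w)))
      where
      lemma : ∀ M a r → 1 ℕ.+ (M ℕ.+ (a ℕ.+ r)) ≡ M ℕ.+ a ℕ.+ (1 ℕ.+ r)
      lemma = ℕ-solve-∀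
      lemma′ : ∀ M w → M ℕ.+ w ℕ.* M ℕ.+ M ≡ (2 ℕ.+ w) ℕ.* M
      lemma′ = ℕ-solve-∀

  mersenne : ℕ → ℕ
  mersenne zero    = 0
  mersenne (suc r) = mersenne r ℕ.+ suc (mersenne r)

  -- Oresme's argument: the 2^r reciprocals from 2^r + 1 to 2^(r+1) are each at least 1 / 2^(r+1),
  -- so every dyadic block adds at least 1 / 2.
  harmonic-dyadic : ∀ r → ⟦ r ⟧ * ½ ≤ harmonic 1 (mersenne r)
  harmonic-dyadic zero    = ℚ.≤-refl
  harmonic-dyadic (suc r) = subst₂ _≤_
    (trans (cong (⟦ r ⟧ * ½ +_) half) (trans (lemma ⟦ r ⟧) (cong (_* ½) (sym (⟦suc⟧ r)))))
    (sym (harmonic-split 1 s (suc s)))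
    (ℚ.+-mono-≤ (harmonic-dyadic r) (harmonic-lower (suc s) (suc s) (suc s ℕ.+ suc s) ℕ.≤-refl))
    where
    s = mersenne r
    lemma : ∀ r → r * ½ + ½ ≡ (1ℚ + r) * ½
    lemma = solve-∀ ring
    half : suc s // (suc s ℕ.+ suc s) ≡ ½
    half = //-cong (suc s) 1 (suc s ℕ.+ suc s) 2 (eq (suc s))
      where
      eq : ∀ s → s ℕ.* 2 ≡ 1 ℕ.* (s ℕ.+ s)
      eq = ℕ-solve-∀

  ℓ-dyadic : ∀ r n → suc (mersenne r) ℕ.≤ n → ⟦ r ⟧ * ½ ≤ ℓ n
  ℓ-dyadic r n h = ℚ.≤-trans (harmonic-dyadic r) (harmonic-mono (ℕ.∸-monoˡ-≤ 1 h))

  ℓ≥13/12 : ∀ n → 4 ℕ.≤ n → 13 // 12 ≤ ℓ n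
  ℓ≥13/12 n h = harmonic-mono {3} (ℕ.∸-monoˡ-≤ 1 h)

  -- A lower bound for e² log n, with 64 / 9 = (8 / 3)².
  y : ℕ → ℚ
  y n = 64 // 9 * ℓ n

  -- A rational lower bound for the right-hand side, from e ≥ 8 / 3,
  -- √ (2 π k) ≤ √ (8 k) ≤ k + 2 and log n ≥ H n - 1 = ℓ n.
  bound : ℕ → ℕ → ℚ
  bound k n = 14 // 3 * ι (2 ℕ.+ k) * y n ^ k * ⟦ n ℕ.^ (k ℕ.∸ 1) ⟧

  square-bound : ∀ n b c → 0ℚ ≤ c → c ≤ ℓ n → n ℕ.≤ b → {_ : True (⟦ b ⟧ ℚ.≤? 7 // 3 * ((64 // 9 * c) * (64 // 9 * c)))} →
    ⟦ n ⟧ ≤ 7 // 3 * (y n * y n)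
  square-bound n b c 0≤c c≤ℓ n≤b {t} = ℚ.≤-trans (⟦⟧-mono n≤b) (ℚ.≤-trans (toWitness t) (*-monoˡ (0≤// 7 3) (*-mono 0≤d d≤ 0≤d d≤)))
    where
    0≤d = 0≤* (0≤// 64 9) 0≤c
    d≤ = *-monoˡ (0≤// 64 9) c≤ℓ

  -- The right side is only of order log² n, so this is confined to a bounded range. On each of
  -- three subranges the right endpoint is compared with a lower bound of ℓ at the left endpoint:
  -- 1/2 + 1/3 + 1/4 at 4, then r / 2 at 2^r for r = 7 and r = 10.
  small-n : ∀ n → 4 ℕ.≤ n → n ℕ.< 2048 → ⟦ n ⟧ ≤ 7 // 3 * (y n * y n)
  small-n n 4≤n n<2048 with n ℕ.<? 128 | n ℕ.<? 1024
  ... | yes n<128 | _          = square-bound n 128 (13 // 12) (0≤// 13 12) (ℓ≥13/12 n 4≤n) (ℕ.<⇒≤ n<128)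
  ... | no n≮128  | yes n<1024 = square-bound n 1024 (⟦ 7 ⟧ * ½) (0≤// 7 2) (ℓ-dyadic 7 n (ℕ.≮⇒≥ n≮128)) (ℕ.<⇒≤ n<1024)
  ... | no _      | no n≮1024  = square-bound n 2048 (⟦ 10 ⟧ * ½) (0≤// 10 2) (ℓ-dyadic 10 n (ℕ.≮⇒≥ n≮1024)) (ℕ.<⇒≤ n<2048)

  -- The right side equals x² / 2 at k = 2 and does not decrease with k: successive values have the
  -- ratio x (k + 1) (k + 2) / (k + 3) ≥ 1.
  factorial-growth : ∀ {x} → 1ℚ ≤ x → ∀ i → let k = suc (suc i) in ½ * (x * x) ≤ ⟦ k ! ⟧ * ι (2 ℕ.+ k) * x ^ k
  factorial-growth {x} 1≤x zero    = ℚ.≤-reflexive (cong (½ *_) (cong (x *_) (sym (ℚ.*-identityʳ x))))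
  factorial-growth {x} 1≤x (suc i) = ℚ.≤-trans (factorial-growth 1≤x i)
    (ℚ.≤-trans (ℚ.≤-reflexive (lemma₁ ⟦ k ! ⟧ (ι (2 ℕ.+ k)) (x ^ k)))
      (ℚ.≤-trans (*-mono (0≤* 0≤1 0≤c) (*-mono 0≤1 1≤x 0≤c ι≤) 0≤F ℚ.≤-refl)
        (ℚ.≤-reflexive (trans (lemma₂ x ⟦ suc k ⟧ (ι (3 ℕ.+ k)) ⟦ k ! ⟧ (x ^ k))
          (cong (λ t → t * ι (3 ℕ.+ k) * x ^ suc k) (⟦*⟧ (suc k) (k !)))))))
    where
    k = suc (suc i)
    0≤x = ℚ.≤-trans 0≤1 1≤x
    0≤c = 0≤ι (2 ℕ.+ k)
    0≤F = 0≤* (0≤⟦⟧ (k !)) (0≤^ k 0≤x)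
    lemma₁ : ∀ f a X → f * a * X ≡ 1ℚ * a * (f * X)
    lemma₁ = solve-∀ ring
    lemma₂ : ∀ x u b f X → x * (u * b) * (f * X) ≡ u * f * b * (x * X)
    lemma₂ = solve-∀ ring
    lemma₃ : ∀ a s t b → a * (s * t * b) ≡ t * a * (s * b)
    lemma₃ = solve-∀ ring
    lemma₄ : ∀ i → 1 ℕ.+ (4 ℕ.+ i) ℕ.+ (7 ℕ.+ (6 ℕ.* i ℕ.+ i ℕ.* i)) ≡ (3 ℕ.+ i) ℕ.* (4 ℕ.+ i)
    lemma₄ = ℕ-solve-∀
    ι≤ : ι (2 ℕ.+ k) ≤ ⟦ suc k ⟧ * ι (3 ℕ.+ k)
    ι≤ = ℚ.≤-trans (ℚ.≤-reflexive (sym (trans (cong (ι (2 ℕ.+ k) *_) (ι-inverse (3 ℕ.+ k))) (ℚ.*-identityʳ _))))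
      (ℚ.≤-trans (*-monoˡ 0≤c (*-monoʳ (0≤ι (3 ℕ.+ k)) (⟦⟧-mono {3 ℕ.+ k} {suc k ℕ.* (2 ℕ.+ k)}
          (ℕ.≤-trans (ℕ.m≤m+n _ (7 ℕ.+ (6 ℕ.* i ℕ.+ i ℕ.* i))) (ℕ.≤-reflexive (lemma₄ i))))))
        (ℚ.≤-reflexive (trans (cong (λ t → ι (2 ℕ.+ k) * (t * ι (3 ℕ.+ k))) (sym (⟦*⟧ (suc k) (2 ℕ.+ k))))
          (trans (lemma₃ (ι (2 ℕ.+ k)) ⟦ suc k ⟧ ⟦ 2 ℕ.+ k ⟧ (ι (3 ℕ.+ k)))
            (trans (cong (_* (⟦ suc k ⟧ * ι (3 ℕ.+ k))) (ι-inverse (2 ℕ.+ k))) (ℚ.*-identityˡ _))))))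

  -- Cancelling n^(k-1) / k! leaves n ≤ (14 / 3) k! y^k / (k + 2), which `factorial-growth` reduces
  -- to the inequality n ≤ (7 / 3) y², free of k.
  volume≤bound : ∀ i n → let k = suc (suc i) in 4 ℕ.≤ n → n ℕ.< 2048 → volume k n ≤ bound k n
  volume≤bound i n 4≤n n<2048 = ℚ.≤-trans (ℚ.≤-reflexive (ℚ.*-assoc ⟦ n ⟧ (⟦ n ⟧ ^ j) (ι (k !))))
    (ℚ.≤-trans (*-monoʳ (0≤* (0≤^ j (0≤⟦⟧ n)) (0≤ι (k !)))
        (ℚ.≤-trans (small-n n 4≤n n<2048)
          (ℚ.≤-trans (ℚ.≤-reflexive (lemma₁ (y n * y n))) (*-monoˡ (0≤// 14 3) (factorial-growth 1≤y i)))))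
      (ℚ.≤-reflexive (trans (lemma₂ ⟦ k ! ⟧ (ι (2 ℕ.+ k)) (y n ^ k) (⟦ n ⟧ ^ j) (ι (k !)))
        (trans (cong (_* (14 // 3 * ι (2 ℕ.+ k) * y n ^ k * ⟦ n ⟧ ^ j)) (ι-inverse (k !) {{k ℕ.!≢0}}))
          (trans (ℚ.*-identityˡ _) (cong (14 // 3 * ι (2 ℕ.+ k) * y n ^ k *_) (⟦^⟧ n j)))))))
    where
    j = suc i
    k = suc j
    1≤y : 1ℚ ≤ y n
    1≤y = ℚ.≤-trans (from-yes (1ℚ ℚ.≤? 64 // 9 * 13 // 12)) (*-monoˡ (0≤// 64 9) (ℓ≥13/12 n 4≤n))
    lemma₁ : ∀ s → 7 // 3 * s ≡ 14 // 3 * (½ * s)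
    lemma₁ = solve-∀ ring
    lemma₂ : ∀ F a Y N f → 14 // 3 * (F * a * Y) * (N * f) ≡ F * f * (14 // 3 * a * Y * N)
    lemma₂ = solve-∀ ring

  -- Multiply by k + 2 ≤ (4 / 3) (k + 1). Then (k + 1)^k / k! ≤ 3^k / 2 and k² ≤ 7 (3 / 2)^k give
  -- the constant 4/3 · 7 · 1/2 = 14/3 and the base 3 · 3/2 = 9/2.
  constant≤ : ∀ i → let k = suc (suc i) in
    ⟦ k ⟧ * ⟦ k ⟧ * (1ℚ + ⟦ k ⟧) ^ suc i * ι (k !) ≤ 14 // 3 * ι (2 ℕ.+ k) * (9 // 2) ^ k
  constant≤ i = ℚ.≤-trans (ℚ.≤-reflexive (sym (trans (cong (_* (κ * κ * P * φ)) (trans (ℚ.*-comm a ⟦ 2 ℕ.+ k ⟧) (ι-inverse (2 ℕ.+ k)))) (ℚ.*-identityˡ _))))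
    (ℚ.≤-trans (ℚ.≤-reflexive (ℚ.*-assoc a ⟦ 2 ℕ.+ k ⟧ (κ * κ * P * φ)))
      (ℚ.≤-trans (*-monoˡ (0≤ι (2 ℕ.+ k)) main)
        (ℚ.≤-reflexive (lemma₄ a ((9 // 2) ^ k)))))
    where
    k = suc (suc i)
    κ = ⟦ k ⟧
    P = (1ℚ + κ) ^ suc i
    φ = ι (k !)
    a = ι (2 ℕ.+ k)
    0≤κ = 0≤⟦⟧ k
    0≤P = 0≤^ (suc i) (0≤+ 0≤1 0≤κ)
    lemma₀ : ∀ t → 1ℚ + (1ℚ + t) + 1 // 3 * (t - ⟦ 2 ⟧) ≡ 4 // 3 * (1ℚ + t)
    lemma₀ = solve-∀ ring
    k+2≤ : ⟦ 2 ℕ.+ k ⟧ ≤ 4 // 3 * (1ℚ + κ)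
    k+2≤ = ≤-by (0≤* (0≤// 1 3) (≤⇒0≤ (⟦⟧-mono {2} {k} (s≤s (s≤s z≤n)))))
      (trans (cong (_+ 1 // 3 * (κ - ⟦ 2 ⟧)) (trans (⟦suc⟧ (suc k)) (cong (1ℚ +_) (⟦suc⟧ k)))) (lemma₀ κ))
    lemma₁ : ∀ t P f → 4 // 3 * (1ℚ + t) * (t * t * P * f) ≡ 2 // 3 * (t * t) * (⟦ 2 ⟧ * ((1ℚ + t) * P) * f)
    lemma₁ = solve-∀ ring
    2P≤ : ⟦ 2 ⟧ * ((1ℚ + κ) * P) * φ ≤ ⟦ 3 ⟧ ^ k
    2P≤ = subst₂ _≤_ (cong (λ t → ⟦ 2 ⟧ * t ^ k * φ) (⟦suc⟧ k))
      (trans (ℚ.*-assoc (⟦ 3 ⟧ ^ k) ⟦ k ! ⟧ φ) (trans (cong (⟦ 3 ⟧ ^ k *_) (ι-inverse (k !) {{k ℕ.!≢0}})) (ℚ.*-identityʳ _)))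
      (*-monoʳ (0≤ι (k !)) (factorial-lower i))
    lemma₂ : ∀ q s → 2 // 3 * (⟦ 7 ⟧ * q) * s ≡ 14 // 3 * (q * s)
    lemma₂ = solve-∀ ring
    main : ⟦ 2 ℕ.+ k ⟧ * (κ * κ * P * φ) ≤ 14 // 3 * (9 // 2) ^ k
    main = ℚ.≤-trans (*-monoʳ (0≤* (0≤* (0≤* 0≤κ 0≤κ) 0≤P) (0≤ι (k !))) k+2≤)
      (ℚ.≤-trans (ℚ.≤-reflexive (lemma₁ κ P φ))
        (ℚ.≤-trans (*-mono (0≤* (0≤// 2 3) (0≤* 0≤κ 0≤κ)) (*-monoˡ (0≤// 2 3) (square≤exponential k))
            (0≤* (0≤* (0≤⟦⟧ 2) (0≤* (0≤+ 0≤1 0≤κ) 0≤P)) (0≤ι (k !))) 2P≤)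
          (ℚ.≤-reflexive (trans (lemma₂ ((3 // 2) ^ k) (⟦ 3 ⟧ ^ k)) (cong (14 // 3 *_) (sym (^-* (3 // 2) ⟦ 3 ⟧ k)))))))
    lemma₄ : ∀ a s → a * (14 // 3 * s) ≡ 14 // 3 * a * s
    lemma₄ = solve-∀ ring

  B≡ : ∀ n .{{_ : ℕ.NonZero n}} → Weight.B n ≡ ⟦ 3 ⟧ + ℓ n
  B≡ (suc n) = trans (cong (_+ ⟦ 2 ⟧) (Σ-head n (λ i → ι (suc i)))) (lemma (ℓ (suc n)))
    where
    lemma : ∀ l → 1ℚ + l + ⟦ 2 ⟧ ≡ ⟦ 3 ⟧ + l
    lemma = solve-∀ ring

  error≤bound : ∀ i n → let k = suc (suc i) in 2048 ℕ.≤ n →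
    ⟦ k ⟧ * ⟦ k ⟧ * (1ℚ + ⟦ k ⟧) ^ suc i * Weight.B n ^ k * (⟦ n ⟧ ^ suc i * ι (k !)) ≤ bound k n
  error≤bound i n 2048≤n = ℚ.≤-trans
    (ℚ.≤-reflexive (lemma₁ (⟦ k ⟧ * ⟦ k ⟧ * (1ℚ + ⟦ k ⟧) ^ j) (Weight.B n ^ k) (⟦ n ⟧ ^ j) (ι (k !))))
    (ℚ.≤-trans (*-monoʳ (0≤^ j (0≤⟦⟧ n))
        (*-mono (0≤* (0≤* (0≤* (0≤⟦⟧ k) (0≤⟦⟧ k)) (0≤^ j (0≤+ 0≤1 (0≤⟦⟧ k)))) (0≤ι (k !))) (constant≤ i)
          (0≤^ k (Weight.0≤B n)) (^-mono k (Weight.0≤B n) B≤)))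
      (ℚ.≤-reflexive (cong₂ _*_ (trans (ℚ.*-assoc (14 // 3 * ι (2 ℕ.+ k)) ((9 // 2) ^ k) ((128 // 81 * ℓ n) ^ k))
          (cong (14 // 3 * ι (2 ℕ.+ k) *_) (trans (sym (^-* (9 // 2) (128 // 81 * ℓ n) k)) (cong (_^ k) (lemma₃ (ℓ n))))))
        (⟦^⟧ n j))))
    where
    j = suc i
    k = suc j
    instance
      n≢0 : ℕ.NonZero n
      n≢0 = ℕ.>-nonZero (ℕ.≤-trans (s≤s z≤n) 2048≤n)
    lemma₁ : ∀ K B N f → K * B * (N * f) ≡ K * f * B * N
    lemma₁ = solve-∀ ring
    lemma₂ : ∀ l → ⟦ 3 ⟧ + l + (47 // 81 * (l - ⟦ 11 ⟧ * ½) + 31 // 162) ≡ 128 // 81 * l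
    lemma₂ = solve-∀ ring
    lemma₃ : ∀ l → 9 // 2 * (128 // 81 * l) ≡ 64 // 9 * l
    lemma₃ = solve-∀ ring
    -- 128 / 81 is the quotient of 64 / 9 by 9 / 2, all that `constant≤` leaves for B. As B = 3 + ℓ,
    -- this needs ℓ ≥ 243 / 47; the dyadic bound 11 / 2 at 2048 = 2^11 suffices, whereas 10 / 2
    -- would not.
    B≤ : Weight.B n ≤ 128 // 81 * ℓ n
    B≤ = subst (_≤ 128 // 81 * ℓ n) (sym (B≡ n))
      (≤-by (0≤+ (0≤* (0≤// 47 81) (≤⇒0≤ (ℓ-dyadic 11 n 2048≤n))) (0≤// 31 162)) (lemma₂ (ℓ n)))

-- Comparison with the approximations of the real right-hand side

module Approximations where

  open Rational
  open ErrorTerm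
  open Numerics
  open import Defs using (approx; _//_; 0≤*; 0≤+; 0≤//; *-mono; e-approx; log-approx; wallis; 1≤wallis; wallis≤2; √approx; √approx-lower; √approx-upper; 0≤√approx; sq-cancel-≤; recip; recip-inverse; A)
  import Defs
  open import Data.Rational using (_+_; _*_; _-_; _≤_; _<_; ∣_∣)

  approx-^ : ∀ x k m → approx (x Defs.^ k) m ≡ approx x m ^ k
  approx-^ x zero    m = refl
  approx-^ x (suc k) m = cong (approx x m *_) (approx-^ x k m)

  8/3≤e : ∀ m → 8 // 3 ≤ e-approx (4 ℕ.+ m)
  8/3≤e zero    = ℚ.≤-refl
  8/3≤e (suc m) = ℚ.≤-trans (8/3≤e m) (p≤p+q _ (0≤// 1 ((4 ℕ.+ m) !) {{(4 ℕ.+ m) ℕ.!≢0}}))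

  2πk : ℕ → ℕ → ℚ
  2πk k m = ⟦ 2 ⟧ * (⟦ 2 ⟧ * wallis m) * ⟦ k ⟧

  module _ (k m : ℕ) .{{_ : ℕ.NonZero k}} where

    private
      q = 2πk k m
      r = √approx (suc m) q
      0≤r = 0≤√approx m q

    4≤2πk : ⟦ 4 ⟧ ≤ q
    4≤2πk = ℚ.≤-trans (ℚ.≤-reflexive four)
      (*-mono (0≤⟦⟧ 4) (*-monoˡ (0≤⟦⟧ 2) (*-monoˡ (0≤⟦⟧ 2) (1≤wallis m))) 0≤1 (1≤⟦⟧ k))
      where
      four : ⟦ 4 ⟧ ≡ ⟦ 2 ⟧ * (⟦ 2 ⟧ * 1ℚ) * 1ℚ
      four = refl

    0≤2πk : 0ℚ ≤ q
    0≤2πk = ℚ.≤-trans (0≤⟦⟧ 4) 4≤2πk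

    √≤k+2 : r ≤ ⟦ 2 ℕ.+ k ⟧
    √≤k+2 = sq-cancel-≤ 0≤r (0≤⟦⟧ (2 ℕ.+ k)) (ℚ.≤-trans (√approx-lower m q 0≤2πk)
      (ℚ.≤-trans (*-monoʳ (0≤⟦⟧ k) (*-monoˡ (0≤⟦⟧ 2) (*-monoˡ (0≤⟦⟧ 2) (wallis≤2 m))))
        (≤-by (0≤square (⟦ k ⟧ - ⟦ 2 ⟧)) (trans (lemma ⟦ k ⟧) (cong (λ t → t * t) (⟦+⟧ 2 k))))))
      where
      lemma : ∀ k → ⟦ 2 ⟧ * (⟦ 2 ⟧ * ⟦ 2 ⟧) * k + (k - ⟦ 2 ⟧) * (k - ⟦ 2 ⟧) ≡ (⟦ 2 ⟧ + k) * (⟦ 2 ⟧ + k)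
      lemma = solve-∀ ring

    -- Each single approximation must be positive, so that `recip` avoids its default value at 0. If
    -- r ≤ 0, then q ≤ (r + 1 / (m + 1))² ≤ 1, against 4 ≤ q.
    0<√ : 0ℚ < r
    0<√ = ℚ.≰⇒> λ r≤0 → let s≤1 = ℚ.+-mono-≤ r≤0 1//≤1 in
      ℚ.<-irrefl refl (ℚ.<-≤-trans 1<4 (ℚ.≤-trans 4≤2πk (ℚ.≤-trans (√approx-upper m q 0≤2πk) (*-mono 0≤s s≤1 0≤s s≤1))))
      where
      1<4 : (0ℚ + 1ℚ) * (0ℚ + 1ℚ) < ⟦ 4 ⟧
      1<4 = from-yes ((0ℚ + 1ℚ) * (0ℚ + 1ℚ) ℚ.<? ⟦ 4 ⟧)
      0≤s : 0ℚ ≤ r + 1 // suc m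
      0≤s = 0≤+ 0≤r (0≤// 1 (suc m))
      1//≤1 : 1 // suc m ≤ 1ℚ
      1//≤1 = ι-antimono {1} {suc m} (s≤s z≤n)

    ι≤recip : ι (2 ℕ.+ k) ≤ recip r
    ι≤recip = ℚ.≤-trans (ℚ.≤-reflexive (sym (trans (cong (ι (2 ℕ.+ k) *_) (recip-inverse 0<√)) (ℚ.*-identityʳ _))))
      (ℚ.≤-trans (*-monoˡ (0≤ι (2 ℕ.+ k)) (*-monoˡ (ℚ.<⇒≤ (Defs.0<recip 0<√)) √≤k+2))
        (ℚ.≤-reflexive (trans (lemma (ι (2 ℕ.+ k)) (recip r) ⟦ 2 ℕ.+ k ⟧)
          (trans (cong (_* recip r) (ι-inverse (2 ℕ.+ k))) (ℚ.*-identityˡ _)))))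
      where
      lemma : ∀ a b c → a * (b * c) ≡ c * a * b
      lemma = solve-∀ ring

  -- Shaped to agree by computation with the m-th approximation of the real right-hand side, up to
  -- the k-th power, for which `approx-^` is needed.
  right-approx : ℕ → ℕ → ℕ → ℚ
  right-approx k n m = (⟦ 2 ⟧ + e-approx m) * recip (√approx (suc m) (2πk k m))
    * (e-approx m * (e-approx m * 1ℚ) * log-approx n m) ^ k * ⟦ n ℕ.^ (k ℕ.∸ 1) ⟧

  0≤y : ∀ n → 0ℚ ≤ y n
  0≤y n = 0≤* (0≤// 64 9) (0≤harmonic 1 (n ℕ.∸ 1))

  0≤bound : ∀ k n → 0ℚ ≤ bound k n
  0≤bound k n = 0≤* (0≤* (0≤* (0≤// 14 3) (0≤ι (2 ℕ.+ k))) (0≤^ k (0≤y n))) (0≤⟦⟧ (n ℕ.^ (k ℕ.∸ 1)))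

  bound≤right : ∀ k n m .{{_ : ℕ.NonZero k}} → 4 ℕ.≤ m → bound k n ≤ right-approx k n m
  bound≤right k n m 4≤m = *-monoʳ (0≤⟦⟧ (n ℕ.^ (k ℕ.∸ 1)))
    (*-mono (0≤* (0≤// 14 3) (0≤ι (2 ℕ.+ k)))
      (*-mono (0≤// 14 3) (ℚ.+-monoʳ-≤ ⟦ 2 ⟧ e≥) (0≤ι (2 ℕ.+ k)) (ι≤recip k m))
      (0≤^ k (0≤y n))
      (^-mono k (0≤y n) (*-mono (0≤// 64 9) (*-mono (0≤// 8 3) e≥ (0≤// 8 3) (subst (8 // 3 ≤_) (sym (ℚ.*-identityʳ _)) e≥))
        (0≤harmonic 1 (n ℕ.∸ 1)) (ℓ≤log-approx n m))))
    where
    e≥ : 8 // 3 ≤ e-approx m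
    e≥ = subst (λ t → 8 // 3 ≤ e-approx t) (ℕ.m+[n∸m]≡n 4≤m) (8/3≤e (m ℕ.∸ 4))

  rational-bound : ∀ k n m .{{_ : ℕ.NonZero k}} → k ℕ.+ 1 ℕ.< n → n ℕ.< m → ∣ ⟦ A k n ⟧ - main-term k n m ∣ ≤ bound k n
  rational-bound 1 1 m (s≤s ()) n<m
  rational-bound 1 (suc (suc n′)) m h n<m = subst (_≤ bound 1 (suc (suc n′)))
    (sym (≡⇒∣-∣≡0 (Totient.A-totient n′ m n<m))) (0≤bound 1 (suc (suc n′)))
  rational-bound (suc (suc i)) n m h n<m = subst (λ t → ∣ ⟦ A k t ⟧ - main-term k t m ∣ ≤ bound k t) N+k≡n (cases (N ℕ.+ k ℕ.<? 2048))
    where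
    k = suc (suc i)
    N = n ℕ.∸ k
    k+1<n : suc (suc k) ℕ.≤ n
    k+1<n = subst (λ t → suc t ℕ.≤ n) (ℕ.+-comm k 1) h
    N+k≡n : N ℕ.+ k ≡ n
    N+k≡n = ℕ.m∸n+n≡m (ℕ.≤-trans (ℕ.n≤1+n k) (ℕ.≤-trans (ℕ.n≤1+n (suc k)) k+1<n))
    N+k<m : N ℕ.+ k ℕ.< m
    N+k<m = subst (ℕ._< m) (sym N+k≡n) n<m
    open General i N m N+k<m
    cases : Dec (N ℕ.+ k ℕ.< 2048) → ∣ ⟦ A k (N ℕ.+ k) ⟧ - main-term k (N ℕ.+ k) m ∣ ≤ bound k (N ℕ.+ k)
    cases (yes n<2048) = ℚ.≤-trans A-trivial (volume≤bound i (N ℕ.+ k)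
      (subst (4 ℕ.≤_) (sym N+k≡n) (ℕ.≤-trans (s≤s (s≤s (s≤s (s≤s z≤n)))) k+1<n)) n<2048)
    cases (no n≮2048)  = ℚ.≤-trans A-error (error≤bound i (N ℕ.+ k) (ℕ.≮⇒≥ n≮2048))

open import Defs
open Approximations using (approx-^; right-approx; rational-bound; bound≤right)

theorem2 : (k n : ℕ) .{{_ : ℕ.NonZero k}} → k ℕ.+ 1 ℕ.< n →
    ∣ fromℕ (A k n) - C k * fromℚ (f k n) * fromℚ (_//_ (n ℕ.^ k) (k !) {{k !≢0}}) ∣
    ≤ (fromℕ 2 + e) / √ (fromℕ 2 * π * fromℕ k) * (e ^ 2 * log n) ^ k * fromℕ (n ℕ.^ (k ℕ.∸ 1))
-- m > n makes the sieve up to m exact, and m ≥ 4 gives `e-approx m` ≥ 8 / 3. From there on the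
-- approximations satisfy the inequality without slack, and ε is merely added.
theorem2 k n h ε 0<ε = ℕ.suc n ℕ.⊔ 4 , λ m N≤m → ℚ.≤-trans
  (rational-bound k n m h (ℕ.m⊔n≤o⇒m≤o (ℕ.suc n) 4 N≤m))
  (ℚ.≤-trans (bound≤right k n m (ℕ.m⊔n≤o⇒n≤o (ℕ.suc n) 4 N≤m))
    (ℚ.≤-trans (ℚ.≤-reflexive (right≡ m))
      (subst (ℚ._≤ approx right m ℚ.+ ε) (ℚ.+-identityʳ (approx right m)) (ℚ.+-monoʳ-≤ (approx right m) (ℚ.<⇒≤ 0<ε)))))
  where
  right : ℝ
  right = (fromℕ 2 + e) / √ (fromℕ 2 * π * fromℕ k) * (e ^ 2 * log n) ^ k * fromℕ (n ℕ.^ (k ℕ.∸ 1))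
  right≡ : ∀ m → right-approx k n m ≡ approx right m
  right≡ m = cong (λ t → (approx (fromℕ 2 + e) m ℚ.* approx (reciprocal (√ (fromℕ 2 * π * fromℕ k)) √-positive) m) ℚ.* t ℚ.* approx (fromℕ (n ℕ.^ (k ℕ.∸ 1))) m)
    (sym (approx-^ (e ^ 2 * log n) k m))
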